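{- The following problem is decidable: given a finite set $\Sigma$, numbers $k,n$, and two quantifier-free interpretations $f,g:\mathsf E_k\Sigma\to\mathsf M^n1$, decide whether for every input tree $t\in\mathsf E_k\Sigma$ the output trees $f(t)$ and $g(t)$ are isomorphic.
   Context: $\mathsf E_k\Sigma$ is the class of finite unordered trees of height at most $k$ (height = maximal number of edges on a root-to-leaf path) with edges labelled by elements of the finite set $\Sigma$, in the edge representation: the universe is the set of edges; for each label $a\in\Sigma$ a unary relation selects edges with label $a$; and a unary function maps each edge to its parent edge, looping on edges leaving the root. $\mathsf M^n1$ is the class of unlabelled unordered trees of height at most $n$, represented as structures whose universe is the set of nodes with one binary parent-child relation. A quantifier-free interpretation $f:\mathcal C\to\mathcal D$ is given by a finite set $I$ of components, each $i$ with dimension $k_i\ge0$ and a quantifier-free formula $\varphi_i$ with $k_i$ free variables over the input vocabulary, such that the universe of $f(A)$ is $\coprod_{i\in I}\{\bar a\in A^{k_i}:A\models\varphi_i(\bar a)\}$, and for each $m$-ary output relation $R$ and components $i_1,\ldots,i_m$ a quantifier-free formula $\varphi$ with $k_{i_1}+\cdots+k_{i_m}$ free variables such that $f(A)\models R((i_1,\bar a_1),\ldots,(i_m,\bar a_m))$ iff $A\models\varphi(\bar a_1\cdots\bar a_m)$. The interpretations in the instance are assumed to produce outputs in $\mathsf M^n1$. -}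

module Defs where

open import Data.Nat using (ℕ; zero; suc; _+_)
open import Data.Fin using (Fin)
open import Data.Fin.Properties using () renaming (_≟_ to _≟ᶠ_)
open import Data.Bool using (Bool; true; false; T; not; _∧_; _∨_; if_then_else_)
open import Data.Unit using (⊤)
open import Data.Empty using (⊥)
open import Data.Product using (Σ; _×_; _,_)
open import Data.Sum using (_⊎_; inj₁; inj₂)
open import Data.Maybe using (Maybe; nothing; just)
open import Data.List using (List; []; _∷_)
open import Data.Vec using (Vec; lookup; _++_)
open import Relation.Nullary using (does)
open import Relation.Binary.Definitions using (DecidableEquality)
open import Relation.Binary.PropositionalEquality using (_≡_)
import Data.Sum.Properties as SumP
import Data.Maybe.Properties as MaybeP

-- Finite unordered rooted trees with edges labelled in L.
-- (Children are stored in a list; the order is irrelevant since all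
--  notions below are taken up to isomorphism of the derived structures.)

data Tree (L : Set) : Set where
  node : List (L × Tree L) → Tree L

Forest : Set → Set
Forest L = List (L × Tree L)

mutual
  HeightLE : {L : Set} → ℕ → Tree L → Set
  HeightLE k (node cs) = HeightLEF k cs

  HeightLEF : {L : Set} → ℕ → Forest L → Set
  HeightLEF k [] = ⊤
  HeightLEF zero (_ ∷ _) = ⊥
  HeightLEF (suc k) ((a , t) ∷ cs) = HeightLE k t × HeightLEF (suc k) cs

-- The edges of a tree: an edge of node cs is either the edge to the
-- i-th child (inj₁ nothing), an edge inside the i-th child (inj₁ (just e)),
-- or an edge among the later children (inj₂).
mutual
  Edge : {L : Set} → Tree L → Set
  Edge (node cs) = EdgeF cs

  EdgeF : {L : Set} → Forest L → Set
  EdgeF [] = ⊥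
  EdgeF ((a , t) ∷ cs) = Maybe (Edge t) ⊎ EdgeF cs

mutual
  edge-≟ : {L : Set} (t : Tree L) → DecidableEquality (Edge t)
  edge-≟ (node cs) = edgeF-≟ cs

  edgeF-≟ : {L : Set} (cs : Forest L) → DecidableEquality (EdgeF cs)
  edgeF-≟ [] ()
  edgeF-≟ ((a , t) ∷ cs) = SumP.≡-dec (MaybeP.≡-dec (edge-≟ t)) (edgeF-≟ cs)

mutual
  isTop : {L : Set} (t : Tree L) → Edge t → Bool
  isTop (node cs) e = isTopF cs e

  isTopF : {L : Set} (cs : Forest L) → EdgeF cs → Bool
  isTopF [] ()
  isTopF ((a , t) ∷ cs) (inj₁ nothing) = true
  isTopF ((a , t) ∷ cs) (inj₁ (just e)) = false
  isTopF ((a , t) ∷ cs) (inj₂ e) = isTopF cs e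

-- Parent edge; loops on edges leaving the root.
mutual
  parent : {L : Set} (t : Tree L) → Edge t → Edge t
  parent (node cs) e = parentF cs e

  parentF : {L : Set} (cs : Forest L) → EdgeF cs → EdgeF cs
  parentF [] ()
  parentF ((a , t) ∷ cs) (inj₁ nothing) = inj₁ nothing
  parentF ((a , t) ∷ cs) (inj₁ (just e)) =
    inj₁ (if isTop t e then nothing else just (parent t e))
  parentF ((a , t) ∷ cs) (inj₂ e) = inj₂ (parentF cs e)

mutual
  label : {L : Set} (t : Tree L) → Edge t → L
  label (node cs) e = labelF cs e

  labelF : {L : Set} (cs : Forest L) → EdgeF cs → L
  labelF [] ()
  labelF ((a , t) ∷ cs) (inj₁ nothing) = a
  labelF ((a , t) ∷ cs) (inj₁ (just e)) = label t e
  labelF ((a , t) ∷ cs) (inj₂ e) = labelF cs e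

-- Quantifier-free formulas over the vocabulary of E_k Σ (Σ = Fin s):
-- unary predicates P_a (a : Fin s), unary function parent, equality;
-- m free variables.

data Term (m : ℕ) : Set where
  var : Fin m → Term m
  par : Term m → Term m

data QF (s m : ℕ) : Set where
  tt ff : QF s m
  _≐_   : Term m → Term m → QF s m
  lab   : Fin s → Term m → QF s m
  neg   : QF s m → QF s m
  _and_ : QF s m → QF s m → QF s m
  _or_  : QF s m → QF s m → QF s m

evalTerm : {s m : ℕ} (t : Tree (Fin s)) → Vec (Edge t) m → Term m → Edge t
evalTerm t v (var x) = lookup v x
evalTerm t v (par u) = parent t (evalTerm t v u)

evalQF : {s m : ℕ} (t : Tree (Fin s)) → Vec (Edge t) m → QF s m → Bool
evalQF t v tt = true
evalQF t v ff = false
evalQF t v (u ≐ w) = does (edge-≟ t (evalTerm t v u) (evalTerm t v w))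
evalQF t v (lab a u) = does (label t (evalTerm t v u) ≟ᶠ a)
evalQF t v (neg φ) = not (evalQF t v φ)
evalQF t v (φ and ψ) = evalQF t v φ ∧ evalQF t v ψ
evalQF t v (φ or ψ) = evalQF t v φ ∨ evalQF t v ψ

record BinStr : Set₁ where
  field
    Carrier : Set
    Rel     : Carrier → Carrier → Set
open BinStr public

record _≅_ (A B : BinStr) : Set where
  field
    to      : Carrier A → Carrier B
    from    : Carrier B → Carrier A
    from∘to : ∀ x → from (to x) ≡ x
    to∘from : ∀ y → to (from y) ≡ y
    to-pres : ∀ x y → Rel A x y → Rel B (to x) (to y)
    to-refl : ∀ x y → Rel B (to x) (to y) → Rel A x y

-- Node representation of an unlabelled tree: nodes are the root (nothing)
-- and the lower endpoints of the edges (just e); Rel x y iff x is the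
-- parent of y.
parentNode : {L : Set} (t : Tree L) → Edge t → Maybe (Edge t)
parentNode t e = if isTop t e then nothing else just (parent t e)

data ChildOf {L : Set} (t : Tree L) : Maybe (Edge t) → Maybe (Edge t) → Set where
  child : (e : Edge t) → ChildOf t (parentNode t e) (just e)

nodeStr : Tree ⊤ → BinStr
nodeStr t = record { Carrier = Maybe (Edge t) ; Rel = ChildOf t }

InM : ℕ → BinStr → Set
InM n S = Σ (Tree ⊤) λ t → HeightLE n t × (S ≅ nodeStr t)


record Interp (s : ℕ) : Set where
  field
    comps : ℕ
    dim   : Fin comps → ℕ
    dom   : (i : Fin comps) → QF s (dim i)
    rel   : (i j : Fin comps) → QF s (dim i + dim j)
open Interp public

apply : {s : ℕ} → Interp s → Tree (Fin s) → BinStr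
apply f t = record
  { Carrier = Σ (Fin (comps f)) λ i → Σ (Vec (Edge t) (dim f i)) λ v → T (evalQF t v (dom f i))
  ; Rel = λ { (i , v , _) (j , w , _) → T (evalQF t (v ++ w) (rel f i j)) }
  }

{-# OPTIONS --safe #-}

-- An output tree is compared with another one by colour refinement: two nodes
-- x and y have the same colour at level n + 1 iff they have equally many
-- children of each colour of level n. With ε z = [z child of x] - [z child of y]
-- this says that Q x y = Σ_{z,w} ε z * ε w * [z and w have the same colour]
-- vanishes, because Q is the sum of the squares of the class weights of ε.
-- Replace the colouring S n, which depends on the input tree, by an equivalence
-- E n on tuples of edges that does not: E (n + 1) x y iff Q, formed with E n,
-- vanishes on every input tree that contains x and y. Then
-- (1) E n is decidable: Q counts tuples, so it vanishes on all trees as soon as it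
--     vanishes on those generated by x, y and one pair (z , w), and up to
--     renaming there are finitely many of these;
-- (2) E n refines S n in every input tree;
-- (3) Q is a polynomial in the number N of a-labelled leaves added at a node, so
--     if it is not zero it is not zero for all large N. Choosing all numbers of
--     children from the root downwards, each large enough, gives one input tree in
--     which S n and E n agree.
-- Hence the outputs are isomorphic on all inputs iff E relates two virtual roots,
-- whose children are all the nodes of the first and of the second output.

module Submission where

open import Defs
open import Data.Nat using (ℕ)
open import Data.Fin using (Fin)
open import Relation.Nullary using (Dec)

open import Data.Nat as ℕ using (zero; suc; _≤_; _<_; z≤n; s≤s; _⊔_)
import Data.Nat.Properties as ℕₚ
open import Data.Integer using (ℤ; 0ℤ; 1ℤ; +_; -[1+_])
  renaming (_+_ to _+ᶻ_; _*_ to _*ᶻ_; _-_ to _-ᶻ_; _≤_ to _≤ᶻ_; -_ to -ᶻ_)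
import Data.Integer as ℤ
import Data.Integer.Properties as ℤₚ
open import Data.Integer.Tactic.RingSolver using (solve-∀)
import Data.Fin.Properties as Finₚ
open import Data.Bool using (Bool; true; false; not; T; if_then_else_; _∧_; _∨_)
import Data.Bool.Properties as Boolₚ
import Data.Maybe
open import Data.Maybe using (Maybe; just; nothing)
open import Data.Unit using (⊤) renaming (tt to unit)
open import Data.Empty using (⊥; ⊥-elim)
open import Data.Product using (Σ; ∃; _×_; _,_; proj₁; proj₂)
import Data.Product.Properties as Prodₚ
open import Data.Sum using (_⊎_; inj₁; inj₂)
open import Data.List using (List; []; _∷_; map; _++_; filter; length; downFrom; upTo; allFin;
  concatMap; cartesianProductWith; cartesianProduct; deduplicate)
import Data.List.Properties as Listₚ
open import Data.List.Membership.Propositional using (_∈_; _∉_; lose; find)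
open import Data.List.Membership.Propositional.Properties
open import Data.List.Membership.Propositional.Properties.WithK using (unique∧set⇒bag)
open import Data.List.Relation.Binary.BagAndSetEquality using (∼bag⇒↭)
open import Data.List.Relation.Binary.Permutation.Propositional using (_↭_; ↭-sym; prep; swap)
  renaming (refl to ↭-refl; trans to ↭-trans)
open import Data.List.Relation.Binary.Permutation.Propositional.Properties using (shift)
open import Data.List.Relation.Unary.Any using (here; there; any?)
open import Data.List.Relation.Unary.All as All using (All; []; _∷_; all?)
import Data.List.Relation.Unary.All.Properties as Allₚ
open import Data.List.Relation.Unary.AllPairs using ([]; _∷_)
open import Data.List.Relation.Unary.Unique.Propositional using (Unique)
import Data.List.Relation.Unary.Unique.Propositional.Properties as Uniq
import Data.List.Relation.Unary.Unique.DecPropositional.Properties as DecUniq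
open import Data.Vec as Vec using (Vec; []; _∷_; toList)
import Data.Vec.Properties as Vecₚ
open import Function using (_∘_; id; mk⇔)
open import Relation.Binary.Definitions using (DecidableEquality)
open import Relation.Binary.PropositionalEquality
open import Relation.Nullary using (yes; no; ¬_; does; ¬?; _×-dec_)
open import Relation.Nullary.Decidable using (dec-true; dec-false)
open import Relation.Unary using (Decidable)

open ≡-Reasoning

-- The form Q packs all the class counts into one integer. No class has to be named, and the summand
-- depends only on a pair of nodes. This forces the replacement of S by E: with the colours of the
-- current tree in the summand, adding leaves would change the colours as well as the range of
-- summation, and Q need not be polynomial in the number of leaves. Two obstacles remain. Q is a sum
-- of squares only over an equivalence, but a tree that separates x from w need not contain y; so
-- the transitivity of E already relies on polynomiality. Moreover, one tree has to separate
-- infinitely many pairs, while polynomiality gives a threshold for each pair alone. Everything is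
-- invariant under exchanging equally labelled siblings together with their subtrees. Exchanges
-- among large indices do not move the nodes whose numbers of children are already fixed, and they
-- leave finitely many pairs, so a common threshold exists for the next number. The virtual roots
-- have all nodes as children because being the root of the output is not a quantifier-free
-- condition; the true roots are recovered afterwards from the lengths of descending chains.

private variable
  A B C : Set
  s : ℕ

-- Finite sums of integers

sumL : List A → (A → ℤ) → ℤ
sumL []       f = 0ℤ
sumL (x ∷ xs) f = f x +ᶻ sumL xs f

⟦_⟧ : Bool → ℤ
⟦ true ⟧  = 1ℤ
⟦ false ⟧ = 0ℤ

interchange : ∀ a b c d → (a +ᶻ b) +ᶻ (c +ᶻ d) ≡ (a +ᶻ c) +ᶻ (b +ᶻ d)
interchange = solve-∀

sum-cong : (xs : List A) {f g : A → ℤ} → (∀ {x} → x ∈ xs → f x ≡ g x) → sumL xs f ≡ sumL xs g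
sum-cong []       e = refl
sum-cong (x ∷ xs) e = cong₂ _+ᶻ_ (e (here refl)) (sum-cong xs (e ∘ there))

sum-ext : (xs : List A) {f g : A → ℤ} → (∀ x → f x ≡ g x) → sumL xs f ≡ sumL xs g
sum-ext xs e = sum-cong xs (λ {x} _ → e x)

sum-zero : (xs : List A) {f : A → ℤ} → (∀ {x} → x ∈ xs → f x ≡ 0ℤ) → sumL xs f ≡ 0ℤ
sum-zero []       e = refl
sum-zero (x ∷ xs) e = cong₂ _+ᶻ_ (e (here refl)) (sum-zero xs (e ∘ there))

sum-+ : (xs : List A) (f g : A → ℤ) → sumL xs (λ x → f x +ᶻ g x) ≡ sumL xs f +ᶻ sumL xs g
sum-+ []       f g = refl
sum-+ (x ∷ xs) f g = trans (cong (λ s → f x +ᶻ g x +ᶻ s) (sum-+ xs f g)) (interchange (f x) (g x) _ _)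

sum-- : (xs : List A) (f g : A → ℤ) → sumL xs (λ x → f x -ᶻ g x) ≡ sumL xs f -ᶻ sumL xs g
sum-- []       f g = refl
sum-- (x ∷ xs) f g = trans (cong (λ s → f x -ᶻ g x +ᶻ s) (sum-- xs f g)) (alg (f x) (g x) _ _)
  where
  alg : ∀ a b c d → (a -ᶻ b) +ᶻ (c -ᶻ d) ≡ (a +ᶻ c) -ᶻ (b +ᶻ d)
  alg = solve-∀

sum-*ˡ : (xs : List A) (c : ℤ) (f : A → ℤ) → sumL xs (λ x → c *ᶻ f x) ≡ c *ᶻ sumL xs f
sum-*ˡ []       c f = sym (ℤₚ.*-zeroʳ c)
sum-*ˡ (x ∷ xs) c f = trans (cong (c *ᶻ f x +ᶻ_) (sum-*ˡ xs c f)) (sym (ℤₚ.*-distribˡ-+ c (f x) _))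

sum-*ʳ : (xs : List A) (f : A → ℤ) (c : ℤ) → sumL xs (λ x → f x *ᶻ c) ≡ sumL xs f *ᶻ c
sum-*ʳ xs f c = trans (sum-ext xs (λ x → ℤₚ.*-comm (f x) c))
                      (trans (sum-*ˡ xs c f) (ℤₚ.*-comm c _))

sum-++ : (xs ys : List A) (f : A → ℤ) → sumL (xs ++ ys) f ≡ sumL xs f +ᶻ sumL ys f
sum-++ []       ys f = sym (ℤₚ.+-identityˡ _)
sum-++ (x ∷ xs) ys f = trans (cong (f x +ᶻ_) (sum-++ xs ys f)) (sym (ℤₚ.+-assoc (f x) _ _))

sum-map : (h : A → B) (xs : List A) (f : B → ℤ) → sumL (map h xs) f ≡ sumL xs (f ∘ h)
sum-map h []       f = refl
sum-map h (x ∷ xs) f = cong (f (h x) +ᶻ_) (sum-map h xs f)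

sum-concatMap : (h : A → List B) (xs : List A) (f : B → ℤ) →
  sumL (concatMap h xs) f ≡ sumL xs (λ x → sumL (h x) f)
sum-concatMap h []       f = refl
sum-concatMap h (x ∷ xs) f =
  trans (sum-++ (h x) (concatMap h xs) f) (cong (sumL (h x) f +ᶻ_) (sum-concatMap h xs f))

sum-cartesianProductWith : (h : A → B → C) (xs : List A) (ys : List B) (f : C → ℤ) →
  sumL (cartesianProductWith h xs ys) f ≡ sumL xs (λ x → sumL ys (λ y → f (h x y)))
sum-cartesianProductWith h []       ys f = refl
sum-cartesianProductWith h (x ∷ xs) ys f =
  trans (sum-++ (map (h x) ys) (cartesianProductWith h xs ys) f)
        (cong₂ _+ᶻ_ (sum-map (h x) ys f) (sum-cartesianProductWith h xs ys f))

sum-↭ : {xs ys : List A} (f : A → ℤ) → xs ↭ ys → sumL xs f ≡ sumL ys f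
sum-↭ f ↭-refl           = refl
sum-↭ f (prep x p)       = cong (f x +ᶻ_) (sum-↭ f p)
sum-↭ f (swap x y p) =
  trans (cong (λ s → f x +ᶻ (f y +ᶻ s)) (sum-↭ f p)) (alg (f x) (f y) _)
  where
  alg : ∀ a b c → a +ᶻ (b +ᶻ c) ≡ b +ᶻ (a +ᶻ c)
  alg = solve-∀
sum-↭ f (↭-trans p q)    = trans (sum-↭ f p) (sum-↭ f q)

module _ {P : A → Set} (P? : Decidable P) where

  sum-filter : (xs : List A) (f : A → ℤ) →
    sumL (filter P? xs) f ≡ sumL xs (λ x → ⟦ does (P? x) ⟧ *ᶻ f x)
  sum-filter []       f = refl
  sum-filter (x ∷ xs) f with does (P? x)
  ... | true  = cong₂ _+ᶻ_ (sym (ℤₚ.*-identityˡ (f x))) (sum-filter xs f)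
  ... | false = trans (sum-filter xs f) (sym (ℤₚ.+-identityˡ _))

  sum-split : (xs : List A) (f : A → ℤ) →
    sumL xs f ≡ sumL (filter P? xs) f +ᶻ sumL (filter (¬? ∘ P?) xs) f
  sum-split []       f = refl
  sum-split (x ∷ xs) f with does (P? x)
  ... | true  = trans (cong (f x +ᶻ_) (sum-split xs f)) (sym (ℤₚ.+-assoc (f x) _ _))
  ... | false = trans (cong (f x +ᶻ_) (sum-split xs f)) (alg (f x) (sumL (filter P? xs) f) (sumL (filter (¬? ∘ P?) xs) f))
    where
    alg : ∀ a b c → a +ᶻ (b +ᶻ c) ≡ b +ᶻ (a +ᶻ c)
    alg = solve-∀

  filter-shorter : {xs : List A} {x : A} → x ∈ xs → ¬ P x → length (filter P? xs) < length xs
  filter-shorter {xs} x∈ ¬p = Listₚ.filter-notAll P? xs (lose x∈ ¬p)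

unique-set-↭ : {xs ys : List A} → Unique xs → Unique ys →
  (∀ {x} → x ∈ xs → x ∈ ys) → (∀ {x} → x ∈ ys → x ∈ xs) → xs ↭ ys
unique-set-↭ u v f g = ∼bag⇒↭ (unique∧set⇒bag u v (mk⇔ f g))

sum-support : {xs ys : List A} → Unique xs → Unique ys → (f : A → ℤ) →
  (∀ {x} → f x ≢ 0ℤ → x ∈ xs → x ∈ ys) → (∀ {x} → f x ≢ 0ℤ → x ∈ ys → x ∈ xs) →
  sumL xs f ≡ sumL ys f
sum-support {A} {xs} {ys} u v f to from = begin
  sumL xs f ≡⟨ nonzero-part xs ⟩
  sumL (filter nz? xs) f
    ≡⟨ sum-↭ f (unique-set-↭ (Uniq.filter⁺ nz? u) (Uniq.filter⁺ nz? v) (move to) (move from)) ⟩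
  sumL (filter nz? ys) f ≡⟨ nonzero-part ys ⟨
  sumL ys f ∎
  where
  nz? : Decidable (λ x → f x ≢ 0ℤ)
  nz? x = ¬? (f x ℤ.≟ 0ℤ)
  move : {xs ys : List A} → (∀ {x} → f x ≢ 0ℤ → x ∈ xs → x ∈ ys) →
    ∀ {x} → x ∈ filter nz? xs → x ∈ filter nz? ys
  move {xs} to m with ∈-filter⁻ nz? {xs = xs} m
  ... | x∈ , nz = ∈-filter⁺ nz? (to nz x∈) nz
  nonzero-part : (zs : List A) → sumL zs f ≡ sumL (filter nz? zs) f
  nonzero-part zs = begin
    sumL zs f ≡⟨ sum-split nz? zs f ⟩
    sumL (filter nz? zs) f +ᶻ sumL (filter (¬? ∘ nz?) zs) f
      ≡⟨ cong (sumL (filter nz? zs) f +ᶻ_) (sum-zero _ vanish) ⟩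
    sumL (filter nz? zs) f +ᶻ 0ℤ ≡⟨ ℤₚ.+-identityʳ _ ⟩
    sumL (filter nz? zs) f ∎
    where
    vanish : ∀ {x} → x ∈ filter (¬? ∘ nz?) zs → f x ≡ 0ℤ
    vanish {x} m with f x ℤ.≟ 0ℤ | proj₂ (∈-filter⁻ (¬? ∘ nz?) {xs = zs} m)
    ... | yes e | _  = e
    ... | no ne | nn = ⊥-elim (nn ne)

sq≥0 : ∀ a → 0ℤ ≤ᶻ a *ᶻ a
sq≥0 (+ zero)  = ℤ.+≤+ z≤n
sq≥0 (+ suc n) = ℤ.+≤+ z≤n
sq≥0 -[1+ n ]  = ℤ.+≤+ z≤n

+-zero-parts : ∀ {a b} → 0ℤ ≤ᶻ a → 0ℤ ≤ᶻ b → a +ᶻ b ≡ 0ℤ → a ≡ 0ℤ × b ≡ 0ℤ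
+-zero-parts {+ zero} {+ zero} _ _ _ = refl , refl
+-zero-parts {+ zero} {+ suc n} _ _ ()
+-zero-parts {+ suc m} {+ n} _ _ ()

sq-zero : ∀ a → a *ᶻ a ≡ 0ℤ → a ≡ 0ℤ
sq-zero a e with ℤₚ.i*j≡0⇒i≡0∨j≡0 a e
... | inj₁ z = z
... | inj₂ z = z

-- Quadratic forms over an equivalence relation

cls : (A → A → Bool) → (A → ℤ) → List A → A → ℤ
cls R ε L c = sumL L (λ w → ε w *ᶻ ⟦ R w c ⟧)

quad : (A → A → Bool) → (A → ℤ) → List A → ℤ
quad R ε L = sumL L (λ z → sumL L (λ w → ε z *ᶻ ε w *ᶻ ⟦ R z w ⟧))

-- The laws are demanded on `P` only: from level one on, `E` relates a node that lies in no tree to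
-- every node, so transitivity is available among valid nodes only.
record IsEqᵇ (P : A → Set) (R : A → A → Bool) : Set where
  field
    rfl : ∀ {x} → P x → R x x ≡ true
    sm  : ∀ {x y} → P x → P y → R x y ≡ true → R y x ≡ true
    trn : ∀ {x y z} → P x → P y → P z → R x y ≡ true → R y z ≡ true → R x z ≡ true

  sm≡ : ∀ {x y} → P x → P y → R x y ≡ R y x
  sm≡ {x} {y} px py with R x y in e | R y x in e'
  ... | true  | true  = refl
  ... | false | false = refl
  ... | true  | false = trans (sym (sm px py e)) e'
  ... | false | true  = trans (sym e) (sm py px e')

  left≡ : ∀ {x y z} → P x → P y → P z → R x y ≡ true → R x z ≡ R y z
  left≡ {x} {y} {z} px py pz xy with R x z in e | R y z in e'
  ... | true  | true  = refl
  ... | false | false = refl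
  ... | true  | false = trans (sym (trn py px pz (sm px py xy) e)) e'
  ... | false | true  = trans (sym e) (trn px py pz xy e')

  right≡ : ∀ {x y z} → P x → P y → P z → R x y ≡ true → R z x ≡ R z y
  right≡ px py pz xy = trans (sm≡ pz px) (trans (left≡ px py pz xy) (sm≡ py pz))

module _ {P : A → Set} {R : A → A → Bool} (eq : IsEqᵇ P R) (ε : A → ℤ) where
  open IsEqᵇ eq

  private
    inC : (c w : A) → Dec (R w c ≡ true)
    inC c w = R w c Data.Bool.≟ true

    does-inC : ∀ c w → does (inC c w) ≡ R w c
    does-inC c w with R w c
    ... | true = refl
    ... | false = refl

    rest : A → List A → List A
    rest c L = filter (¬? ∘ inC c) L

    rest⊆ : ∀ {c L z} → z ∈ rest c L → z ∈ L × ¬ (R z c ≡ true)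
    rest⊆ {c} {L} = ∈-filter⁻ (¬? ∘ inC c) {xs = L}

    ∈P : ∀ {L} → All P L → ∀ {z} → z ∈ L → P z
    ∈P = All.lookup

  cls-invariant : ∀ L → All P L → ∀ {c z} → P c → P z → R z c ≡ true → cls R ε L z ≡ cls R ε L c
  cls-invariant L pL pc pz zc =
    sum-cong L (λ w∈ → cong (λ b → ε _ *ᶻ ⟦ b ⟧) (right≡ pz pc (∈P pL w∈) zc))

  private
    sum-class : ∀ L c → sumL (filter (inC c) L) ε ≡ cls R ε L c
    sum-class L c = trans (sum-filter (inC c) L ε)
      (sum-ext L (λ w → trans (cong (λ b → ⟦ b ⟧ *ᶻ ε w) (does-inC c w)) (ℤₚ.*-comm ⟦ R w c ⟧ (ε w))))

    cls-rest : ∀ L → All P L → ∀ {c z} → P c → z ∈ rest c L → cls R ε L z ≡ cls R ε (rest c L) z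
    cls-rest L pL {c} {z} pc z∈ = begin
      cls R ε L z ≡⟨ sum-split (inC c) L _ ⟩
      sumL (filter (inC c) L) g +ᶻ cls R ε (rest c L) z
        ≡⟨ cong (_+ᶻ cls R ε (rest c L) z) (sum-zero _ off) ⟩
      0ℤ +ᶻ cls R ε (rest c L) z ≡⟨ ℤₚ.+-identityˡ _ ⟩
      cls R ε (rest c L) z ∎
      where
      g = λ w → ε w *ᶻ ⟦ R w z ⟧
      pz = ∈P pL (proj₁ (rest⊆ {c} {L} z∈))
      off : ∀ {w} → w ∈ filter (inC c) L → g w ≡ 0ℤ
      off {w} m with ∈-filter⁻ (inC c) {xs = L} m
      ... | w∈ , wc with R w z in e
      ...   | false = ℤₚ.*-zeroʳ (ε w)
      ...   | true  = ⊥-elim (proj₂ (rest⊆ {c} {L} z∈)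
                (trn pz (∈P pL w∈) pc (sm (∈P pL w∈) pz e) wc))

    rest-P : ∀ c L → All P L → All P (rest c L)
    rest-P c L pL = All.tabulate (λ m → ∈P pL (proj₁ (rest⊆ {c} {L} m)))

    rest-shorter : ∀ c L → P c → length (rest c (c ∷ L)) < length (c ∷ L)
    rest-shorter c L pc = filter-shorter (¬? ∘ inC c) (here refl) (λ f → f (rfl pc))

  quad≡ : ∀ L → All P L → quad R ε L ≡ sumL L (λ z → ε z *ᶻ cls R ε L z)
  quad≡ L pL = sum-cong L λ {z} z∈ → trans
    (sum-cong L (λ {w} w∈ → trans (ℤₚ.*-assoc (ε z) (ε w) _)
      (cong (λ b → ε z *ᶻ (ε w *ᶻ ⟦ b ⟧)) (sm≡ (∈P pL z∈) (∈P pL w∈)))))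
    (sum-*ˡ L (ε z) _)

  -- On each class `h` is constant, so the class contributes its weight times that constant. The
  -- recursion removes the class of the head, which is not structural; `n` bounds the length. In the
  -- application `R` is `E` and `h` indicates a class of the coarser colouring.
  invariant-sum-zero : ∀ n L → length L ≤ n → All P L → (∀ {c} → c ∈ L → cls R ε L c ≡ 0ℤ) →
    (h : A → ℤ) → (∀ {x y} → x ∈ L → y ∈ L → R x y ≡ true → h x ≡ h y) →
    sumL L (λ z → ε z *ᶻ h z) ≡ 0ℤ
  invariant-sum-zero n [] le pL z h inv = refl
  invariant-sum-zero (suc n) L@(c ∷ L') le pL@(pc ∷ _) z h inv = begin
    sumL L (λ z → ε z *ᶻ h z) ≡⟨ sum-split (inC c) L _ ⟩
    sumL (filter (inC c) L) (λ z → ε z *ᶻ h z) +ᶻ sumL (rest c L) (λ z → ε z *ᶻ h z)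
      ≡⟨ cong₂ _+ᶻ_ first second ⟩
    0ℤ ∎
    where
    first : sumL (filter (inC c) L) (λ z → ε z *ᶻ h z) ≡ 0ℤ
    first = begin
      sumL (filter (inC c) L) (λ z → ε z *ᶻ h z)
        ≡⟨ sum-cong (filter (inC c) L) (λ {w} m → let w∈ , wc = ∈-filter⁻ (inC c) {xs = L} m in
             cong (ε w *ᶻ_) (inv w∈ (here refl) wc)) ⟩
      sumL (filter (inC c) L) (λ z → ε z *ᶻ h c) ≡⟨ sum-*ʳ (filter (inC c) L) ε (h c) ⟩
      sumL (filter (inC c) L) ε *ᶻ h c
        ≡⟨ cong (_*ᶻ h c) (trans (sum-class L c) (z (here refl))) ⟩
      0ℤ *ᶻ h c ≡⟨ ℤₚ.*-zeroˡ (h c) ⟩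
      0ℤ ∎
    second : sumL (rest c L) (λ z → ε z *ᶻ h z) ≡ 0ℤ
    second = invariant-sum-zero n (rest c L) (ℕₚ.≤-pred (ℕₚ.≤-trans (rest-shorter c L' pc) le))
      (rest-P c L pL)
      (λ {d} m → trans (sym (cls-rest L pL pc m)) (z (proj₁ (rest⊆ {c} {L} m)))) h
      (λ m m' → inv (proj₁ (rest⊆ {c} {L} m)) (proj₁ (rest⊆ {c} {L} m')))

  classes-zero⇒quad-zero : ∀ L → All P L → (∀ {c} → c ∈ L → cls R ε L c ≡ 0ℤ) → quad R ε L ≡ 0ℤ
  classes-zero⇒quad-zero L pL z = trans (quad≡ L pL)
    (sum-zero L (λ {w} m → trans (cong (ε w *ᶻ_) (z m)) (ℤₚ.*-zeroʳ (ε w))))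

  -- The form is the sum, over the classes of R, of the squares of the class weights.
  quad-psd : ∀ n L → length L ≤ n → All P L →
    0ℤ ≤ᶻ quad R ε L × (quad R ε L ≡ 0ℤ → ∀ {c} → c ∈ L → cls R ε L c ≡ 0ℤ)
  quad-psd n [] le pL = ℤ.+≤+ z≤n , λ _ ()
  quad-psd (suc n) L@(c ∷ L') le pL@(pc ∷ _) =
    subst (0ℤ ≤ᶻ_) (sym decomp) (ℤₚ.+-mono-≤ (sq≥0 wt) ih≥) , zeros
    where
    wt = cls R ε L c
    Y = rest c L
    pY = rest-P c L pL
    ih = quad-psd n Y (ℕₚ.≤-pred (ℕₚ.≤-trans (rest-shorter c L' pc) le)) pY
    ih≥ = proj₁ ih
    first : sumL (filter (inC c) L) (λ z → ε z *ᶻ cls R ε L z) ≡ wt *ᶻ wt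
    first = begin
      sumL (filter (inC c) L) (λ z → ε z *ᶻ cls R ε L z)
        ≡⟨ sum-cong (filter (inC c) L) (λ {w} m → let w∈ , wc = ∈-filter⁻ (inC c) {xs = L} m in
             cong (ε w *ᶻ_) (cls-invariant L pL pc (∈P pL w∈) wc)) ⟩
      sumL (filter (inC c) L) (λ z → ε z *ᶻ wt) ≡⟨ sum-*ʳ (filter (inC c) L) ε wt ⟩
      sumL (filter (inC c) L) ε *ᶻ wt ≡⟨ cong (_*ᶻ wt) (sum-class L c) ⟩
      wt *ᶻ wt ∎
    decomp : quad R ε L ≡ wt *ᶻ wt +ᶻ quad R ε Y
    decomp = begin
      quad R ε L ≡⟨ quad≡ L pL ⟩
      sumL L (λ z → ε z *ᶻ cls R ε L z) ≡⟨ sum-split (inC c) L _ ⟩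
      sumL (filter (inC c) L) (λ z → ε z *ᶻ cls R ε L z) +ᶻ sumL Y (λ z → ε z *ᶻ cls R ε L z)
        ≡⟨ cong₂ _+ᶻ_ first (sum-cong Y (λ {w} m → cong (ε w *ᶻ_) (cls-rest L pL pc m))) ⟩
      wt *ᶻ wt +ᶻ sumL Y (λ z → ε z *ᶻ cls R ε Y z) ≡⟨ cong (wt *ᶻ wt +ᶻ_) (quad≡ Y pY) ⟨
      wt *ᶻ wt +ᶻ quad R ε Y ∎
    zeros : quad R ε L ≡ 0ℤ → ∀ {d} → d ∈ L → cls R ε L d ≡ 0ℤ
    zeros q {d} d∈ with +-zero-parts (sq≥0 wt) ih≥ (trans (sym decomp) q) | inC c d
    ... | ss , qY | yes dc = trans (cls-invariant L pL pc (∈P pL d∈) dc) (sq-zero wt ss)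
    ... | ss , qY | no ¬dc = trans (cls-rest L pL pc m) (proj₂ ih qY m)
      where m = ∈-filter⁺ (¬? ∘ inC c) d∈ ¬dc

  quad-zero⇒classes-zero : ∀ L → All P L → quad R ε L ≡ 0ℤ → ∀ {c} → c ∈ L → cls R ε L c ≡ 0ℤ
  quad-zero⇒classes-zero L pL = proj₂ (quad-psd (length L) L ℕₚ.≤-refl pL)

-- Sums over the down-sets of a preorder

module _ {_≼_ : A → A → Set} (≼? : ∀ x y → Dec (x ≼ y))
         (≼-refl : ∀ {x} → x ≼ x) (≼-trans : ∀ {x y z} → x ≼ y → y ≼ z → x ≼ z) where

  -- If `w` is not minimal, the search moves to some `v` strictly below it and keeps only the
  -- elements below `v`. These do not include `w`, so the list gets shorter.
  minimal : ∀ n (W : List A) → length W ≤ n → ∀ {w} → w ∈ W →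
    ∃ λ m → m ∈ W × (∀ {v} → v ∈ W → v ≼ m → m ≼ v)
  minimal zero [] le ()
  minimal (suc n) W le {w} w∈ with any? (λ v → ≼? v w ×-dec ¬? (≼? w v)) W
  ... | no none = w , w∈ , λ {v} v∈ vw → smaller v v∈ vw
    where
    smaller : ∀ v → v ∈ W → v ≼ w → w ≼ v
    smaller v v∈ vw with ≼? w v
    ... | yes wv = wv
    ... | no ¬wv = ⊥-elim (none (lose v∈ (vw , ¬wv)))
  ... | yes some with find some
  ...   | v , v∈ , vw , ¬wv = m , proj₁ m∈ , λ {u} u∈ um →
            m-min (∈-filter⁺ below? u∈ (≼-trans um (proj₂ m∈))) um
    where
    below? = λ u → ≼? u v
    r = minimal n (filter below? W)
          (ℕₚ.≤-pred (ℕₚ.≤-trans (filter-shorter below? w∈ ¬wv) le)) (∈-filter⁺ below? v∈ ≼-refl)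
    m = proj₁ r
    m∈ = ∈-filter⁻ below? {xs = W} (proj₁ (proj₂ r))
    m-min = proj₂ (proj₂ r)

  -- A replacement for Möbius inversion. The elements below a minimal `m` are all equivalent to `m`.
  -- Their sum vanishes, and every down-set contains all of them or none, so deleting them changes
  -- neither the total nor any remaining down-sum.
  down-sums-zero⇒sum-zero : ∀ n (W : List A) → length W ≤ n → (χ : A → ℤ) →
    (∀ {w} → w ∈ W → sumL W (λ v → ⟦ does (≼? v w) ⟧ *ᶻ χ v) ≡ 0ℤ) → sumL W χ ≡ 0ℤ
  down-sums-zero⇒sum-zero n [] le χ z = refl
  down-sums-zero⇒sum-zero (suc n) W@(w₀ ∷ _) le χ z = begin
    sumL W χ ≡⟨ sum-split below? W χ ⟩
    sumL (filter below? W) χ +ᶻ sumL Y χ ≡⟨ cong₂ _+ᶻ_ classzero ih ⟩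
    0ℤ ∎
    where
    r = minimal (suc n) W le (here refl)
    m = proj₁ r
    m∈ = proj₁ (proj₂ r)
    m-min = proj₂ (proj₂ r)
    below? = λ u → ≼? u m
    Y = filter (¬? ∘ below?) W
    classzero : sumL (filter below? W) χ ≡ 0ℤ
    classzero = trans (sum-filter below? W χ) (z m∈)
    g : A → A → ℤ
    g w v = ⟦ does (≼? v w) ⟧ *ᶻ χ v
    constant : ∀ w → ∀ {v} → v ∈ filter below? W → g w v ≡ ⟦ does (≼? m w) ⟧ *ᶻ χ v
    constant w {v} v∈ with ∈-filter⁻ below? {xs = W} v∈
    ... | v∈W , vm = cong (λ b → ⟦ b ⟧ *ᶻ χ v) same
      where
      mv = m-min v∈W vm
      same : does (≼? v w) ≡ does (≼? m w)
      same with ≼? v w | ≼? m w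
      ... | yes _  | yes _  = refl
      ... | no _   | no _   = refl
      ... | yes vw | no ¬mw = ⊥-elim (¬mw (≼-trans mv vw))
      ... | no ¬vw | yes mw = ⊥-elim (¬vw (≼-trans vm mw))
    part : ∀ w → sumL (filter below? W) (g w) ≡ 0ℤ
    part w = begin
      sumL (filter below? W) (g w) ≡⟨ sum-cong _ (constant w) ⟩
      sumL (filter below? W) (λ v → ⟦ does (≼? m w) ⟧ *ᶻ χ v)
        ≡⟨ sum-*ˡ (filter below? W) ⟦ does (≼? m w) ⟧ χ ⟩
      ⟦ does (≼? m w) ⟧ *ᶻ sumL (filter below? W) χ
        ≡⟨ cong (⟦ does (≼? m w) ⟧ *ᶻ_) classzero ⟩
      ⟦ does (≼? m w) ⟧ *ᶻ 0ℤ ≡⟨ ℤₚ.*-zeroʳ ⟦ does (≼? m w) ⟧ ⟩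
      0ℤ ∎
    ih : sumL Y χ ≡ 0ℤ
    ih = down-sums-zero⇒sum-zero n Y
      (ℕₚ.≤-pred (ℕₚ.≤-trans (filter-shorter (¬? ∘ below?) m∈ (λ f → f ≼-refl)) le)) χ
      (λ {w} w∈ → begin
        sumL Y (g w) ≡⟨ ℤₚ.+-identityˡ _ ⟨
        0ℤ +ᶻ sumL Y (g w) ≡⟨ cong (_+ᶻ sumL Y (g w)) (part w) ⟨
        sumL (filter below? W) (g w) +ᶻ sumL Y (g w) ≡⟨ sum-split below? W (g w) ⟨
        sumL W (g w) ≡⟨ z (proj₁ (∈-filter⁻ (¬? ∘ below?) {xs = W} w∈)) ⟩
        0ℤ ∎)

-- Integer sequences and functions of lists with a vanishing iterated difference

-- The sign behaviour of polynomial sequences. The first case asks for zero everywhere and not just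
-- eventually, so that a single nonzero value excludes it.
Trichotomy : (ℕ → ℤ) → Set
Trichotomy g = (∀ j → g j ≡ 0ℤ)
  ⊎ (∃ λ b → ∀ j → b ≤ j → 1ℤ ≤ᶻ g j)
  ⊎ (∃ λ b → ∀ j → b ≤ j → g j ≤ᶻ ℤ.-1ℤ)

Δ : (ℕ → ℤ) → ℕ → ℤ
Δ g j = g (suc j) -ᶻ g j

Δ-step : ∀ g j → g (suc j) ≡ g j +ᶻ Δ g j
Δ-step g j = alg (g (suc j)) (g j)
  where
  alg : ∀ a b → a ≡ b +ᶻ (a -ᶻ b)
  alg = solve-∀

private
  growth : ∀ g b → (∀ j → b ≤ j → 1ℤ ≤ᶻ Δ g j) → ∀ i → g b +ᶻ + i ≤ᶻ g (i ℕ.+ b)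
  growth g b h zero = ℤₚ.≤-reflexive (ℤₚ.+-identityʳ (g b))
  growth g b h (suc i) = subst₂ _≤ᶻ_ (alg (g b) (+ i)) (sym (Δ-step g (i ℕ.+ b)))
    (ℤₚ.+-mono-≤ (growth g b h i) (h (i ℕ.+ b) (ℕₚ.m≤n+m b i)))
    where
    alg : ∀ x y → (x +ᶻ y) +ᶻ 1ℤ ≡ x +ᶻ (1ℤ +ᶻ y)
    alg = solve-∀

  enough : ∀ z → ∃ λ m → ∀ i → m ≤ i → 1ℤ ≤ᶻ z +ᶻ + i
  enough (+ n) = 1 , λ i le → ℤₚ.≤-trans (ℤ.+≤+ le) (ℤₚ.i≤j+i (+ i) (+ n))
  enough -[1+ n ] = suc (suc n) , λ i le → subst (1ℤ ≤ᶻ_) (ℤₚ.+-comm (+ i) -[1+ n ])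
    (subst (1ℤ ≤ᶻ_) (sym (ℤₚ.⊖-≥ (ℕₚ.≤-trans (ℕₚ.n≤1+n _) le)))
      (ℤ.+≤+ (ℕₚ.m<n⇒0<n∸m le)))

eventually-increasing : ∀ g → (∃ λ b → ∀ j → b ≤ j → 1ℤ ≤ᶻ Δ g j) →
  ∃ λ b → ∀ j → b ≤ j → 1ℤ ≤ᶻ g j
eventually-increasing g (b , h) with enough (g b)
... | m , big = m ℕ.+ b , λ j le →
  subst (λ x → 1ℤ ≤ᶻ g x) (ℕₚ.m∸n+n≡m (ℕₚ.≤-trans (ℕₚ.m≤n+m b m) le))
    (ℤₚ.≤-trans (big (j ℕ.∸ b) (ℕₚ.m+n≤o⇒m≤o∸n m le)) (growth g b h (j ℕ.∸ b)))

-- If the differences vanish, `g` is constant and the sign of `g 0` decides. If they are eventually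
-- all positive or all negative, `g` is unbounded in that direction.
Δ-trichotomy : ∀ g → Trichotomy (Δ g) → Trichotomy g
Δ-trichotomy g (inj₁ z) = constant (g 0) refl
  where
  same : ∀ j → g j ≡ g 0
  same zero    = refl
  same (suc j) = trans (Δ-step g j) (trans (cong₂ _+ᶻ_ (same j) (z j)) (ℤₚ.+-identityʳ _))
  constant : ∀ v → g 0 ≡ v → Trichotomy g
  constant (+ zero)  e = inj₁ (λ j → trans (same j) e)
  constant (+ suc n) e = inj₂ (inj₁ (0 , λ j _ → subst (1ℤ ≤ᶻ_) (sym (trans (same j) e)) (ℤ.+≤+ (s≤s z≤n))))
  constant -[1+ n ]  e = inj₂ (inj₂ (0 , λ j _ → subst (_≤ᶻ ℤ.-1ℤ) (sym (trans (same j) e)) (ℤ.-≤- z≤n)))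
Δ-trichotomy g (inj₂ (inj₁ up)) = inj₂ (inj₁ (eventually-increasing g up))
Δ-trichotomy g (inj₂ (inj₂ (b , down))) = inj₂ (inj₂ (proj₁ r , λ j le →
    subst (_≤ᶻ ℤ.-1ℤ) (ℤₚ.neg-involutive (g j)) (ℤₚ.neg-mono-≤ (proj₂ r j le))))
  where
  alg : ∀ a b → -ᶻ (a -ᶻ b) ≡ (-ᶻ a) -ᶻ (-ᶻ b)
  alg = solve-∀
  r = eventually-increasing (λ j → -ᶻ g j) (b , λ j le →
    subst (1ℤ ≤ᶻ_) (alg (g (suc j)) (g j)) (ℤₚ.neg-mono-≤ (down j le)))

trichotomy-nonzero : ∀ {g} → Trichotomy g → ∀ i → g i ≢ 0ℤ → ∃ λ b → ∀ j → b ≤ j → g j ≢ 0ℤ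
trichotomy-nonzero (inj₁ z) i nz = ⊥-elim (nz (z i))
trichotomy-nonzero {g} (inj₂ (inj₁ (b , h))) i nz = b , λ j le e → bad (subst (1ℤ ≤ᶻ_) e (h j le))
  where
  bad : ¬ (1ℤ ≤ᶻ 0ℤ)
  bad (ℤ.+≤+ ())
trichotomy-nonzero {g} (inj₂ (inj₂ (b , h))) i nz = b , λ j le e → bad (subst (_≤ᶻ ℤ.-1ℤ) e (h j le))
  where
  bad : ¬ (0ℤ ≤ᶻ ℤ.-1ℤ)
  bad ()

-- Polynomials of degree less than `D`, where a difference adjoins one element to the list. The
-- argument is the list of added elements and not their number, because the values in question
-- depend on the number alone only for lists of new indices.
PD : ℕ → (List A → ℤ) → Set
PD zero    H = ∀ X → H X ≡ 0ℤ
PD (suc D) H = ∀ ℓ → PD D (λ X → H (ℓ ∷ X) -ᶻ H X)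

PD-ext : ∀ D {H H' : List A → ℤ} → (∀ X → H X ≡ H' X) → PD D H → PD D H'
PD-ext zero    e p X = trans (sym (e X)) (p X)
PD-ext (suc D) e p ℓ = PD-ext D (λ X → cong₂ _-ᶻ_ (e (ℓ ∷ X)) (e X)) (p ℓ)

PD-suc : ∀ D {H : List A → ℤ} → PD D H → PD (suc D) H
PD-suc zero    p ℓ X = cong₂ _-ᶻ_ (p (ℓ ∷ X)) (p X)
PD-suc (suc D) p ℓ = PD-suc D (p ℓ)

PD-mono : ∀ {D D'} {H : List A → ℤ} → D ℕ.≤′ D' → PD D H → PD D' H
PD-mono ℕ.≤′-refl p = p
PD-mono (ℕ.≤′-step {n} le) p = PD-suc n (PD-mono le p)

PD-+ : ∀ D {H H' : List A → ℤ} → PD D H → PD D H' → PD D (λ X → H X +ᶻ H' X)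
PD-+ zero    p q X = cong₂ _+ᶻ_ (p X) (q X)
PD-+ (suc D) {H} {H'} p q ℓ =
  PD-ext D (λ X → alg (H (ℓ ∷ X)) (H X) (H' (ℓ ∷ X)) (H' X)) (PD-+ D (p ℓ) (q ℓ))
  where
  alg : ∀ a b c d → (a -ᶻ b) +ᶻ (c -ᶻ d) ≡ (a +ᶻ c) -ᶻ (b +ᶻ d)
  alg = solve-∀

PD-shift : ∀ D {H : List A → ℤ} → PD D H → ∀ ℓ → PD D (λ X → H (ℓ ∷ X))
PD-shift zero    p ℓ X = p (ℓ ∷ X)
PD-shift (suc D) {H} p ℓ = PD-ext (suc D) (λ X → alg (H X) (H (ℓ ∷ X)))
  (PD-+ (suc D) {H} p (PD-suc D (p ℓ)))
  where
  alg : ∀ a b → a +ᶻ (b -ᶻ a) ≡ b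
  alg = solve-∀

PD-const : ∀ (c : ℤ) → PD {A} 1 (λ _ → c)
PD-const c ℓ X = ℤₚ.+-inverseʳ c

PD-map : ∀ D (h : A → B) {H : List B → ℤ} → PD D H → PD D (λ X → H (map h X))
PD-map zero    h p X = p (map h X)
PD-map (suc D) h p ℓ = PD-map D h (p (h ℓ))

-- A product rule: adjoining `ℓ` contributes the new summand `F ℓ (ℓ ∷ X)` and changes every old
-- summand by a difference of `F e`, to which the induction on the degree applies.
PD-sum : ∀ D (t : List A) {F : A → List A → ℤ} → (∀ e → PD D (F e)) →
  PD (suc D) (λ X → sumL (X ++ t) (λ e → F e X))
PD-sum zero t p ℓ X = cong₂ _-ᶻ_ (sum-zero (ℓ ∷ X ++ t) (λ {e} _ → p e (ℓ ∷ X))) (sum-zero (X ++ t) (λ {e} _ → p e X))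
PD-sum (suc D) t {F} p ℓ = PD-ext (suc D) eq
  (PD-+ (suc D) {λ X → F ℓ (ℓ ∷ X)} (PD-shift (suc D) {F ℓ} (p ℓ) ℓ) (PD-sum D t (λ e → p e ℓ)))
  where
  alg : ∀ a b c → a +ᶻ (b -ᶻ c) ≡ (a +ᶻ b) -ᶻ c
  alg = solve-∀
  eq : ∀ X → F ℓ (ℓ ∷ X) +ᶻ sumL (X ++ t) (λ e → F e (ℓ ∷ X) -ᶻ F e X)
    ≡ sumL (ℓ ∷ X ++ t) (λ e → F e (ℓ ∷ X)) -ᶻ sumL (X ++ t) (λ e → F e X)
  eq X = trans (cong (F ℓ (ℓ ∷ X) +ᶻ_) (sum-- (X ++ t) (λ e → F e (ℓ ∷ X)) (λ e → F e X)))
    (alg (F ℓ (ℓ ∷ X)) _ _)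

-- Paths and exchanges of siblings

Key : ℕ → Set
Key s = Fin s × ℕ

-- A path is listed from its lower end to the root, so that the parent of an
-- edge is the tail of its path.
Path : ℕ → Set
Path s = List (Key s)

_≟ᵏ_ : DecidableEquality (Key s)
_≟ᵏ_ = Prodₚ.≡-dec Finₚ._≟_ ℕ._≟_

_≟ᵖ_ : DecidableEquality (Path s)
_≟ᵖ_ = Listₚ.≡-dec _≟ᵏ_

_∈?_ : (π : Path s) (t : List (Path s)) → Dec (π ∈ t)
π ∈? t = any? (π ≟ᵖ_) t

par↑ : Path s → Path s
par↑ []           = []
par↑ (κ ∷ [])     = κ ∷ []
par↑ (κ ∷ κ' ∷ π) = κ' ∷ π

-- Since paths start at the lower end, the suffixes of a path are its ancestors, itself and the root
-- included.
data Suf {s : ℕ} (q : Path s) : Path s → Set where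
  here  : Suf q q
  there : ∀ {κ π} → Suf q π → Suf q (κ ∷ π)

Suf-length : {q π : Path s} → Suf q π → length q ≤ length π
Suf-length here      = ℕₚ.≤-refl
Suf-length (there m) = ℕₚ.≤-trans (Suf-length m) (ℕₚ.n≤1+n _)

Suf-trans : {p q π : Path s} → Suf p q → Suf q π → Suf p π
Suf-trans m here      = m
Suf-trans m (there n) = there (Suf-trans m n)

Suf-tail : {κ : Key s} {q π : Path s} → Suf (κ ∷ q) π → Suf q π
Suf-tail here      = there here
Suf-tail (there m) = there (Suf-tail m)

¬Suf-longer : {κ : Key s} {q : Path s} → ¬ Suf (κ ∷ q) q
¬Suf-longer m = ℕₚ.1+n≰n (Suf-length m)

Suf-unique : {κ κ' : Key s} {p π : Path s} → Suf (κ ∷ p) π → Suf (κ' ∷ p) π → κ ≡ κ'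
Suf-unique here      here      = refl
Suf-unique here      (there n) = ⊥-elim (¬Suf-longer n)
Suf-unique (there m) here      = ⊥-elim (¬Suf-longer m)
Suf-unique (there m) (there n) = Suf-unique m n

-- Exchanges two siblings with the same label together with their subtrees.
record Swap (s : ℕ) : Set where
  constructor swap-at
  field
    pre : Path s
    lbl : Fin s
    fr to : ℕ

swapℕ : ℕ → ℕ → ℕ → ℕ
swapℕ i j m with m ℕ.≟ i
... | yes _ = j
... | no _ with m ℕ.≟ j
...   | yes _ = i
...   | no _  = m

swapℕ-fr : ∀ i j → swapℕ i j i ≡ j
swapℕ-fr i j with i ℕ.≟ i
... | yes _ = refl
... | no n  = ⊥-elim (n refl)

swapℕ-to : ∀ i j → swapℕ i j j ≡ i
swapℕ-to i j with j ℕ.≟ i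
... | yes e = e
... | no _ with j ℕ.≟ j
...   | yes _ = refl
...   | no n  = ⊥-elim (n refl)

swapℕ-other : ∀ i j {m} → m ≢ i → m ≢ j → swapℕ i j m ≡ m
swapℕ-other i j {m} a b with m ℕ.≟ i
... | yes e = ⊥-elim (a e)
... | no _ with m ℕ.≟ j
...   | yes e = ⊥-elim (b e)
...   | no _  = refl

swapℕ-invol : ∀ i j m → swapℕ i j (swapℕ i j m) ≡ m
swapℕ-invol i j m with m ℕ.≟ i
... | yes refl = swapℕ-to i j
... | no a with m ℕ.≟ j
...   | yes refl = swapℕ-fr i j
...   | no b = swapℕ-other i j a b

swapKey : Fin s → ℕ → ℕ → Key s → Key s
swapKey a i j (b , m) = b , (if does (b Finₚ.≟ a) then swapℕ i j m else m)

swapKey-same : (a : Fin s) (i j m : ℕ) → swapKey a i j (a , m) ≡ (a , swapℕ i j m)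
swapKey-same a i j m rewrite dec-true (a Finₚ.≟ a) refl = refl

swapKey-invol : (a : Fin s) (i j : ℕ) (κ : Key s) → swapKey a i j (swapKey a i j κ) ≡ κ
swapKey-invol a i j (b , m) with does (b Finₚ.≟ a)
... | true  = cong (b ,_) (swapℕ-invol i j m)
... | false = refl

swapKey-other : (a : Fin s) (i j : ℕ) {κ : Key s} → κ ≢ (a , i) → κ ≢ (a , j) → swapKey a i j κ ≡ κ
swapKey-other a i j {b , m} n n' with b Finₚ.≟ a
... | yes refl = cong (b ,_) (swapℕ-other i j (λ { refl → n refl }) (λ { refl → n' refl }))
... | no _     = refl

-- The test looks at the tail before it is moved. This is harmless because the exchange fixes `pre`,
-- see `act-pre`.
act : Swap s → Path s → Path s
act σ [] = []
act σ@(swap-at p a i j) (κ ∷ π) = (if does (π ≟ᵖ p) then swapKey a i j κ else κ) ∷ act σ π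

module _ (σ : Swap s) where
  open Swap σ

  act-fix : ∀ {π} → ¬ Suf ((lbl , fr) ∷ pre) π → ¬ Suf ((lbl , to) ∷ pre) π → act σ π ≡ π
  act-fix {[]}    n n' = refl
  act-fix {κ ∷ π} n n' with π ≟ᵖ pre
  ... | yes refl = cong₂ _∷_ (swapKey-other lbl fr to (λ { refl → n here }) (λ { refl → n' here }))
                     (act-fix (n ∘ there) (n' ∘ there))
  ... | no _     = cong (κ ∷_) (act-fix (n ∘ there) (n' ∘ there))

  act-pre : act σ pre ≡ pre
  act-pre = act-fix ¬Suf-longer ¬Suf-longer

  act-invol : ∀ π → act σ (act σ π) ≡ π
  act-invol []      = refl
  act-invol (κ ∷ π) with π ≟ᵖ pre
  ... | yes refl rewrite act-pre | dec-true (pre ≟ᵖ pre) refl =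
          cong₂ _∷_ (swapKey-invol lbl fr to κ) act-pre
  ... | no n rewrite dec-false (act σ π ≟ᵖ pre)
               (λ e → n (trans (sym (act-invol π)) (trans (cong (act σ) e) act-pre))) =
          cong (κ ∷_) (act-invol π)

  act-inj : ∀ {π π'} → act σ π ≡ act σ π' → π ≡ π'
  act-inj {π} {π'} e = trans (sym (act-invol π)) (trans (cong (act σ) e) (act-invol π'))

  act-length : ∀ π → length (act σ π) ≡ length π
  act-length []      = refl
  act-length (κ ∷ π) = cong suc (act-length π)

  act-par : ∀ π → par↑ (act σ π) ≡ act σ (par↑ π)
  act-par []           = refl
  act-par (κ ∷ [])     = refl
  act-par (κ ∷ κ' ∷ π) = refl

  act-Suf : ∀ {q π} → Suf q π → Suf (act σ q) (act σ π)
  act-Suf here      = here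
  act-Suf (there m) = there (act-Suf m)

  act-hit : ∀ m → act σ ((lbl , m) ∷ pre) ≡ (lbl , swapℕ fr to m) ∷ pre
  act-hit m rewrite dec-true (pre ≟ᵖ pre) refl = cong₂ _∷_ (swapKey-same lbl fr to m) act-pre

  act-miss : ∀ {κ π} → π ≢ pre → act σ (κ ∷ π) ≡ κ ∷ act σ π
  act-miss {κ} {π} n rewrite dec-false (π ≟ᵖ pre) n = refl

  act-miss-label : ∀ {b m π} → b ≢ lbl → act σ ((b , m) ∷ π) ≡ (b , m) ∷ act σ π
  act-miss-label {b} {m} {π} n with does (π ≟ᵖ pre)
  ... | false = refl
  ... | true rewrite dec-false (b Finₚ.≟ lbl) n = refl

-- Tuples over a list

tuples : (d : ℕ) → List A → List (Vec A d)
tuples zero    S = [] ∷ []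
tuples (suc d) S = cartesianProductWith _∷_ S (tuples d S)

sum-tuples : ∀ d (S : List A) (f : Vec A (suc d) → ℤ) →
  sumL (tuples (suc d) S) f ≡ sumL S (λ e → sumL (tuples d S) (λ v → f (e ∷ v)))
sum-tuples d S f = sum-cartesianProductWith _∷_ S (tuples d S) f

∈-tuples⁺ : ∀ {d} {S : List A} (v : Vec A d) → All (_∈ S) (toList v) → v ∈ tuples d S
∈-tuples⁺ []      []       = here refl
∈-tuples⁺ (e ∷ v) (m ∷ ms) = ∈-cartesianProductWith⁺ _∷_ m (∈-tuples⁺ v ms)

∈-tuples⁻ : ∀ {d} (S : List A) {v : Vec A d} → v ∈ tuples d S → All (_∈ S) (toList v)
∈-tuples⁻ {d = zero}  S (here refl) = []
∈-tuples⁻ {d = suc d} S m with ∈-cartesianProductWith⁻ _∷_ S (tuples d S) m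
... | e , v , e∈ , v∈ , refl = e∈ ∷ ∈-tuples⁻ S v∈

tuples-unique : ∀ d {S : List A} → Unique S → Unique (tuples d S)
tuples-unique zero    u = [] ∷ []
tuples-unique (suc d) u = Uniq.cartesianProductWith⁺ _∷_ (λ { refl → refl , refl }) u (tuples-unique d u)

sum-tuples-map : ∀ d (h : A → B) (S : List A) (f : Vec B d → ℤ) →
  sumL (tuples d (map h S)) f ≡ sumL (tuples d S) (f ∘ Vec.map h)
sum-tuples-map zero    h S f = refl
sum-tuples-map (suc d) h S f = begin
  sumL (tuples (suc d) (map h S)) f ≡⟨ sum-tuples d (map h S) f ⟩
  sumL (map h S) (λ e → sumL (tuples d (map h S)) (λ v → f (e ∷ v))) ≡⟨ sum-map h S _ ⟩
  sumL S (λ e → sumL (tuples d (map h S)) (λ v → f (h e ∷ v)))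
    ≡⟨ sum-ext S (λ e → sum-tuples-map d h S (λ v → f (h e ∷ v))) ⟩
  sumL S (λ e → sumL (tuples d S) (λ v → f (Vec.map h (e ∷ v)))) ≡⟨ sum-tuples d S (f ∘ Vec.map h) ⟨
  sumL (tuples (suc d) S) (f ∘ Vec.map h) ∎

sum-tuples-↭ : ∀ d {S S' : List A} → S ↭ S' → (f : Vec A d → ℤ) →
  sumL (tuples d S) f ≡ sumL (tuples d S') f
sum-tuples-↭ zero    p f = refl
sum-tuples-↭ (suc d) {S} {S'} p f = begin
  sumL (tuples (suc d) S) f ≡⟨ sum-tuples d S f ⟩
  sumL S (λ e → sumL (tuples d S) (λ v → f (e ∷ v)))
    ≡⟨ sum-ext S (λ e → sum-tuples-↭ d p (λ v → f (e ∷ v))) ⟩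
  sumL S (λ e → sumL (tuples d S') (λ v → f (e ∷ v))) ≡⟨ sum-↭ _ p ⟩
  sumL S' (λ e → sumL (tuples d S') (λ v → f (e ∷ v))) ≡⟨ sum-tuples d S' f ⟨
  sumL (tuples (suc d) S') f ∎

PD-tuples : ∀ d D (t : List A) {F : Vec A d → List A → ℤ} → (∀ v → PD D (F v)) →
  PD (d ℕ.+ D) (λ X → sumL (tuples d (X ++ t)) (λ v → F v X))
PD-tuples zero    D t {F} p = PD-ext D (λ X → sym (ℤₚ.+-identityʳ (F [] X))) (p [])
PD-tuples (suc d) D t {F} p = PD-ext (suc d ℕ.+ D)
  (λ X → sym (sum-tuples d (X ++ t) (λ v → F v X)))
  (PD-sum (d ℕ.+ D) t (λ e → PD-tuples d D t (λ v → p (e ∷ v))))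

-- Systems of nodes

-- All that the equivalences `E` use of the two interpretations: finitely many kinds of tuples and a
-- child relation that refers to no tree and is invariant under exchanges.
record Sys (s : ℕ) : Set₁ where
  field
    Cmp         : Set
    cmps        : List Cmp
    ∈-cmps      : ∀ i → i ∈ cmps
    cmps-unique : Unique cmps
    arity         : Cmp → ℕ

  Node : Set
  Node = Σ Cmp (λ i → Vec (Path s) (arity i))

  mapN : (Path s → Path s) → Node → Node
  mapN h (i , v) = i , Vec.map h v

  field
    isChild      : Node → Node → Bool
    isChild-swap : ∀ σ x y → isChild (mapN (act σ) x) (mapN (act σ) y) ≡ isChild x y

  pts : Node → List (Path s)
  pts (i , v) = toList v

  Pts : Node → List (Path s) → Set
  Pts x t = All (_∈ t) (pts x)

  nlist : List (Path s) → List Node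
  nlist S = concatMap (λ i → map (i ,_) (tuples (arity i) S)) cmps

  ε : Node → Node → Node → ℤ
  ε x y z = ⟦ isChild x z ⟧ -ᶻ ⟦ isChild y z ⟧

  Q : (Node → Node → Bool) → List (Path s) → Node → Node → ℤ
  Q R t x y = quad R (ε x y) (nlist t)

  SwapInv : (Node → Node → Bool) → Set
  SwapInv R = ∀ σ x y → R (mapN (act σ) x) (mapN (act σ) y) ≡ R x y

module Nodes {s : ℕ} (𝒮 : Sys s) where
  open Sys 𝒮

  sum-nlist : ∀ S (f : Node → ℤ) → sumL (nlist S) f ≡ sumL cmps (λ i → sumL (tuples (arity i) S) (λ v → f (i , v)))
  sum-nlist S f = trans (sum-concatMap _ cmps f) (sum-ext cmps (λ i → sum-map (i ,_) (tuples (arity i) S) f))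

  ∈-nlist⁺ : ∀ {S} x → Pts x S → x ∈ nlist S
  ∈-nlist⁺ {S} (i , v) m = ∈-concatMap⁺ _ (lose (∈-cmps i) (∈-map⁺ (i ,_) (∈-tuples⁺ v m)))

  ∈-nlist⁻ : ∀ {S x} → x ∈ nlist S → Pts x S
  ∈-nlist⁻ {S} m with find (∈-concatMap⁻ (λ i → map (i ,_) (tuples (arity i) S)) {xs = cmps} m)
  ... | i , _ , m' with ∈-map⁻ (i ,_) m'
  ...   | v , v∈ , refl = ∈-tuples⁻ S v∈

  nlist-unique : ∀ {S} → Unique S → Unique (nlist S)
  nlist-unique {S} u = go cmps cmps-unique
    where
    block : Cmp → List Node
    block i = map (i ,_) (tuples (arity i) S)
    go : ∀ is → Unique is → Unique (concatMap block is)
    go []       []         = []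
    go (i ∷ is) (i∉ ∷ us) = Uniq.++⁺
      (Uniq.map⁺ (λ { refl → refl }) (tuples-unique (arity i) u)) (go is us) disjoint
      where
      disjoint : ∀ {x} → ¬ (x ∈ block i × x ∈ concatMap block is)
      disjoint (m , m') with ∈-map⁻ (i ,_) m | find (∈-concatMap⁻ block {xs = is} m')
      ... | v , _ , refl | j , j∈ , n with ∈-map⁻ (j ,_) n
      ...   | _ , _ , refl = All.lookup i∉ j∈ refl

  sum-nlist-map : ∀ h S (f : Node → ℤ) → sumL (nlist (map h S)) f ≡ sumL (nlist S) (f ∘ mapN h)
  sum-nlist-map h S f = trans (sum-nlist (map h S) f)
    (trans (sum-ext cmps (λ i → sum-tuples-map (arity i) h S (λ v → f (i , v)))) (sym (sum-nlist S _)))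

  sum-nlist-↭ : ∀ {S S'} → S ↭ S' → (f : Node → ℤ) → sumL (nlist S) f ≡ sumL (nlist S') f
  sum-nlist-↭ {S} {S'} p f = trans (sum-nlist S f)
    (trans (sum-ext cmps (λ i → sum-tuples-↭ (arity i) p (λ v → f (i , v)))) (sym (sum-nlist S' f)))

  pts-mapN : ∀ h x → pts (mapN h x) ≡ map h (pts x)
  pts-mapN h (i , v) = Vecₚ.toList-map h v

  mapN-fix : ∀ h x → (∀ {π} → π ∈ pts x → h π ≡ π) → mapN h x ≡ x
  mapN-fix h (i , v) e = cong (i ,_) (go v e)
    where
    go : ∀ {d} (v : Vec (Path s) d) → (∀ {π} → π ∈ toList v → h π ≡ π) → Vec.map h v ≡ v
    go []      e = refl
    go (π ∷ v) e = cong₂ _∷_ (e (here refl)) (go v (e ∘ there))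

  mapN-∘ : ∀ g h x → mapN g (mapN h x) ≡ mapN (g ∘ h) x
  mapN-∘ g h (i , v) = cong (i ,_) (sym (Vecₚ.map-∘ g h v))

  mapN-invol : ∀ σ x → mapN (act σ) (mapN (act σ) x) ≡ x
  mapN-invol σ x = trans (mapN-∘ (act σ) (act σ) x) (mapN-fix _ x (λ {π} _ → act-invol σ π))

  Pts-map : ∀ h x {t} → Pts x t → Pts (mapN h x) (map h t)
  Pts-map h x {t} m = subst (All (_∈ map h t)) (sym (pts-mapN h x)) (Allₚ.map⁺ (All.map (∈-map⁺ h) m))

  Q-cong : ∀ {R R'} t x y → (∀ {z w} → z ∈ nlist t → w ∈ nlist t → R z w ≡ R' z w) → Q R t x y ≡ Q R' t x y
  Q-cong t x y e = sum-cong (nlist t) (λ {z} z∈ → sum-cong (nlist t) (λ {w} w∈ →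
    cong (λ b → ε x y z *ᶻ ε x y w *ᶻ ⟦ b ⟧) (e z∈ w∈)))

  Q-↭ : ∀ R {t t'} x y → t ↭ t' → Q R t x y ≡ Q R t' x y
  Q-↭ R {t} {t'} x y p = trans (sum-ext (nlist t) (λ z → sum-nlist-↭ p _)) (sum-nlist-↭ p _)

  Q-set : ∀ R {t t'} x y → Unique t → Unique t' →
    (∀ {π} → π ∈ t → π ∈ t') → (∀ {π} → π ∈ t' → π ∈ t) → Q R t x y ≡ Q R t' x y
  Q-set R x y u u' f g = Q-↭ R x y (unique-set-↭ u u' f g)

  Q-swap : ∀ {R} → SwapInv R → ∀ σ t x y →
    Q R (map (act σ) t) (mapN (act σ) x) (mapN (act σ) y) ≡ Q R t x y
  Q-swap {R} inv σ t x y = trans (sum-nlist-map (act σ) t _)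
    (sum-ext (nlist t) (λ z → trans (sum-nlist-map (act σ) t _) (sum-ext (nlist t) (λ w →
      cong₂ _*ᶻ_ (cong₂ _*ᶻ_ (ε-swap z) (ε-swap w)) (cong ⟦_⟧ (inv σ z w))))))
    where
    ε-swap : ∀ z → ε (mapN (act σ) x) (mapN (act σ) y) (mapN (act σ) z) ≡ ε x y z
    ε-swap z = cong₂ (λ b c → ⟦ b ⟧ -ᶻ ⟦ c ⟧) (isChild-swap σ x z) (isChild-swap σ y z)

  nodeDegree : List Cmp → ℕ → ℕ
  nodeDegree []       D = 0
  nodeDegree (i ∷ is) D = (arity i ℕ.+ D) ℕ.+ nodeDegree is D

  PD-nlist : ∀ D t {F : Node → List (Path s) → ℤ} → (∀ z → PD D (F z)) →
    PD (nodeDegree cmps D) (λ X → sumL (nlist (X ++ t)) (λ z → F z X))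
  PD-nlist D t {F} p = PD-ext (nodeDegree cmps D)
    (λ X → sym (sum-nlist (X ++ t) (λ z → F z X))) (go cmps)
    where
    block : Cmp → List (Path s) → ℤ
    block i X = sumL (tuples (arity i) (X ++ t)) (λ v → F (i , v) X)
    go : ∀ is → PD (nodeDegree is D) (λ X → sumL is (λ i → block i X))
    go []       = λ X → refl
    go (i ∷ is) = PD-+ (d ℕ.+ d') {block i}
        (PD-mono (ℕₚ.≤⇒≤′ (ℕₚ.m≤m+n d d')) (PD-tuples (arity i) D t (λ v → p (i , v))))
        (PD-mono (ℕₚ.≤⇒≤′ (ℕₚ.m≤n+m d' d)) (go is))
      where
      d = arity i ℕ.+ D
      d' = nodeDegree is D

  -- The summand is constant in `X` because `R` does not depend on the tree; only the ranges of the
  -- two nested sums grow, and each sum raises the degree by a bounded amount.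
  PD-Q : ∀ R t x y → ∃ λ D → PD D (λ X → Q R (X ++ t) x y)
  PD-Q R t x y = nodeDegree cmps (nodeDegree cmps 1) ,
    PD-nlist (nodeDegree cmps 1) t (λ z → PD-nlist 1 t {λ w X → ε x y z *ᶻ ε x y w *ᶻ ⟦ R z w ⟧}
      (λ w → PD-const (ε x y z *ᶻ ε x y w *ᶻ ⟦ R z w ⟧)))

-- Edge sets of trees as lists of paths

record FS (k : ℕ) (t : List (Path s)) : Set where
  field
    uniq   : Unique t
    closed : ∀ {π} → π ∈ t → par↑ π ∈ t
    pos    : [] ∉ t
    ht     : ∀ {π} → π ∈ t → length π ≤ k

  Suf-closed : ∀ {κ q π} → Suf (κ ∷ q) π → π ∈ t → κ ∷ q ∈ t
  Suf-closed here m = m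
  Suf-closed (there {π = []} ()) m
  Suf-closed (there {π = _ ∷ _} n) m = Suf-closed n (closed m)

-- The root is the path `[]`, which is not an edge and thus never in `t`; hence the separate case.
Has : Path s → List (Path s) → Set
Has p t = p ≡ [] ⊎ p ∈ t

Below : ℕ → Path s → Set
Below m = All (λ κ → proj₂ κ < m)

Below-mono : ∀ {m n} → m ≤ n → {π : Path s} → Below m π → Below n π
Below-mono le = All.map (λ lt → ℕₚ.≤-trans lt le)

Below-Suf : ∀ {m a i} {q π : Path s} → Suf ((a , i) ∷ q) π → Below m π → i < m
Below-Suf here      (b ∷ _) = b
Below-Suf (there n) (_ ∷ b) = Below-Suf n b

path-bound : (π : Path s) → ∃ λ m → Below m π
path-bound []            = 0 , []
path-bound ((b , i) ∷ π) = suc i ⊔ proj₁ (path-bound π) ,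
  ℕₚ.m≤m⊔n (suc i) (proj₁ (path-bound π)) ∷ Below-mono (ℕₚ.m≤n⊔m (suc i) _) (proj₂ (path-bound π))

list-bound : (t : List (Path s)) → ∃ λ m → ∀ {π} → π ∈ t → Below m π
list-bound []      = 0 , λ ()
list-bound (π ∷ t) = proj₁ (path-bound π) ⊔ proj₁ (list-bound t) , λ
  { (here refl) → Below-mono (ℕₚ.m≤m⊔n _ _) (proj₂ (path-bound π))
  ; (there m)   → Below-mono (ℕₚ.m≤n⊔m (proj₁ (path-bound π)) _) (proj₂ (list-bound t) m) }

-- Polynomiality in the number of added leaves

Fresh : ℕ → List ℕ → Set
Fresh m X = Unique X × All (m ≤_) X

countUp : ℕ → ℕ → List ℕ
countUp m zero    = []
countUp m (suc n) = m ∷ countUp (suc m) n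

countUp-≥ : ∀ m n → All (m ≤_) (countUp m n)
countUp-≥ m zero    = []
countUp-≥ m (suc n) = ℕₚ.≤-refl ∷ All.map (ℕₚ.≤-trans (ℕₚ.n≤1+n m)) (countUp-≥ (suc m) n)

countUp-fresh : ∀ m n → Fresh m (countUp m n)
countUp-fresh m n = go m n , countUp-≥ m n
  where
  go : ∀ m n → Unique (countUp m n)
  go m zero    = []
  go m (suc n) = All.map ℕₚ.<⇒≢ (countUp-≥ (suc m) n) ∷ go (suc m) n

countUp-length : ∀ m n → length (countUp m n) ≡ n
countUp-length m zero    = refl
countUp-length m (suc n) = cong suc (countUp-length (suc m) n)

-- `G` follows `g` on fresh lists only. The induction takes the difference at `m` and afterwards
-- admits only indices above `m`; then `m ∷ X` is again fresh, and the difference of `G` follows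
-- `Δ g`.
symmetric-trichotomy : ∀ D m (G : List ℕ → ℤ) g → PD D G →
  (∀ X → Fresh m X → G X ≡ g (length X)) → Trichotomy g
symmetric-trichotomy zero m G g pd e = inj₁ λ j → begin
  g j                     ≡⟨ cong g (countUp-length m j) ⟨
  g (length (countUp m j))   ≡⟨ e (countUp m j) (countUp-fresh m j) ⟨
  G (countUp m j)            ≡⟨ pd (countUp m j) ⟩
  0ℤ ∎
symmetric-trichotomy (suc D) m G g pd e = Δ-trichotomy g
  (symmetric-trichotomy D (suc m) (λ X → G (m ∷ X) -ᶻ G X) (Δ g) (pd m) λ X (u , ge) →
    cong₂ _-ᶻ_ (e (m ∷ X) (All.map ℕₚ.<⇒≢ ge ∷ u , ℕₚ.≤-refl ∷ All.map (ℕₚ.≤-trans (ℕₚ.n≤1+n m)) ge))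
      (e X (u , All.map (ℕₚ.≤-trans (ℕₚ.n≤1+n m)) ge)))

module Line {s k : ℕ} (𝒮 : Sys s) (R : Sys.Node 𝒮 → Sys.Node 𝒮 → Bool) (inv : Sys.SwapInv 𝒮 R)
            (x y : Sys.Node 𝒮) (p : Path s) (a : Fin s) where
  open Sys 𝒮
  open Nodes 𝒮

  leaf : ℕ → Path s
  leaf i = (a , i) ∷ p

  Unmet : List (Path s) → List ℕ → Set
  Unmet t X = Unique X × (∀ {i} → i ∈ X → ∀ {π} → π ∈ t → ¬ Suf (leaf i) π)

  leaf-Suf : ∀ {i j} → Suf (leaf i) (leaf j) → i ≡ j
  leaf-Suf here      = refl
  leaf-Suf (there m) = ⊥-elim (¬Suf-longer m)

  private
    swapℕ-cases : ∀ i j m → m ≢ i → swapℕ i j m ≡ m ⊎ swapℕ i j m ≡ i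
    swapℕ-cases i j m n with m ℕ.≟ j
    ... | yes refl = inj₂ (swapℕ-to i j)
    ... | no n'    = inj₁ (swapℕ-other i j n n')

  -- Exchanging `i` and `j` turns the first new leaf of one list into that of the other. It fixes
  -- `t`, `x` and `y`, which pass through neither. The common leaf then counts as an old path, and
  -- shorter lists remain.
  symmetric : ∀ X Y t → Pts x t → Pts y t → Unmet t X → Unmet t Y → length X ≡ length Y →
    Q R (map leaf X ++ t) x y ≡ Q R (map leaf Y ++ t) x y
  symmetric []      []      t px py fX fY e = refl
  symmetric (i ∷ X) (j ∷ Y) t px py (i∉ ∷ uX , fX) (j∉ ∷ uY , fY) e = begin
    Q R (leaf i ∷ map leaf X ++ t) x y
      ≡⟨ Q-swap inv σ (leaf i ∷ map leaf X ++ t) x y ⟨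
    Q R (map (act σ) (leaf i ∷ map leaf X ++ t)) (mapN (act σ) x) (mapN (act σ) y)
      ≡⟨ cong₂ (Q R _) (fixes x px) (fixes y py) ⟩
    Q R (map (act σ) (leaf i ∷ map leaf X ++ t)) x y ≡⟨ cong (λ S → Q R S x y) moved ⟩
    Q R (leaf j ∷ map leaf X' ++ t) x y ≡⟨ Q-↭ R x y (↭-sym (shift (leaf j) (map leaf X') t)) ⟩
    Q R (map leaf X' ++ leaf j ∷ t) x y
      ≡⟨ symmetric X' Y (leaf j ∷ t) (All.map there px) (All.map there py) fX' fY'
           (trans (Listₚ.length-map _ X) (ℕₚ.suc-injective e)) ⟩
    Q R (map leaf Y ++ leaf j ∷ t) x y ≡⟨ Q-↭ R x y (shift (leaf j) (map leaf Y) t) ⟩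
    Q R (leaf j ∷ map leaf Y ++ t) x y ∎
    where
    σ = swap-at p a i j
    X' = map (swapℕ i j) X
    fix-t : ∀ {π} → π ∈ t → act σ π ≡ π
    fix-t m = act-fix σ (fX (here refl) m) (fY (here refl) m)
    fixes : ∀ z → Pts z t → mapN (act σ) z ≡ z
    fixes z pz = mapN-fix (act σ) z (λ m → fix-t (All.lookup pz m))
    moved-X : ∀ X → map (act σ) (map leaf X ++ t) ≡ map leaf (map (swapℕ i j) X) ++ t
    moved-X []      = trans (Listₚ.map-cong-local (All.tabulate fix-t)) (Listₚ.map-id t)
    moved-X (m ∷ X) = cong₂ _∷_ (act-hit σ m) (moved-X X)
    moved : map (act σ) (leaf i ∷ map leaf X ++ t) ≡ leaf j ∷ map leaf X' ++ t
    moved = trans (moved-X (i ∷ X)) (cong (λ m → leaf m ∷ map leaf X' ++ t) (swapℕ-fr i j))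
    fY' : Unmet (leaf j ∷ t) Y
    fY' = uY , λ { m (here refl) su → All.lookup j∉ m (sym (leaf-Suf su))
                 ; m (there n) su → fY (there m) n su }
    swapℕ-inj : ∀ {m n} → swapℕ i j m ≡ swapℕ i j n → m ≡ n
    swapℕ-inj {m} {n} e = trans (sym (swapℕ-invol i j m)) (trans (cong (swapℕ i j) e) (swapℕ-invol i j n))
    fX' : Unmet (leaf j ∷ t) X'
    fX' = Uniq.map⁺ swapℕ-inj uX , unmet
      where
      unmet : ∀ {m} → m ∈ X' → ∀ {π} → π ∈ leaf j ∷ t → ¬ Suf (leaf m) π
      unmet m∈ π∈ su with ∈-map⁻ (swapℕ i j) m∈
      unmet m∈ (here refl) su | m₀ , m₀∈ , refl =
        All.lookup i∉ m₀∈ (swapℕ-inj (trans (swapℕ-fr i j) (sym (leaf-Suf su))))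
      unmet m∈ (there n) su | m₀ , m₀∈ , refl
        with swapℕ i j m₀ | swapℕ-cases i j m₀ (λ e → All.lookup i∉ m₀∈ (sym e))
      ... | _ | inj₁ refl = fX (there m₀∈) n su
      ... | _ | inj₂ refl = fX (here refl) n su

  eventually-nonzero : ∀ t → Pts x t → Pts y t → Q R t x y ≢ 0ℤ →
    ∃ λ b → ∀ X → Unmet t X → b ≤ length X → Q R (map leaf X ++ t) x y ≢ 0ℤ
  eventually-nonzero t px py nz = proj₁ r , λ X f le e →
    proj₂ r (length X) le (trans (symmetric (countUp m (length X)) X t px py
      (fresh⇒unmet (countUp-fresh m _)) f (countUp-length m _)) e)
    where
    m = proj₁ (list-bound t)
    G : List ℕ → ℤ
    G X = Q R (map leaf X ++ t) x y
    g : ℕ → ℤ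
    g j = G (countUp m j)
    fresh⇒unmet : ∀ {X} → Fresh m X → Unmet t X
    fresh⇒unmet (u , ge) = u , λ i∈ π∈ su →
      ℕₚ.<-irrefl refl (ℕₚ.<-≤-trans (Below-Suf su (proj₂ (list-bound t) π∈)) (All.lookup ge i∈))
    D = proj₁ (PD-Q R t x y)
    tri : Trichotomy g
    tri = symmetric-trichotomy D m G g
      (PD-map D leaf {λ S → Q R (S ++ t) x y} (proj₂ (PD-Q R t x y))) (λ X f →
        symmetric X (countUp m (length X)) t px py (fresh⇒unmet f) (fresh⇒unmet (countUp-fresh m _))
          (sym (countUp-length m _)))
    -- At `0` no leaf is added, so `nz` itself excludes the zero sequence.
    r = trichotomy-nonzero tri 0 nz

  missing : List (Path s) → ℕ → List ℕ
  missing t N = filter (λ i → ¬? (leaf i ∈? t)) (downFrom N)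

  -- Filling all gaps, and not just adding new leaves, makes the indices of the `a`-labelled
  -- children of `p` exactly those below `N` once `N` exceeds every index in `t`. Prescribed numbers
  -- of children need this form.
  fill : List (Path s) → ℕ → List (Path s)
  fill t N = map leaf (missing t N) ++ t

  ∈-fill⁻ : ∀ t N {π} → π ∈ fill t N → π ∈ t ⊎ ∃ λ i → i < N × π ≡ leaf i
  ∈-fill⁻ t N m with ∈-++⁻ (map leaf (missing t N)) m
  ... | inj₂ m' = inj₁ m'
  ... | inj₁ m' with ∈-map⁻ leaf m'
  ...   | i , i∈ , e = inj₂ (i , ∈-downFrom⁻ (proj₁ (∈-filter⁻ _ {xs = downFrom N} i∈)) , e)

  ∈-fill⁺ : ∀ t N {π} → π ∈ t → π ∈ fill t N
  ∈-fill⁺ t N = ∈-++⁺ʳ (map leaf (missing t N))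

  leaf∈fill : ∀ t N {i} → i < N → leaf i ∈ fill t N
  leaf∈fill t N {i} lt with leaf i ∈? t
  ... | yes m = ∈-fill⁺ t N m
  ... | no n  = ∈-++⁺ˡ (∈-map⁺ leaf (∈-filter⁺ _ (∈-downFrom⁺ lt) n))

  fill-FS : ∀ t N → FS k t → Has p t → length p < k → FS k (fill t N)
  fill-FS t N fs hp lt = record
    { uniq = Uniq.++⁺ (Uniq.map⁺ (λ { refl → refl }) (Uniq.filter⁺ _ (Uniq.downFrom⁺ N))) uniq
        λ (m , m') → disjoint m m'
    ; closed = λ m → closed' (∈-fill⁻ t N m)
    ; pos = λ m → pos' (∈-fill⁻ t N m)
    ; ht = λ m → ht' (∈-fill⁻ t N m) }
    where
    open FS fs
    disjoint : ∀ {π} → π ∈ map leaf (missing t N) → ¬ (π ∈ t)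
    disjoint m m' with ∈-map⁻ leaf m
    ... | i , i∈ , refl = proj₂ (∈-filter⁻ (λ i → ¬? (leaf i ∈? t)) {xs = downFrom N} i∈) m'
    closed' : ∀ {π} → π ∈ t ⊎ (∃ λ i → i < N × π ≡ leaf i) → par↑ π ∈ fill t N
    closed' (inj₁ m) = ∈-fill⁺ t N (closed m)
    closed' (inj₂ (i , lt , refl)) = top p hp refl
      where
      top : ∀ p' → Has p' t → p' ≡ p → par↑ ((a , i) ∷ p') ∈ fill t N
      top [] _ refl = leaf∈fill t N lt
      top (_ ∷ _) (inj₁ ())
      top (_ ∷ _) (inj₂ m) _ = ∈-fill⁺ t N m
    pos' : [] ∈ t ⊎ (∃ λ i → i < N × [] ≡ leaf i) → ⊥
    pos' (inj₁ m) = pos m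
    pos' (inj₂ (_ , _ , ()))
    ht' : ∀ {π} → π ∈ t ⊎ (∃ λ i → i < N × π ≡ leaf i) → length π ≤ k
    ht' (inj₁ m) = ht m
    ht' (inj₂ (_ , _ , refl)) = lt

  private
    missing-length : ∀ t m → (∀ {π} → π ∈ t → Below m π) → ∀ N → N ≤ length (missing t N) ℕ.+ m
    missing-length t m bd zero = z≤n
    missing-length t m bd (suc N) with leaf N ∈? t
    ... | yes π∈ = ℕₚ.≤-trans (All.head (bd π∈)) (ℕₚ.m≤n+m m _)
    ... | no _   = s≤s (missing-length t m bd N)

  fill-nonzero : ∀ t → FS k t → Pts x t → Pts y t → Q R t x y ≢ 0ℤ →
    ∃ λ b → ∀ N → b ≤ N → Q R (fill t N) x y ≢ 0ℤ × (∀ {i} → leaf i ∈ fill t N → i < N)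
  -- At least `b₀` leaves must be added, and up to `m` of the indices below `N` may already be
  -- taken, as `m` bounds the indices in `t`.
  fill-nonzero t fs px py nz = b₀ ℕ.+ m , λ N le →
      proj₂ ev (missing t N)
        -- A path of `t` through a missing leaf would, by closure, put that leaf into `t`.
        (Uniq.filter⁺ _ (Uniq.downFrom⁺ N) , λ i∈ π∈ su →
          proj₂ (∈-filter⁻ (λ i → ¬? (leaf i ∈? t)) {xs = downFrom N} i∈) (FS.Suf-closed fs su π∈))
        (ℕₚ.+-cancelʳ-≤ m b₀ _ (ℕₚ.≤-trans le (missing-length t m bd N)))
    , λ m → index (ℕₚ.≤-trans (ℕₚ.m≤n+m _ b₀) le) (∈-fill⁻ t N m)
    where
    ev = eventually-nonzero t px py nz
    b₀ = proj₁ ev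
    m = proj₁ (list-bound t)
    bd = proj₂ (list-bound t)
    index : ∀ {N i} → m ≤ N → leaf i ∈ t ⊎ (∃ λ j → j < N × leaf i ≡ leaf j) → i < N
    index le (inj₁ π∈) = ℕₚ.<-≤-trans (All.head (bd π∈)) le
    index le (inj₂ (_ , lt , refl)) = lt

-- Decidability of E

pathsOf : (s l M : ℕ) → List (Path s)
pathsOf s zero    M = [] ∷ []
pathsOf s (suc l) M = cartesianProductWith _∷_ (cartesianProduct (allFin s) (upTo M)) (pathsOf s l M)

∈-pathsOf⁺ : ∀ M (π : Path s) → Below M π → π ∈ pathsOf s (length π) M
∈-pathsOf⁺ M []            []       = here refl
∈-pathsOf⁺ M ((a , i) ∷ π) (lt ∷ b) =
  ∈-cartesianProductWith⁺ _∷_ (∈-cartesianProduct⁺ (∈-allFin a) (∈-upTo⁺ lt)) (∈-pathsOf⁺ M π b)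

∈-pathsOf⁻ : ∀ l M {π : Path s} → π ∈ pathsOf s l M → length π ≡ l
∈-pathsOf⁻ zero    M (here refl) = refl
∈-pathsOf⁻ {s} (suc l) M m with ∈-cartesianProductWith⁻ _∷_ (cartesianProduct (allFin s) (upTo M)) (pathsOf s l M) m
... | κ , π , _ , π∈ , refl = cong suc (∈-pathsOf⁻ l M π∈)

paths≤ : (s k M : ℕ) → List (Path s)
paths≤ s zero    M = []
paths≤ s (suc k) M = pathsOf s (suc k) M ++ paths≤ s k M

IsEdge : ℕ → Path s → Set
IsEdge k π = 1 ≤ length π × length π ≤ k

isEdge? : ∀ k (π : Path s) → Dec (IsEdge k π)
isEdge? k π = (1 ℕ.≤? length π) ×-dec (length π ℕ.≤? k)

∈-paths≤⁺ : ∀ k M (π : Path s) → IsEdge k π → Below M π → π ∈ paths≤ s k M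
∈-paths≤⁺ zero M π (l , le) b = ⊥-elim (ℕₚ.1+n≰n (ℕₚ.≤-trans l le))
∈-paths≤⁺ {s} (suc k) M π (l , le) b with length π ℕ.≟ suc k
... | yes e = ∈-++⁺ˡ (subst (λ n → π ∈ pathsOf s n M) e (∈-pathsOf⁺ M π b))
... | no n  = ∈-++⁺ʳ (pathsOf s (suc k) M) (∈-paths≤⁺ k M π (l , ℕₚ.≤-pred (ℕₚ.≤∧≢⇒< le n)) b)

∈-paths≤⁻ : ∀ k M {π : Path s} → π ∈ paths≤ s k M → IsEdge k π
∈-paths≤⁻ zero M ()
∈-paths≤⁻ {s} (suc k) M m with ∈-++⁻ (pathsOf s (suc k) M) m
... | inj₁ m' = subst (1 ≤_) (sym e) (s≤s z≤n) , ℕₚ.≤-reflexive e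
  where e = ∈-pathsOf⁻ (suc k) M m'
... | inj₂ m' = proj₁ (∈-paths≤⁻ k M m') , ℕₚ.≤-trans (proj₂ (∈-paths≤⁻ k M m')) (ℕₚ.n≤1+n k)

-- Renaming paths to small indices

record TailMap {s : ℕ} (f : Path s → Path s) : Set where
  field
    nil  : f [] ≡ []
    cons : ∀ κ π → ∃ λ κ' → f (κ ∷ π) ≡ κ' ∷ f π

  len : ∀ π → length (f π) ≡ length π
  len []      = cong length nil
  len (κ ∷ π) = trans (cong length (proj₂ (cons κ π))) (cong suc (len π))

  suf : ∀ {q π} → Suf q π → Suf (f q) (f π)
  suf here = here
  suf {q} (there {κ} {π} m) = subst (Suf (f q)) (sym (proj₂ (cons κ π))) (there (suf m))

id-TailMap : TailMap {s} id
id-TailMap = record { nil = refl ; cons = λ κ π → κ , refl }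

act-TailMap : ∀ (σ : Swap s) {f} → TailMap f → TailMap (act σ ∘ f)
act-TailMap σ {f} tl = record
  { nil = cong (act σ) nil
  ; cons = λ κ π → _ , cong (act σ) (proj₂ (cons κ π)) }
  where open TailMap tl

act-below : ∀ {p : Path s} {a i j m π} → m ≤ i → m ≤ j → Below m π → act (swap-at p a i j) π ≡ π
act-below le le' b = act-fix _ (λ su → ℕₚ.<-irrefl refl (ℕₚ.<-≤-trans (Below-Suf su b) le))
                               (λ su → ℕₚ.<-irrefl refl (ℕₚ.<-≤-trans (Below-Suf su b) le'))

-- Along one path all large indices are exchanged for the same index `m`; the next path uses
-- `suc m`, so `length Z` new indices suffice. Paths with indices below the current `m` stay where
-- they are, which protects those already treated. `Φ` is the invariant of the application; `step`
-- may use that the exchange happens on a path from `Z` and that `m ≤ i`.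
module Normalise {s : ℕ} (Φ : (Path s → Path s) → Set) (M B : ℕ) (Z : List (Path s))
  (step : ∀ f → TailMap f → Φ f → ∀ {a i q z m} → z ∈ Z → Suf ((a , i) ∷ q) (f z) →
    M ≤ m → m < B → m ≤ i → Φ (act (swap-at q a i m) ∘ f)) where

  Result : (m m' : ℕ) (f : Path s → Path s) (us : List (Path s)) → Set
  Result m m' f us = ∃ λ f' → TailMap f' × Φ f' × (∀ {u} → u ∈ us → Below m' (f' u))
    × (∀ {y} → Below m (f y) → f' y ≡ f y)

  normalise-one : ∀ {m z} → M ≤ m → m < B → z ∈ Z → ∀ u → Suf u z → ∀ f → TailMap f → Φ f →
    Result m (suc m) f (u ∷ [])
  normalise-one {m} M≤m m<B z∈ [] su f tl φ =
    f , tl , φ , (λ { (here refl) → subst (Below (suc m)) (sym (TailMap.nil tl)) [] }) , λ _ → refl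
  normalise-one {m} {z} M≤m m<B z∈ (κ ∷ u) su f tl φ
    with normalise-one M≤m m<B z∈ u (Suf-tail su) f tl φ
  ... | f₁ , tl₁ , φ₁ , b₁ , fix₁ with TailMap.cons tl₁ κ u
  ...   | (a , i) , e with i ℕ.<? suc m
  ...     | yes lt = f₁ , tl₁ , φ₁ ,
              (λ { (here refl) → subst (Below (suc m)) (sym e) (lt ∷ b₁ (here refl)) }) , fix₁
  ...     | no ¬lt = act σ ∘ f₁ , act-TailMap σ tl₁ ,
              step f₁ tl₁ φ₁ z∈ (subst (λ q → Suf q (f₁ z)) e (TailMap.suf tl₁ su)) M≤m m<B m≤i ,
              (λ { (here refl) → subst (Below (suc m)) (sym moved) (ℕₚ.≤-refl ∷ b₁ (here refl)) }) ,
              λ {y} b → trans (cong (act σ) (fix₁ b)) (act-below m≤i ℕₚ.≤-refl b)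
    where
    m≤i : m ≤ i
    m≤i = ℕₚ.≤-trans (ℕₚ.n≤1+n m) (ℕₚ.≮⇒≥ ¬lt)
    -- The tail `f₁ u` is already normalised, and an exchange of its children fixes it.
    σ = swap-at (f₁ u) a i m
    moved : act σ (f₁ (κ ∷ u)) ≡ (a , m) ∷ f₁ u
    moved = trans (cong (act σ) e) (trans (act-hit σ i) (cong (λ j → (a , j) ∷ f₁ u) (swapℕ-fr i m)))

  normalise : ∀ zs → (∀ {z} → z ∈ zs → z ∈ Z) → ∀ m → M ≤ m → m ℕ.+ length zs ≤ B →
    ∀ f → TailMap f → Φ f → Result m (m ℕ.+ length zs) f zs
  normalise [] zs⊆ m M≤m le f tl φ = f , tl , φ , (λ ()) , λ _ → refl
  normalise (z ∷ zs) zs⊆ m M≤m le f tl φ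
    with normalise-one M≤m (ℕₚ.≤-trans (s≤s (ℕₚ.m≤m+n m _)) (subst (_≤ B) (ℕₚ.+-suc m _) le))
           (zs⊆ (here refl)) z here f tl φ
  ... | f₁ , tl₁ , φ₁ , b₁ , fix₁
    with normalise zs (zs⊆ ∘ there) (suc m) (ℕₚ.≤-trans M≤m (ℕₚ.n≤1+n m))
           (subst (_≤ B) (ℕₚ.+-suc m _) le) f₁ tl₁ φ₁
  ...   | f₂ , tl₂ , φ₂ , b₂ , fix₂ = f₂ , tl₂ , φ₂ , below ,
          λ {y} b → trans (fix₂ (subst (Below (suc m)) (sym (fix₁ b)) (Below-mono (ℕₚ.n≤1+n m) b))) (fix₁ b)
    where
    below : ∀ {u} → u ∈ z ∷ zs → Below (m ℕ.+ suc (length zs)) (f₂ u)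
    below (here refl) = subst (Below _) (sym (fix₂ (b₁ (here refl))))
      (Below-mono (subst (suc m ≤_) (sym (ℕₚ.+-suc m _)) (s≤s (ℕₚ.m≤m+n m _))) (b₁ (here refl)))
    below {u} (there n) = subst (λ l → Below l (f₂ u)) (sym (ℕₚ.+-suc m (length zs))) (b₂ n)

-- Closures under ancestors

sufs : Path s → List (Path s)
sufs []      = []
sufs (κ ∷ π) = (κ ∷ π) ∷ sufs π

∈-sufs⁺ : ∀ {κ q} {π : Path s} → Suf (κ ∷ q) π → κ ∷ q ∈ sufs π
∈-sufs⁺ here                = here refl
∈-sufs⁺ (there {π = π} m) = there (∈-sufs⁺ m)

∈-sufs⁻ : ∀ {q} (π : Path s) → q ∈ sufs π → q ≢ [] × Suf q π
∈-sufs⁻ (κ ∷ π) (here refl) = (λ ()) , here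
∈-sufs⁻ (κ ∷ π) (there m)   = proj₁ (∈-sufs⁻ π m) , there (proj₂ (∈-sufs⁻ π m))

clo : List (Path s) → List (Path s)
clo P = deduplicate _≟ᵖ_ (concatMap sufs P)

∈-clo⁺ : ∀ {κ q π} {P : List (Path s)} → π ∈ P → Suf (κ ∷ q) π → κ ∷ q ∈ clo P
∈-clo⁺ π∈ su = ∈-deduplicate⁺ _≟ᵖ_ (∈-concatMap⁺ sufs (lose π∈ (∈-sufs⁺ su)))

∈-clo⁻ : ∀ {q} (P : List (Path s)) → q ∈ clo P → ∃ λ π → π ∈ P × q ≢ [] × Suf q π
∈-clo⁻ P m with find (∈-concatMap⁻ sufs {xs = P} (∈-deduplicate⁻ _≟ᵖ_ (concatMap sufs P) m))
... | π , π∈ , m' = π , π∈ , ∈-sufs⁻ π m'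

clo-unique : (P : List (Path s)) → Unique (clo P)
clo-unique P = DecUniq.deduplicate-! _≟ᵖ_ (concatMap sufs P)

∈-clo-self : ∀ {π} {P : List (Path s)} → 1 ≤ length π → π ∈ P → π ∈ clo P
∈-clo-self {π = κ ∷ π} _ m = ∈-clo⁺ m here

Suf-par : ∀ {κ q} {π : Path s} → Suf (κ ∷ q) π → Suf (par↑ (κ ∷ q)) π
Suf-par {q = []}    m = m
Suf-par {q = _ ∷ _} m = Suf-tail m

par-nonempty : ∀ κ (q : Path s) → ∃ λ κ' → ∃ λ q' → par↑ (κ ∷ q) ≡ κ' ∷ q'
par-nonempty κ []       = _ , _ , refl
par-nonempty κ (_ ∷ _) = _ , _ , refl

clo-FS : ∀ {k} (P : List (Path s)) → (∀ {π} → π ∈ P → length π ≤ k) → FS k (clo P)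
clo-FS P h = record { uniq = clo-unique P ; closed = closed' ; pos = λ m → nil m ; ht = ht' }
  where
  nil : [] ∉ clo P
  nil m = proj₁ (proj₂ (proj₂ (∈-clo⁻ P m))) refl
  closed' : ∀ {q} → q ∈ clo P → par↑ q ∈ clo P
  closed' {[]} m = ⊥-elim (nil m)
  closed' {κ ∷ q} m with ∈-clo⁻ P m | par-nonempty κ q
  ... | π , π∈ , _ , su | κ' , q' , e =
    subst (_∈ clo P) (sym e) (∈-clo⁺ π∈ (subst (λ r → Suf r π) e (Suf-par su)))
  ht' : ∀ {q} → q ∈ clo P → length q ≤ _
  ht' m with ∈-clo⁻ P m
  ... | π , π∈ , _ , su = ℕₚ.≤-trans (Suf-length su) (h π∈)

clo⊆ : ∀ {k} {P t : List (Path s)} → FS k t → (∀ {π} → π ∈ P → π ∈ t) → ∀ {q} → q ∈ clo P → q ∈ t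
clo⊆ {P = P} fs h {q} m with ∈-clo⁻ P m
clo⊆ fs h {[]}    m | π , π∈ , n , su = ⊥-elim (n refl)
clo⊆ fs h {κ ∷ q} m | π , π∈ , n , su = FS.Suf-closed fs su (h π∈)

map-act-FS : ∀ {k t} (σ : Swap s) → FS k t → FS k (map (act σ) t)
map-act-FS {k = k} {t} σ fs = record
  { uniq = Uniq.map⁺ (act-inj σ) uniq
  ; closed = λ m → let π , π∈ , e = ∈-map⁻ (act σ) m in
      subst (_∈ map (act σ) t) (trans (sym (act-par σ π)) (cong par↑ (sym e))) (∈-map⁺ (act σ) (closed π∈))
  ; pos = λ m → let π , π∈ , e = ∈-map⁻ (act σ) m in
      pos (subst (_∈ t) (act-inj σ (sym e)) π∈)
  ; ht = λ m → let π , π∈ , e = ∈-map⁻ (act σ) m in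
      subst (_≤ k) (trans (sym (act-length σ π)) (cong length (sym e))) (ht π∈) }
  where open FS fs

does-⇔ : {A B : Set} (d : Dec A) (e : Dec B) → (A → B) → (B → A) → does d ≡ does e
does-⇔ (yes _) (yes _) f g = refl
does-⇔ (no _)  (no _)  f g = refl
does-⇔ (yes a) (no ¬b) f g = ⊥-elim (¬b (f a))
does-⇔ (no ¬a) (yes b) f g = ⊥-elim (¬a (g b))

-- The tree-independent equivalences

module Generic {s : ℕ} (k : ℕ) (𝒮 : Sys s) where
  open Sys 𝒮
  open Nodes 𝒮

  dims : List Cmp → ℕ
  dims []       = 0
  dims (i ∷ is) = arity i ℕ.+ dims is

  dim≤dims : ∀ {i is} → i ∈ is → arity i ≤ dims is
  dim≤dims {is = j ∷ is} (here refl) = ℕₚ.m≤m+n _ _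
  dim≤dims {is = j ∷ is} (there m)   = ℕₚ.≤-trans (dim≤dims m) (ℕₚ.m≤n+m _ (arity j))

  -- A crude bound on every arity. Twice this bounds the number of paths in a pair of nodes, and so
  -- the number of new indices that normalising a pair takes.
  dmax : ℕ
  dmax = dims cmps

  pts-length : ∀ x → length (pts x) ≤ dmax
  pts-length (i , v) = subst (_≤ dmax) (sym (Vecₚ.length-toList v)) (dim≤dims (∈-cmps i))

  pair-length : ∀ x y → length (pts x ++ pts y) ≤ dmax ℕ.+ dmax
  pair-length x y = subst (_≤ dmax ℕ.+ dmax) (sym (Listₚ.length-++ (pts x)))
    (ℕₚ.+-mono-≤ (pts-length x) (pts-length y))

  Valid : Node → Set
  Valid x = All (IsEdge k) (pts x)

  valid? : ∀ x → Dec (Valid x)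
  valid? x = all? (isEdge? k) (pts x)

  ∈-edge : ∀ {t : List (Path s)} {π} → FS k t → π ∈ t → IsEdge k π
  ∈-edge {π = []}    fs m = ⊥-elim (FS.pos fs m)
  ∈-edge {π = _ ∷ _} fs m = s≤s z≤n , FS.ht fs m

  Pts⇒Valid : ∀ {t x} → FS k t → Pts x t → Valid x
  Pts⇒Valid fs = All.map (∈-edge fs)

  reps : ℕ → List Node
  reps M = nlist (paths≤ s k M)

  ∈-reps⁺ : ∀ {M} x → Valid x → (∀ {π} → π ∈ pts x → Below M π) → x ∈ reps M
  ∈-reps⁺ {M} x vx b = ∈-nlist⁺ x (All.tabulate λ m → ∈-paths≤⁺ k M _ (All.lookup vx m) (b m))

  ∈-reps⁻ : ∀ {M x} → x ∈ reps M → Valid x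
  ∈-reps⁻ {M} m = All.map (∈-paths≤⁻ k M) (∈-nlist⁻ m)

  Valid-map : ∀ {f} → TailMap f → ∀ x → Valid x → Valid (mapN f x)
  Valid-map {f} tl x vx = subst (All (IsEdge k)) (sym (pts-mapN f x)) (Allₚ.map⁺
    (All.map (λ {π} (l , le) → subst (1 ≤_) (sym (len π)) l , subst (_≤ k) (sym (len π)) le) vx))
    where open TailMap tl

  module Separation (R : Node → Node → Bool) (inv : SwapInv R) where

    -- Q does not vanish identically on the trees that contain x and y.
    NV : Node → Node → Set
    NV x y = ∃ λ t → FS k t × Pts x t × Pts y t × Q R t x y ≢ 0ℤ

    NV-swap : ∀ σ x y → NV x y → NV (mapN (act σ) x) (mapN (act σ) y)
    NV-swap σ x y (t , fs , px , py , nz) = map (act σ) t , map-act-FS σ fs ,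
      Pts-map (act σ) x px , Pts-map (act σ) y py , λ e → nz (trans (sym (Q-swap inv σ t x y)) e)

    NV-swap⁻ : ∀ σ x y → NV (mapN (act σ) x) (mapN (act σ) y) → NV x y
    NV-swap⁻ σ x y nv = subst₂ NV (mapN-invol σ x) (mapN-invol σ y) (NV-swap σ _ _ nv)

    module _ (x y : Node) where

      P : Node → Node → List (Path s)
      P z w = (pts x ++ pts y) ++ (pts z ++ pts w)

      cloQ : Node → Node → ℤ
      cloQ z w = Q R (clo (P z w)) x y

      -- The pairs (z , w) are grouped by the closure that they generate together
      -- with x and y; a minimal class is the difference of two vanishing sums.
      clo-determined : ∀ t → FS k t → Pts x t → Pts y t →
        (∀ {z w} → z ∈ nlist t → w ∈ nlist t → cloQ z w ≡ 0ℤ) → Q R t x y ≡ 0ℤ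
      clo-determined t fs px py h = trans (sym (sum-cartesianProductWith _,_ (nlist t) (nlist t) χ))
        (down-sums-zero⇒sum-zero ≼? (λ {v} → ≼-refl {v}) (λ {u} {v} {w} → ≼-trans {u} {v} {w})
          (length (W t)) (W t) ℕₚ.≤-refl χ downs)
        where
        W : List (Path s) → List (Node × Node)
        W t = cartesianProduct (nlist t) (nlist t)
        χ : Node × Node → ℤ
        χ (z , w) = ε x y z *ᶻ ε x y w *ᶻ ⟦ R z w ⟧
        Cl : Node × Node → List (Path s)
        Cl (z , w) = clo (P z w)
        qs : Node × Node → List (Path s)
        qs (z , w) = pts z ++ pts w
        -- The down-set of `w` within `t` consists of the pairs over `Cl w`, so its sum is `cloQ` at
        -- `w`. The case `[]` keeps the relation reflexive on all nodes, as closures omit the empty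
        -- path.
        _≼_ : Node × Node → Node × Node → Set
        v ≼ w = All (λ π → π ∈ Cl w ⊎ π ≡ []) (qs v)
        ≼? : ∀ v w → Dec (v ≼ w)
        ≼? v w = all? (λ π → dec-⊎ π) (qs v)
          where
          dec-⊎ : ∀ π → Dec (π ∈ Cl w ⊎ π ≡ [])
          dec-⊎ π with π ∈? Cl w | π ≟ᵖ []
          ... | yes m | _     = yes (inj₁ m)
          ... | no _  | yes e = yes (inj₂ e)
          ... | no n  | no n' = no λ { (inj₁ m) → n m ; (inj₂ e) → n' e }
        in-C : ∀ v {π} → π ∈ qs v → π ∈ Cl v ⊎ π ≡ []
        in-C v {[]}    m = inj₂ refl
        in-C v {κ ∷ π} m = inj₁ (∈-clo-self (s≤s z≤n) (∈-++⁺ʳ (pts x ++ pts y) m))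
        ≼-refl : ∀ {v} → v ≼ v
        ≼-refl {v} = All.tabulate (in-C v)
        C-mono : ∀ {v w} → v ≼ w → ∀ {q} → q ∈ Cl v → q ∈ Cl w
        C-mono {v} {w} vw {q} m with ∈-clo⁻ (P (proj₁ v) (proj₂ v)) m
        C-mono {v} {w} vw {[]} m | π , π∈ , n , su = ⊥-elim (n refl)
        C-mono {v} {w} vw {κ ∷ q} m | π , π∈ , n , su with ∈-++⁻ (pts x ++ pts y) π∈
        ... | inj₁ π∈' = ∈-clo⁺ (∈-++⁺ˡ π∈') su
        ... | inj₂ π∈' with All.lookup vw π∈'
        ...   | inj₂ refl = ⊥-elim (nosuf su)
          where
          nosuf : ¬ Suf (κ ∷ q) []
          nosuf ()
        ...   | inj₁ π∈C with ∈-clo⁻ (P (proj₁ w) (proj₂ w)) π∈C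
        ...     | ρ , ρ∈ , _ , su' = ∈-clo⁺ ρ∈ (Suf-trans su su')
        ≼-trans : ∀ {u v w} → u ≼ v → v ≼ w → u ≼ w
        ≼-trans {u} {v} {w} uv vw = All.map
          (λ { (inj₁ m) → inj₁ (C-mono {v} {w} vw m) ; (inj₂ e) → inj₂ e }) uv
        ∈W : ∀ {t v} → v ∈ W t → All (_∈ t) (qs v)
        ∈W {t} m with ∈-cartesianProduct⁻ (nlist t) (nlist t) m
        ... | m₁ , m₂ = Allₚ.++⁺ (∈-nlist⁻ m₁) (∈-nlist⁻ m₂)
        W-unique : ∀ {t} → Unique t → Unique (W t)
        W-unique u = Uniq.cartesianProduct⁺ (nlist-unique u) (nlist-unique u)
        downs : ∀ {w} → w ∈ W t → sumL (W t) (λ v → ⟦ does (≼? v w) ⟧ *ᶻ χ v) ≡ 0ℤ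
        downs {w} w∈ = begin
          sumL (W t) g ≡⟨ sum-support (W-unique (FS.uniq fs)) (W-unique (clo-unique (P (proj₁ w) (proj₂ w)))) g (λ {v} → to v) (λ {v} _ → back v) ⟩
          sumL (W (Cl w)) g ≡⟨ sum-cong (W (Cl w)) (λ {v} → all-below v) ⟩
          sumL (W (Cl w)) χ ≡⟨ sum-cartesianProductWith _,_ (nlist (Cl w)) (nlist (Cl w)) χ ⟩
          Q R (Cl w) x y ≡⟨ h (proj₁ w∈') (proj₂ w∈') ⟩
          0ℤ ∎
          where
          w∈' = ∈-cartesianProduct⁻ (nlist t) (nlist t) w∈
          g : Node × Node → ℤ
          g v = ⟦ does (≼? v w) ⟧ *ᶻ χ v
          all-below : ∀ v → v ∈ W (Cl w) → g v ≡ χ v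
          all-below v m with ≼? v w
          ... | yes _ = ℤₚ.*-identityˡ (χ v)
          ... | no n  = ⊥-elim (n (All.map inj₁ (∈W {Cl w} m)))
          C⊆t : ∀ {q} → q ∈ Cl w → q ∈ t
          C⊆t = clo⊆ fs λ m → All.lookup (Allₚ.++⁺ (Allₚ.++⁺ px py) (∈W {t} w∈)) m
          back : ∀ v → v ∈ W (Cl w) → v ∈ W t
          back v m with Allₚ.++⁻ (pts (proj₁ v)) (All.map C⊆t (∈W {Cl w} m))
          ... | m₁ , m₂ = ∈-cartesianProduct⁺ (∈-nlist⁺ (proj₁ v) m₁) (∈-nlist⁺ (proj₂ v) m₂)
          to : ∀ v → g v ≢ 0ℤ → v ∈ W t → v ∈ W (Cl w)
          to v nz m with ≼? v w
          ... | no _   = ⊥-elim (nz refl)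
          ... | yes vw with Allₚ.++⁻ (pts (proj₁ v)) (All.tabulate inC)
            where
            inC : ∀ {π} → π ∈ qs v → π ∈ Cl w
            inC π∈ with All.lookup vw π∈
            ... | inj₁ π∈C  = π∈C
            ... | inj₂ refl = ⊥-elim (FS.pos fs (All.lookup (∈W {t} m) π∈))
          ...   | m₁ , m₂ = ∈-cartesianProduct⁺ (∈-nlist⁺ (proj₁ v) m₁) (∈-nlist⁺ (proj₂ v) m₂)

      M₀ : ℕ
      M₀ = proj₁ (list-bound (pts x ++ pts y))

      candidates : List Node
      candidates = reps (M₀ ℕ.+ (dmax ℕ.+ dmax))

      -- The indices in `x` and `y` are below `M₀`, so exchanges among larger ones fix both nodes.
      -- Such an exchange maps the closure to that of the renamed pair and preserves `Q`;
      -- normalising brings `z` and `w` among the candidates.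
      bounded-witness : Valid x → Valid y → ∀ z w → Valid z → Valid w → cloQ z w ≢ 0ℤ →
        ∃ λ z' → ∃ λ w' → z' ∈ candidates × w' ∈ candidates × cloQ z' w' ≢ 0ℤ
      bounded-witness vx vy z w vz vw nz
        with normalise Z id M₀ ℕₚ.≤-refl ℕₚ.≤-refl id id-TailMap ((λ _ → refl) , nz')
        where
        Z = pts z ++ pts w
        Φ : (Path s → Path s) → Set
        Φ f = (∀ {π} → π ∈ pts x ++ pts y → f π ≡ π) × Q R (clo ((pts x ++ pts y) ++ map f Z)) x y ≢ 0ℤ
        nz' : Q R (clo ((pts x ++ pts y) ++ map id Z)) x y ≢ 0ℤ
        nz' = subst (λ S → Q R (clo ((pts x ++ pts y) ++ S)) x y ≢ 0ℤ) (sym (Listₚ.map-id Z)) nz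
        step : ∀ f → TailMap f → Φ f → ∀ {a i q z m} → z ∈ Z → Suf ((a , i) ∷ q) (f z) →
          M₀ ≤ m → m < M₀ ℕ.+ length Z → m ≤ i → Φ (act (swap-at q a i m) ∘ f)
        step f tl (fix , nz) {a} {i} {q} {_} {m} _ _ le _ le' =
          (λ π∈ → trans (cong (act σ) (fix π∈)) (fixσ π∈)) , λ e → nz (begin
            Q R (clo (XY ++ map f Z)) x y ≡⟨ Q-swap inv σ _ x y ⟨
            Q R (map (act σ) (clo (XY ++ map f Z))) (mapN (act σ) x) (mapN (act σ) y)
              ≡⟨ cong₂ (Q R _) (mapN-fix (act σ) x (fixσ ∘ ∈-++⁺ˡ)) (mapN-fix (act σ) y (fixσ ∘ ∈-++⁺ʳ (pts x))) ⟩
            Q R (map (act σ) (clo (XY ++ map f Z))) x y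
              ≡⟨ Q-set R x y (Uniq.map⁺ (act-inj σ) (clo-unique (XY ++ map f Z))) (clo-unique (XY ++ map (act σ ∘ f) Z)) to back ⟩
            Q R (clo (XY ++ map (act σ ∘ f) Z)) x y ≡⟨ e ⟩
            0ℤ ∎)
          where
          σ = swap-at q a i m
          XY = pts x ++ pts y
          fixσ : ∀ {π} → π ∈ XY → act σ π ≡ π
          fixσ π∈ = act-below (ℕₚ.≤-trans le le') le (proj₂ (list-bound XY) π∈)
          image : map (act σ) (XY ++ map f Z) ≡ XY ++ map (act σ ∘ f) Z
          image = trans (Listₚ.map-++ (act σ) XY (map f Z)) (cong₂ _++_
            (trans (Listₚ.map-cong-local (All.tabulate fixσ)) (Listₚ.map-id XY))
            (sym (Listₚ.map-∘ Z)))
          to : ∀ {π} → π ∈ map (act σ) (clo (XY ++ map f Z)) → π ∈ clo (XY ++ map (act σ ∘ f) Z)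
          to m∈ with ∈-map⁻ (act σ) m∈
          ... | [] , π∈ , refl = ⊥-elim (proj₁ (proj₂ (proj₂ (∈-clo⁻ (XY ++ map f Z) π∈))) refl)
          ... | κ ∷ π , π∈ , refl with ∈-clo⁻ (XY ++ map f Z) π∈
          ...   | ρ , ρ∈ , _ , su = ∈-clo⁺ (subst (act σ ρ ∈_) image (∈-map⁺ (act σ) ρ∈)) (act-Suf σ su)
          back : ∀ {π} → π ∈ clo (XY ++ map (act σ ∘ f) Z) → π ∈ map (act σ) (clo (XY ++ map f Z))
          back {[]} m∈ = ⊥-elim (proj₁ (proj₂ (proj₂ (∈-clo⁻ (XY ++ map (act σ ∘ f) Z) m∈))) refl)
          back {κ ∷ π} m∈ with ∈-clo⁻ (XY ++ map (act σ ∘ f) Z) m∈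
          ... | ρ , ρ∈ , _ , su with ∈-map⁻ (act σ) (subst (ρ ∈_) (sym image) ρ∈)
          ...   | ρ' , ρ'∈ , refl = subst (_∈ map (act σ) (clo (XY ++ map f Z))) (act-invol σ (κ ∷ π))
                  (∈-map⁺ (act σ) (∈-clo⁺ ρ'∈ (subst (Suf (act σ (κ ∷ π))) (act-invol σ ρ') (act-Suf σ su))))
        open Normalise Φ M₀ (M₀ ℕ.+ length Z) Z step
      ... | f , tl , (_ , nz') , below , _ = mapN f z , mapN f w ,
          ∈-reps⁺ (mapN f z) (Valid-map tl z vz) (λ m → low (pts-mapN f z) (λ n → ∈-++⁺ˡ n) m) ,
          ∈-reps⁺ (mapN f w) (Valid-map tl w vw) (λ m → low (pts-mapN f w) (λ n → ∈-++⁺ʳ (pts z) n) m) ,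
          subst (λ S → Q R (clo ((pts x ++ pts y) ++ S)) x y ≢ 0ℤ)
            (trans (Listₚ.map-++ f (pts z) (pts w)) (sym (cong₂ _++_ (pts-mapN f z) (pts-mapN f w)))) nz'
        where
        low : ∀ {S S' π} → S ≡ map f S' → (∀ {ρ} → ρ ∈ S' → ρ ∈ pts z ++ pts w) → π ∈ S →
          Below (M₀ ℕ.+ (dmax ℕ.+ dmax)) π
        low refl h m with ∈-map⁻ f m
        ... | ρ , ρ∈ , refl = Below-mono (ℕₚ.+-monoʳ-≤ M₀ (pair-length z w)) (below (h ρ∈))

      -- A candidate pair with nonzero value gives a tree directly, namely its closure. If all
      -- candidates give zero, `bounded-witness` extends this to all pairs and `clo-determined` to
      -- all trees. Nodes that are not valid lie in no tree.
      NV? : Dec (NV x y)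
      NV? with valid? x | valid? y
      ... | no ¬vx | _ = no λ (t , fs , px , py , _) → ¬vx (Pts⇒Valid fs px)
      ... | yes _ | no ¬vy = no λ (t , fs , px , py , _) → ¬vy (Pts⇒Valid fs py)
      ... | yes vx | yes vy
        with any? (λ z → any? (λ w → ¬? (cloQ z w ℤ.≟ 0ℤ)) candidates) candidates
      ...   | yes a with find a
      ...     | z , z∈ , a' with find a'
      ...       | w , w∈ , nz = yes (clo (P z w) , clo-FS (P z w) short , self ∈-++⁺ˡ vx , self (∈-++⁺ʳ (pts x)) vy , nz)
        where
        short : ∀ {π} → π ∈ P z w → length π ≤ k
        short m = proj₂ (All.lookup (Allₚ.++⁺ (Allₚ.++⁺ vx vy) (Allₚ.++⁺ (∈-reps⁻ z∈) (∈-reps⁻ w∈))) m)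
        self : ∀ {S} → (∀ {π} → π ∈ S → π ∈ pts x ++ pts y) → All (IsEdge k) S → All (_∈ clo (P z w)) S
        self h v = All.tabulate λ m → ∈-clo-self (proj₁ (All.lookup v m)) (∈-++⁺ˡ (h m))
      NV? | yes vx | yes vy | no none = no λ (t , fs , px , py , nz) →
        nz (clo-determined t fs px py λ {z} {w} z∈ w∈ → decide fs z w z∈ w∈)
        where
        decide : ∀ {t} → FS k t → ∀ z w → z ∈ nlist t → w ∈ nlist t → cloQ z w ≡ 0ℤ
        decide fs z w z∈ w∈ with cloQ z w ℤ.≟ 0ℤ
        ... | yes e = e
        ... | no nz with bounded-witness vx vy z w (Pts⇒Valid fs (∈-nlist⁻ z∈)) (Pts⇒Valid fs (∈-nlist⁻ w∈)) nz
        ...   | z' , w' , z'∈ , w'∈ , nz' = ⊥-elim (none (lose z'∈ (lose w'∈ nz')))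

  -- Deciding the next level requires the invariance of this one, so both are constructed together.
  record Level : Set where
    field
      E     : Node → Node → Bool
      E-inv : SwapInv E

  next : Level → Level
  next l = record
    { E = λ x y → not (does (NV? x y))
    ; E-inv = λ σ x y → cong not (does-⇔ (NV? _ _) (NV? x y) (NV-swap⁻ σ x y) (NV-swap σ x y)) }
    where
    open Level l
    open Separation E E-inv

  level : ℕ → Level
  level zero    = record { E = λ _ _ → true ; E-inv = λ _ _ _ → refl }
  level (suc n) = next (level n)

  E : ℕ → Node → Node → Bool
  E n = Level.E (level n)

  E-inv : ∀ n → SwapInv (E n)
  E-inv n = Level.E-inv (level n)

  NV : ℕ → Node → Node → Set
  NV n = Separation.NV (E n) (E-inv n)

  NV? : ∀ n x y → Dec (NV n x y)
  NV? n = Separation.NV? (E n) (E-inv n)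

  ¬NV⇒E : ∀ n {x y} → ¬ NV n x y → E (suc n) x y ≡ true
  ¬NV⇒E n {x} {y} h with NV? n x y
  ... | yes nv = ⊥-elim (h nv)
  ... | no _   = refl

  E⇒¬NV : ∀ n {x y} → E (suc n) x y ≡ true → ¬ NV n x y
  E⇒¬NV n {x} {y} e nv with NV? n x y
  E⇒¬NV n () nv | yes _
  ... | no ¬nv = ¬nv nv

  E⇒Q≡0 : ∀ n {x y t} → E (suc n) x y ≡ true → FS k t → Pts x t → Pts y t → Q (E n) t x y ≡ 0ℤ
  E⇒Q≡0 n {x} {y} {t} e fs px py with Q (E n) t x y ℤ.≟ 0ℤ
  ... | yes z = z
  ... | no nz = ⊥-elim (E⇒¬NV n e (t , fs , px , py , nz))

-- Colour refinement and E

module Refinement {s : ℕ} (k : ℕ) (𝒮 : Sys s) where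
  open Sys 𝒮
  open Nodes 𝒮
  open Generic k 𝒮

  -- Adding just one leaf might make `Q` vanish. After the ancestors of the path, a whole family of
  -- siblings is added instead, up to an `N` that is above `i` and large enough for `Q` to stay
  -- nonzero.
  extend-path : ∀ n {x y} t → FS k t → Pts x t → Pts y t → Q (E n) t x y ≢ 0ℤ → ∀ π → IsEdge k π →
    ∃ λ t' → FS k t' × (∀ {ρ} → ρ ∈ t → ρ ∈ t') × π ∈ t' × Q (E n) t' x y ≢ 0ℤ
  extend-path n {x} {y} t fs px py nz ((a , i) ∷ p) (_ , le) = add p refl
    where
    add-leaf : ∀ t₁ → FS k t₁ → (∀ {ρ} → ρ ∈ t → ρ ∈ t₁) → Has p t₁ → Q (E n) t₁ x y ≢ 0ℤ →
      ∃ λ t' → FS k t' × (∀ {ρ} → ρ ∈ t → ρ ∈ t') × (a , i) ∷ p ∈ t' × Q (E n) t' x y ≢ 0ℤ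
    add-leaf t₁ fs₁ sub hp nz₁ = fill t₁ N , fill-FS t₁ N fs₁ hp le , ∈-fill⁺ t₁ N ∘ sub ,
        leaf∈fill t₁ N (ℕₚ.m≤n⊔m b (suc i)) , proj₁ (proj₂ r N (ℕₚ.m≤m⊔n b (suc i)))
      where
      open Line {k = k} 𝒮 (E n) (E-inv n) x y p a
      r = fill-nonzero t₁ fs₁ (All.map sub px) (All.map sub py) nz₁
      b = proj₁ r
      N = b ⊔ suc i
    add : ∀ p' → p' ≡ p → ∃ λ t' → FS k t' × (∀ {ρ} → ρ ∈ t → ρ ∈ t') × (a , i) ∷ p ∈ t' × Q (E n) t' x y ≢ 0ℤ
    add [] refl = add-leaf t fs id (inj₁ refl) nz
    add (κ ∷ q) refl with extend-path n t fs px py nz (κ ∷ q) (s≤s z≤n , ℕₚ.≤-trans (ℕₚ.n≤1+n _) le)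
    ... | t₁ , fs₁ , sub , m , nz₁ = add-leaf t₁ fs₁ sub (inj₂ m) nz₁

  extend : ∀ n {x y} t → FS k t → Pts x t → Pts y t → Q (E n) t x y ≢ 0ℤ → ∀ πs → All (IsEdge k) πs →
    ∃ λ t' → FS k t' × (∀ {ρ} → ρ ∈ t → ρ ∈ t') × All (_∈ t') πs × Q (E n) t' x y ≢ 0ℤ
  extend n t fs px py nz [] [] = t , fs , id , [] , nz
  extend n t fs px py nz (π ∷ πs) (e ∷ es) with extend-path n t fs px py nz π e
  ... | t₁ , fs₁ , sub₁ , m₁ , nz₁
    with extend n t₁ fs₁ (All.map sub₁ px) (All.map sub₁ py) nz₁ πs es
  ...   | t₂ , fs₂ , sub₂ , m₂ , nz₂ = t₂ , fs₂ , sub₂ ∘ sub₁ , sub₂ m₁ ∷ m₂ , nz₂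

  nlist-Valid : ∀ {t} → FS k t → All Valid (nlist t)
  nlist-Valid fs = All.tabulate λ m → Pts⇒Valid fs (∈-nlist⁻ m)

  ε-self : ∀ x z → ε x x z ≡ 0ℤ
  ε-self x z = ℤₚ.+-inverseʳ ⟦ isChild x z ⟧

  ε-anti : ∀ x y z → ε y x z ≡ -ᶻ ε x y z
  ε-anti x y z = alg ⟦ isChild x z ⟧ ⟦ isChild y z ⟧
    where
    alg : ∀ a b → b -ᶻ a ≡ -ᶻ (a -ᶻ b)
    alg = solve-∀

  ε-trans : ∀ x y w z → ε x w z ≡ ε x y z +ᶻ ε y w z
  ε-trans x y w z = alg ⟦ isChild x z ⟧ ⟦ isChild y z ⟧ ⟦ isChild w z ⟧
    where
    alg : ∀ a b c → a -ᶻ c ≡ (a -ᶻ b) +ᶻ (b -ᶻ c)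
    alg = solve-∀

  Q-self : ∀ R t x → Q R t x x ≡ 0ℤ
  Q-self R t x = sum-zero (nlist t) λ {z} _ → sum-zero (nlist t) λ {w} _ →
    cong (λ e → e *ᶻ ε x x w *ᶻ ⟦ R z w ⟧) (ε-self x z)

  Q-sym : ∀ R t x y → Q R t y x ≡ Q R t x y
  Q-sym R t x y = sum-ext (nlist t) λ z → sum-ext (nlist t) λ w →
    trans (cong₂ (λ a b → a *ᶻ b *ᶻ ⟦ R z w ⟧) (ε-anti x y z) (ε-anti x y w)) (alg (ε x y z) (ε x y w) ⟦ R z w ⟧)
    where
    alg : ∀ a b c → (-ᶻ a) *ᶻ (-ᶻ b) *ᶻ c ≡ a *ᶻ b *ᶻ c
    alg = solve-∀

  -- `Q` is quadratic and does not add up along `x`, `y`, `w`. Its vanishing is that of the class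
  -- weights, however, and these are linear in `ε`.
  Q-trans : ∀ {P R} → IsEqᵇ P R → ∀ {t} x y w → All P (nlist t) →
    Q R t x y ≡ 0ℤ → Q R t y w ≡ 0ℤ → Q R t x w ≡ 0ℤ
  Q-trans {P} {R} eq {t} x y w all xy yw = classes-zero⇒quad-zero eq (ε x w) (nlist t) all λ {c} c∈ →
    trans (sum-ext (nlist t) (λ z → trans (cong (_*ᶻ ⟦ R z c ⟧) (ε-trans x y w z))
      (ℤₚ.*-distribʳ-+ ⟦ R z c ⟧ (ε x y z) (ε y w z))))
    (trans (sum-+ (nlist t) _ _)
      (cong₂ _+ᶻ_ (quad-zero⇒classes-zero eq (ε x y) (nlist t) all xy c∈)
                  (quad-zero⇒classes-zero eq (ε y w) (nlist t) all yw c∈)))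

  -- For transitivity, a tree separating `x` from `w` is first enlarged by the paths of `y` with `Q`
  -- kept nonzero; in the enlarged tree both hypotheses apply, and `Q-trans` at the level below
  -- gives the contradiction.
  E-isEq : ∀ n → IsEqᵇ Valid (E n)
  E-isEq zero    = record { rfl = λ _ → refl ; sm = λ _ _ _ → refl ; trn = λ _ _ _ _ _ → refl }
  E-isEq (suc n) = record
    { rfl = λ {x} _ → ¬NV⇒E n λ (t , _ , _ , _ , nz) → nz (Q-self (E n) t x)
    ; sm  = λ {x} {y} _ _ e → ¬NV⇒E n λ (t , fs , py , px , nz) →
        nz (trans (Q-sym (E n) t x y) (E⇒Q≡0 n e fs px py))
    ; trn = λ {x} {y} {w} _ vy _ xy yw → ¬NV⇒E n λ (t , fs , px , pw , nz) → chain x y w vy xy yw (extend n t fs px pw nz (pts y) vy) px pw }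
    where
    chain : ∀ x y w → Valid y → E (suc n) x y ≡ true → E (suc n) y w ≡ true → ∀ {t} →
      (∃ λ t' → FS k t' × (∀ {ρ} → ρ ∈ t → ρ ∈ t') × Pts y t' × Q (E n) t' x w ≢ 0ℤ) →
      Pts x t → Pts w t → ⊥
    chain x y w vy xy yw (t' , fs , sub , py , nz) px pw = nz (Q-trans (E-isEq n) x y w (nlist-Valid fs)
      (E⇒Q≡0 n xy fs (All.map sub px) py) (E⇒Q≡0 n yw fs py (All.map sub pw)))

  S : List (Path s) → ℕ → Node → Node → Bool
  S t zero    x y = true
  S t (suc n) x y = does (Q (S t n) t x y ℤ.≟ 0ℤ)

  S⇒Q≡0 : ∀ t n {x y} → S t (suc n) x y ≡ true → Q (S t n) t x y ≡ 0ℤ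
  S⇒Q≡0 t n {x} {y} e with Q (S t n) t x y ℤ.≟ 0ℤ
  ... | yes z = z
  S⇒Q≡0 t n () | no _

  Q≡0⇒S : ∀ t n {x y} → Q (S t n) t x y ≡ 0ℤ → S t (suc n) x y ≡ true
  Q≡0⇒S t n {x} {y} z with Q (S t n) t x y ℤ.≟ 0ℤ
  ... | yes _ = refl
  ... | no nz = ⊥-elim (nz z)

  all-⊤ : (L : List Node) → All (λ _ → ⊤) L
  all-⊤ L = All.tabulate λ _ → unit

  S-isEq : ∀ t n → IsEqᵇ (λ _ → ⊤) (S t n)
  S-isEq t zero    = record { rfl = λ _ → refl ; sm = λ _ _ _ → refl ; trn = λ _ _ _ _ _ → refl }
  S-isEq t (suc n) = record
    { rfl = λ {x} _ → Q≡0⇒S t n (Q-self (S t n) t x)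
    ; sm  = λ {x} {y} _ _ e → Q≡0⇒S t n (trans (Q-sym (S t n) t x y) (S⇒Q≡0 t n e))
    ; trn = λ {x} {y} {w} _ _ _ xy yw → Q≡0⇒S t n
        (Q-trans (S-isEq t n) x y w (all-⊤ (nlist t)) (S⇒Q≡0 t n xy) (S⇒Q≡0 t n yw)) }

  S-classes : ∀ t n {x y} → S t (suc n) x y ≡ true → ∀ {c} → c ∈ nlist t → cls (S t n) (ε x y) (nlist t) c ≡ 0ℤ
  S-classes t n {x} {y} e = quad-zero⇒classes-zero (S-isEq t n) (ε x y) (nlist t) (all-⊤ _) (S⇒Q≡0 t n e)

  classes⇒S : ∀ t n {x y} → (∀ {c} → c ∈ nlist t → cls (S t n) (ε x y) (nlist t) c ≡ 0ℤ) → S t (suc n) x y ≡ true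
  classes⇒S t n {x} {y} h = Q≡0⇒S t n (classes-zero⇒quad-zero (S-isEq t n) (ε x y) (nlist t) (all-⊤ _) h)

  -- By induction each class of `S t n` on the nodes of `t` is a union of classes of `E n`, so its
  -- weight is a sum of weights that vanish.
  E⇒S : ∀ {t} → FS k t → ∀ n {x y} → Pts x t → Pts y t → E n x y ≡ true → S t n x y ≡ true
  E⇒S fs zero px py e = refl
  E⇒S {t} fs (suc n) {x} {y} px py e = classes⇒S t n λ {c} c∈ →
    invariant-sum-zero (E-isEq n) (ε x y) (length (nlist t)) (nlist t) ℕₚ.≤-refl (nlist-Valid fs)
      (quad-zero⇒classes-zero (E-isEq n) (ε x y) (nlist t) (nlist-Valid fs) (E⇒Q≡0 n e fs px py))
      (λ z → ⟦ S t n z c ⟧)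
      (λ z∈ w∈ zw → cong ⟦_⟧ (IsEqᵇ.left≡ (S-isEq t n) unit unit unit (E⇒S fs n (∈-nlist⁻ z∈) (∈-nlist⁻ w∈) zw)))

  IsGeneric : ℕ → List (Path s) → Set
  IsGeneric N t = ∀ n → n < N → ∀ {x y} → Pts x t → Pts y t → NV n x y → Q (E n) t x y ≢ 0ℤ

  -- Agreement at level `n` makes the two forms equal on `t`. What remains is that a pair separated
  -- by some tree is separated by `t` itself, and this is genericity.
  S≡E : ∀ {N t} → FS k t → IsGeneric N t → ∀ n → n ≤ N → ∀ {x y} → Pts x t → Pts y t → S t n x y ≡ E n x y
  S≡E fs gen zero le px py = refl
  S≡E {N} {t} fs gen (suc n) le {x} {y} px py with NV? n x y
  ... | no ¬nv = trans (does-⇔ (Q (S t n) t x y ℤ.≟ 0ℤ) (Q (E n) t x y ℤ.≟ 0ℤ)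
                   (trans (sym same)) (trans same)) (is-true (Q (E n) t x y ℤ.≟ 0ℤ) (E⇒Q≡0 n (¬NV⇒E n ¬nv) fs px py))
    where
    same : Q (S t n) t x y ≡ Q (E n) t x y
    same = Q-cong t x y λ z∈ w∈ → S≡E fs gen n (ℕₚ.≤-trans (ℕₚ.n≤1+n n) le) (∈-nlist⁻ z∈) (∈-nlist⁻ w∈)
    is-true : ∀ {A : Set} (d : Dec A) → A → does d ≡ true
    is-true (yes _) a = refl
    is-true (no n)  a = ⊥-elim (n a)
  ... | yes nv = is-false (Q (S t n) t x y ℤ.≟ 0ℤ) λ z → gen n le px py nv (trans (sym same) z)
    where
    same : Q (S t n) t x y ≡ Q (E n) t x y
    same = Q-cong t x y λ z∈ w∈ → S≡E fs gen n (ℕₚ.≤-trans (ℕₚ.n≤1+n n) le) (∈-nlist⁻ z∈) (∈-nlist⁻ w∈)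
    is-false : ∀ {A : Set} (d : Dec A) → ¬ A → does d ≡ false
    is-false (yes a) n = ⊥-elim (n a)
    is-false (no _)  n = refl

-- The separating tree

-- Prescribed numbers of children: ν p a is the number of a-labelled children of
-- the node p, once it has been chosen.
Profile : ℕ → Set
Profile s = Path s → Fin s → Maybe ℕ

Allowed : Maybe ℕ → ℕ → Set
Allowed nothing  i = ⊤
Allowed (just N) i = i < N

Present : Maybe ℕ → ℕ → Set
Present nothing  i = ⊥
Present (just N) i = i < N

-- `Comp` describes the paths that the prescribed numbers do not exclude, `Forced` those that occur
-- in every tree with these numbers.
Comp : Profile s → Path s → Set
Comp ν []            = ⊤
Comp ν ((a , i) ∷ p) = Allowed (ν p a) i × Comp ν p

Forced : Profile s → Path s → Set
Forced ν []            = ⊤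
Forced ν ((a , i) ∷ p) = Present (ν p a) i × Forced ν p

allowed? : ∀ m i → Dec (Allowed m i)
allowed? nothing  i = yes unit
allowed? (just N) i = i ℕ.<? N

present? : ∀ m i → Dec (Present m i)
present? nothing  i = no λ ()
present? (just N) i = i ℕ.<? N

comp? : (ν : Profile s) (π : Path s) → Dec (Comp ν π)
comp? ν []            = yes unit
comp? ν ((a , i) ∷ p) = allowed? (ν p a) i ×-dec comp? ν p

forced? : (ν : Profile s) (π : Path s) → Dec (Forced ν π)
forced? ν []            = yes unit
forced? ν ((a , i) ∷ p) = present? (ν p a) i ×-dec forced? ν p

present⇒just : ∀ {m i} → Present m i → ∃ λ N → m ≡ just N × i < N
present⇒just {just N} lt = N , refl , lt

Forced⇒Comp : (ν : Profile s) (π : Path s) → Forced ν π → Comp ν π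
Forced⇒Comp ν []            _       = unit
Forced⇒Comp ν ((a , i) ∷ p) (h , f) with ν p a
... | just N = h , Forced⇒Comp ν p f

Comp-Suf : (ν : Profile s) {a : Fin s} {i : ℕ} {q : Path s} (π : Path s) →
  Suf ((a , i) ∷ q) π → Comp ν π → Allowed (ν q a) i
Comp-Suf ν _       here      (h , _) = h
Comp-Suf ν (_ ∷ π) (there m) (_ , c) = Comp-Suf ν π m c

Forced-Suf : (ν : Profile s) {a : Fin s} {i : ℕ} {q : Path s} (π : Path s) →
  Suf ((a , i) ∷ q) π → Forced ν π → Present (ν q a) i
Forced-Suf ν _       here      (h , _) = h
Forced-Suf ν (_ ∷ π) (there m) (_ , c) = Forced-Suf ν π m c

_⊑_ : Profile s → Profile s → Set
ν ⊑ ν' = ∀ {p a N} → ν p a ≡ just N → ν' p a ≡ just N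

Forced-mono : {ν ν' : Profile s} → ν ⊑ ν' → ∀ π → Forced ν π → Forced ν' π
Forced-mono le []            _       = unit
Forced-mono {ν = ν} {ν'} le ((a , i) ∷ p) (h , f) with present⇒just {ν p a} h
... | N , e , lt = subst (λ m → Present m i) (sym (le e)) lt , Forced-mono le p f

Comp-anti : {ν ν' : Profile s} → ν ⊑ ν' → ∀ π → Comp ν' π → Comp ν π
Comp-anti le [] _ = unit
Comp-anti {ν = ν} {ν'} le ((a , i) ∷ p) (h , c) = go (ν p a) refl , Comp-anti le p c
  where
  go : ∀ m → ν p a ≡ m → Allowed m i
  go nothing  e = unit
  go (just N) e = subst (λ m → Allowed m i) (le e) h

upd : Profile s → Path s → Fin s → ℕ → Profile s
upd ν p a N q b with q ≟ᵖ p | b Finₚ.≟ a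
... | yes _ | yes _ = just N
... | yes _ | no _  = ν q b
... | no _  | _     = ν q b

upd-hit : (ν : Profile s) (p : Path s) (a : Fin s) (N : ℕ) → upd ν p a N p a ≡ just N
upd-hit ν p a N with p ≟ᵖ p | a Finₚ.≟ a
... | yes _ | yes _ = refl
... | yes _ | no n  = ⊥-elim (n refl)
... | no n  | _     = ⊥-elim (n refl)

upd-miss : (ν : Profile s) (p : Path s) (a : Fin s) (N : ℕ) {q : Path s} {b : Fin s} →
  q ≢ p ⊎ b ≢ a → upd ν p a N q b ≡ ν q b
upd-miss ν p a N {q} {b} n with q ≟ᵖ p | b Finₚ.≟ a
... | yes _ | no _  = refl
... | no _  | _     = refl
upd-miss ν p a N (inj₁ n) | yes e | yes _ = ⊥-elim (n e)
upd-miss ν p a N (inj₂ n) | yes _ | yes e = ⊥-elim (n e)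

upd-cases : (ν : Profile s) (p : Path s) (a : Fin s) (N : ℕ) (q : Path s) (b : Fin s) {K : ℕ} →
  upd ν p a N q b ≡ just K → (q ≡ p × b ≡ a × K ≡ N) ⊎ ν q b ≡ just K
upd-cases ν p a N q b e with q ≟ᵖ p | b Finₚ.≟ a
upd-cases ν p a N q b refl | yes e | yes e' = inj₁ (e , e' , refl)
... | yes _ | no _  = inj₂ e
... | no _  | _     = inj₂ e

upd-⊑ : (ν : Profile s) (p : Path s) (a : Fin s) (N : ℕ) → ν p a ≡ nothing → ν ⊑ upd ν p a N
upd-⊑ ν p a N none {q} {b} {K} e with q ≟ᵖ p | b Finₚ.≟ a
... | yes refl | yes refl with trans (sym none) e
...   | ()
upd-⊑ ν p a N none e | yes _ | no _ = e
upd-⊑ ν p a N none e | no _  | _    = e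

Eventually : (ℕ → Set) → Set
Eventually P = ∃ λ b → ∀ N → b ≤ N → P N

eventually-all : {A : Set} {P : A → ℕ → Set} (xs : List A) → (∀ x → Eventually (P x)) →
  Eventually (λ N → ∀ {x} → x ∈ xs → P x N)
eventually-all []       h = 0 , λ N _ ()
eventually-all {P = P} (x ∷ xs) h = b ⊔ proj₁ r , λ N le → λ
  { (here refl) → proj₂ (h x) N (ℕₚ.m⊔n≤o⇒m≤o b (proj₁ r) le)
  ; (there m)   → proj₂ r N (ℕₚ.m⊔n≤o⇒n≤o b (proj₁ r) le) m }
  where
  b = proj₁ (h x)
  r = eventually-all {P = P} xs h

module Construction {s : ℕ} (k : ℕ) (𝒮 : Sys s) (N₀ : ℕ) where
  open Sys 𝒮
  open Nodes 𝒮
  open Generic k 𝒮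
  open Refinement k 𝒮

  Realises : Profile s → List (Path s) → Set
  Realises ν t = ∀ {p a N} → ν p a ≡ just N → ∀ i → ((a , i) ∷ p ∈ t → i < N) × (i < N → (a , i) ∷ p ∈ t)

  NZ : Profile s → ℕ → Node → Node → Set
  NZ ν n x y = ∃ λ t → FS k t × Realises ν t × Pts x t × Pts y t × Q (E n) t x y ≢ 0ℤ

  -- `solved` is the invariant proper: the prescriptions made so far destroy no separation of a
  -- compatible pair. By `bounded` and `rooted`, prescribed nodes have paths with indices below `M`,
  -- so exchanges among indices from `M` on do not move them.
  record State (ν : Profile s) (M : ℕ) : Set where
    field
      bounded : ∀ {p a N} → ν p a ≡ just N → N ≤ M
      rooted  : ∀ {p a N} → ν p a ≡ just N → Forced ν p
      short   : ∀ {p a N} → ν p a ≡ just N → length p < k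
      solved  : ∀ {n} → n < N₀ → ∀ x y → All (Comp ν) (pts x) → All (Comp ν) (pts y) →
                NV n x y → NZ ν n x y

  initial : State (λ _ _ → nothing) 0
  initial = record
    { bounded = λ () ; rooted = λ () ; short = λ ()
    ; solved = λ _ x y _ _ (t , fs , px , py , nz) → t , fs , (λ ()) , px , py , nz }

  module Step {ν M} (st : State ν M) (p : Path s) (a : Fin s) (none : ν p a ≡ nothing)
              (fp : Forced ν p) (lt : length p < k) where
    open State st

    root-present : ∀ q {t} → Forced ν q → Realises ν t → Has q t
    root-present []            f re = inj₁ refl
    root-present ((b , i) ∷ q) (h , f) re with present⇒just {ν q b} h
    ... | N , e , lt = inj₂ (proj₂ (re e i) lt)

    -- A witness for `ν` is filled up to `N` children at the new place. Fewer than all large `N`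
    -- would not do: the same `N` has to serve every pair.
    solve-one : ∀ {n} → n < N₀ → ∀ x y → All (Comp ν) (pts x) → All (Comp ν) (pts y) → NV n x y →
      Eventually (λ N → NZ (upd ν p a N) n x y)
    solve-one {n} n< x y cx cy nv with solved n< x y cx cy nv
    ... | t , fs , re , px , py , nz = proj₁ r , λ N le → fill t N ,
        fill-FS t N fs (root-present p fp re) lt , realises N (proj₂ (proj₂ r N le)) ,
        All.map (∈-fill⁺ t N) px , All.map (∈-fill⁺ t N) py , proj₁ (proj₂ r N le)
      where
      open Line {k = k} 𝒮 (E n) (E-inv n) x y p a
      r = fill-nonzero t fs px py nz
      realises : ∀ N → (∀ {i} → leaf i ∈ fill t N → i < N) → Realises (upd ν p a N) (fill t N)
      realises N h {q} {b} {K} e i with upd-cases ν p a N q b e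
      ... | inj₁ (refl , refl , refl) = h , leaf∈fill t N
      ... | inj₂ e' = (λ m → old (∈-fill⁻ t N m)) , λ i<K → ∈-fill⁺ t N (proj₂ (re e' i) i<K)
        where
        old : (b , i) ∷ q ∈ t ⊎ (∃ λ j → j < N × (b , i) ∷ q ≡ leaf j) → i < K
        old (inj₁ m) = proj₁ (re e' i) m
        old (inj₂ (_ , _ , refl)) with trans (sym none) e'
        ... | ()

    Solved : ℕ → Node → Node → ℕ → Set
    Solved n x y N = n < N₀ → All (Comp ν) (pts x) → All (Comp ν) (pts y) → NV n x y → NZ (upd ν p a N) n x y

    solve-rep : ∀ n x y → Eventually (Solved n x y)
    solve-rep n x y with n ℕ.<? N₀ | all? (comp? ν) (pts x) | all? (comp? ν) (pts y) | NV? n x y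
    ... | yes n< | yes cx | yes cy | yes nv = proj₁ r , λ N le _ _ _ _ → proj₂ r N le
      where r = solve-one n< x y cx cy nv
    ... | no c | _ | _ | _ = 0 , λ _ _ n< → ⊥-elim (c n<)
    ... | _ | no c | _ | _ = 0 , λ _ _ _ cx → ⊥-elim (c cx)
    ... | _ | _ | no c | _ = 0 , λ _ _ _ _ cy → ⊥-elim (c cy)
    ... | _ | _ | _ | no c = 0 , λ _ _ _ _ _ nv → ⊥-elim (c nv)

    -- Normalising leaves indices below `M` alone and uses at most one further index for each path
    -- of the pair.
    top : ℕ
    top = M ℕ.+ (dmax ℕ.+ dmax)

    solve-reps : Eventually (λ N → ∀ {n} → n ∈ upTo N₀ → ∀ {x} → x ∈ reps top → ∀ {y} → y ∈ reps top → Solved n x y N)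
    solve-reps = eventually-all (upTo N₀) λ n → eventually-all (reps top) λ x →
      eventually-all (reps top) λ y → solve-rep n x y

    N : ℕ
    -- Besides passing the thresholds of all representatives, `N` is at least `top`. An exchange
    -- made while normalising, if it concerns the `a`-labelled children of `p`, then merely permutes
    -- the prescribed ones.
    N = proj₁ solve-reps ⊔ top

    ν' : Profile s
    ν' = upd ν p a N

    top≤N : top ≤ N
    top≤N = ℕₚ.m≤n⊔m (proj₁ solve-reps) top

    M≤N : M ≤ N
    M≤N = ℕₚ.≤-trans (ℕₚ.m≤m+n M _) top≤N

    ν⊑ν' : ν ⊑ ν'
    ν⊑ν' = upd-⊑ ν p a N none

    rooted-old : ∀ q b {K} → ν' q b ≡ just K → Forced ν q
    rooted-old q b e with upd-cases ν p a N q b e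
    ... | inj₁ (refl , _) = fp
    ... | inj₂ e'         = rooted e'

    -- Exchanges of children i and m of (q , b) with M ≤ m ≤ i occur only where
    -- ν' prescribes nothing, or at (p , a), where both indices lie below N.
    module Exchange (b : Fin s) (i : ℕ) (q : Path s) (m : ℕ) (M≤m : M ≤ m) (m<top : m < top) (m≤i : m ≤ i) (ok : Allowed (ν' q b) i) where

      σ : Swap s
      σ = swap-at q b i m

      not-below : ∀ {j} → M ≤ j → ∀ {r c K} → ν' r c ≡ just K → ¬ Suf ((b , j) ∷ q) r
      not-below {j} le {r} {c} e su with present⇒just (Forced-Suf ν r su (rooted-old r c e))
      ... | K' , e' , j<K' = ℕₚ.<-irrefl refl (ℕₚ.<-≤-trans j<K' (ℕₚ.≤-trans (bounded e') le))

      fix-prescribed : ∀ {r c K} → ν' r c ≡ just K → act σ r ≡ r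
      fix-prescribed e = act-fix σ (not-below (ℕₚ.≤-trans M≤m m≤i) e) (not-below M≤m e)

      both-below : ∀ {K} → ν' q b ≡ just K → i < K × m < K
      both-below {K} e = i<K , m<K
        where
        i<K : i < K
        i<K = subst (λ z → Allowed z i) e ok
        m<K : m < K
        m<K with upd-cases ν p a N q b e
        ... | inj₁ (_ , _ , refl) = ℕₚ.<-≤-trans m<top top≤N
        ... | inj₂ e' = ⊥-elim (ℕₚ.<-irrefl refl (ℕₚ.<-≤-trans i<K (ℕₚ.≤-trans (bounded e') (ℕₚ.≤-trans M≤m m≤i))))

      swapℕ-below : ∀ {K} → i < K → m < K → ∀ j → j < K → swapℕ i m j < K
      swapℕ-below i<K m<K j j<K with j ℕ.≟ i
      ... | yes _ = m<K
      ... | no _ with j ℕ.≟ m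
      ...   | yes _ = i<K
      ...   | no _  = j<K

      child-index : ∀ {r c K} → ν' r c ≡ just K → ∀ j →
        ∃ λ j' → act σ ((c , j) ∷ r) ≡ (c , j') ∷ r × (j < K → j' < K)
      child-index {r} {c} {K} e j = go (r ≟ᵖ q) (c Finₚ.≟ b)
        where
        go : Dec (r ≡ q) → Dec (c ≡ b) → ∃ λ j' → act σ ((c , j) ∷ r) ≡ (c , j') ∷ r × (j < K → j' < K)
        go (yes refl) (yes refl) = swapℕ i m j , act-hit σ j ,
          swapℕ-below (proj₁ (both-below e)) (proj₂ (both-below e)) j
        go (yes refl) (no n) = j , trans (act-miss-label σ n) (cong ((c , j) ∷_) (fix-prescribed e)) , id
        go (no n) _ = j , trans (act-miss σ n) (cong ((c , j) ∷_) (fix-prescribed e)) , id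

      realises : ∀ {t} → Realises ν' t → Realises ν' (map (act σ) t)
      realises {t} re {r} {c} {K} e j with child-index e j
      ... | j' , moved , low = forth , back
        where
        forth : (c , j) ∷ r ∈ map (act σ) t → j < K
        forth m∈ with ∈-map⁻ (act σ) m∈
        ... | π , π∈ , eq with child-index e j'
        ...   | j'' , moved' , low' = subst (_< K) j''≡j (low' (proj₁ (re e j') π∈'))
          where
          π≡ : π ≡ (c , j') ∷ r
          π≡ = trans (sym (act-invol σ π)) (trans (cong (act σ) (sym eq)) moved)
          π∈' : (c , j') ∷ r ∈ t
          π∈' = subst (_∈ t) π≡ π∈
          j''≡j : j'' ≡ j
          j''≡j = same (trans (sym moved') (trans (cong (act σ) (sym π≡)) (sym eq)))
            where
            same : ∀ {u v} → (c , u) ∷ r ≡ (c , v) ∷ r → u ≡ v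
            same refl = refl
        back : j < K → (c , j) ∷ r ∈ map (act σ) t
        back j<K = subst (_∈ map (act σ) t) (trans (cong (act σ) (sym moved)) (act-invol σ _))
          (∈-map⁺ (act σ) (proj₂ (re e j') (low j<K)))

      comp : ∀ π → Comp ν' π → Comp ν' (act σ π)
      comp [] _ = unit
      comp ((c , j) ∷ r) (h , cr) = go (ν' (act σ r) c) refl
        where
        go : ∀ mb → ν' (act σ r) c ≡ mb → Comp ν' (act σ ((c , j) ∷ r))
        go nothing e with r ≟ᵖ q
        ... | yes refl = subst (λ z → Allowed z _) (sym e) unit , comp r cr
        ... | no _     = subst (λ z → Allowed z _) (sym e) unit , comp r cr
        go (just K) e = subst (Comp ν') (sym moved) (subst (λ z → Allowed z j') (sym e') (low j<K) , cr)
          where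
          fixed : act σ r ≡ r
          fixed = act-inj σ (fix-prescribed e)
          e' : ν' r c ≡ just K
          e' = trans (cong (λ z → ν' z c) (sym fixed)) e
          j<K : j < K
          j<K = subst (λ z → Allowed z j) e' h
          j' = proj₁ (child-index {r} {c} e' j)
          moved = proj₁ (proj₂ (child-index {r} {c} e' j))
          low = proj₂ (proj₂ (child-index {r} {c} e' j))

      NZ-back : ∀ n x y → NZ ν' n (mapN (act σ) x) (mapN (act σ) y) → NZ ν' n x y
      NZ-back n x y (t , fs , re , px , py , nz) = map (act σ) t , map-act-FS σ fs , realises re ,
        subst (λ z → Pts z (map (act σ) t)) (mapN-invol σ x) (Pts-map (act σ) (mapN (act σ) x) px) ,
        subst (λ z → Pts z (map (act σ) t)) (mapN-invol σ y) (Pts-map (act σ) (mapN (act σ) y) py) ,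
        λ e → nz (begin
          Q (E n) t (mapN (act σ) x) (mapN (act σ) y) ≡⟨ Q-swap (E-inv n) σ t _ _ ⟨
          Q (E n) (map (act σ) t) (mapN (act σ) (mapN (act σ) x)) (mapN (act σ) (mapN (act σ) y))
            ≡⟨ cong₂ (Q (E n) (map (act σ) t)) (mapN-invol σ x) (mapN-invol σ y) ⟩
          Q (E n) (map (act σ) t) x y ≡⟨ e ⟩
          0ℤ ∎)

    -- Exchanges that preserve `ν'` bring the pair among the representatives for which `N` was
    -- chosen. The tree found there is carried back by the same exchanges, which are involutions.
    solved' : ∀ {n} → n < N₀ → ∀ x y → All (Comp ν') (pts x) → All (Comp ν') (pts y) → NV n x y → NZ ν' n x y
    solved' {n} n< x y cx cy nv@(t₀ , fs₀ , px₀ , py₀ , _)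
      with normalise Z id M ℕₚ.≤-refl (ℕₚ.+-monoʳ-≤ M (pair-length x y)) id id-TailMap
             ((λ {z} m → All.lookup (Allₚ.++⁺ cx cy) m) , nv-id , nz-id)
      where
      Z = pts x ++ pts y
      Φ : (Path s → Path s) → Set
      Φ f = (∀ {z} → z ∈ Z → Comp ν' (f z)) × NV n (mapN f x) (mapN f y)
        × (NZ ν' n (mapN f x) (mapN f y) → NZ ν' n x y)
      mapN-id : ∀ z → mapN id z ≡ z
      mapN-id z = mapN-fix id z (λ _ → refl)
      nv-id : NV n (mapN id x) (mapN id y)
      nv-id = subst₂ (NV n) (sym (mapN-id x)) (sym (mapN-id y)) nv
      nz-id : NZ ν' n (mapN id x) (mapN id y) → NZ ν' n x y
      nz-id = subst₂ (NZ ν' n) (mapN-id x) (mapN-id y)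
      step : ∀ f → TailMap f → Φ f → ∀ {b i q z m} → z ∈ Z → Suf ((b , i) ∷ q) (f z) →
        M ≤ m → m < top → m ≤ i → Φ (act (swap-at q b i m) ∘ f)
      step f tl (c , nv , back) {b} {i} {q} {z} {m} z∈ su M≤m m<top m≤i =
        (λ {u} u∈ → comp (f u) (c u∈)) ,
        subst₂ (NV n) (mapN-∘ (act σ) f x) (mapN-∘ (act σ) f y)
          (Separation.NV-swap (E n) (E-inv n) σ (mapN f x) (mapN f y) nv) ,
        λ nz → back (NZ-back n (mapN f x) (mapN f y)
          (subst₂ (NZ ν' n) (sym (mapN-∘ (act σ) f x)) (sym (mapN-∘ (act σ) f y)) nz))
        where
        open Exchange b i q m M≤m m<top m≤i (Comp-Suf ν' (f z) su (c z∈))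
      open Normalise Φ M top Z step
    ... | f , tl , (c , nv' , back) , below , _ = back (proj₂ solve-reps N (ℕₚ.m≤m⊔n (proj₁ solve-reps) top)
          (∈-upTo⁺ n<) (rep x px₀ fs₀ ∈-++⁺ˡ) (rep y py₀ fs₀ (∈-++⁺ʳ (pts x))) n<
          (comp-pts x ∈-++⁺ˡ) (comp-pts y (∈-++⁺ʳ (pts x))) nv')
      where
      comp-pts : ∀ z → (∀ {π} → π ∈ pts z → π ∈ pts x ++ pts y) → All (Comp ν) (pts (mapN f z))
      comp-pts z sub = subst (All (Comp ν)) (sym (pts-mapN f z))
        (Allₚ.map⁺ (All.tabulate λ m → Comp-anti ν⊑ν' _ (c (sub m))))
      rep : ∀ z {t} → Pts z t → FS k t → (∀ {π} → π ∈ pts z → π ∈ pts x ++ pts y) → mapN f z ∈ reps top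
      rep z pz fs sub = ∈-reps⁺ (mapN f z) (Valid-map tl z (Pts⇒Valid {x = z} fs pz)) low
        where
        low : ∀ {π} → π ∈ pts (mapN f z) → Below top π
        low m with ∈-map⁻ f (subst (_ ∈_) (pts-mapN f z) m)
        ... | ρ , ρ∈ , refl = Below-mono (ℕₚ.+-monoʳ-≤ M (pair-length x y)) (below (sub ρ∈))

    state : State ν' N
    state = record { bounded = λ {q} {b} → bounded' {q} {b} ; rooted = λ {q} {b} e → Forced-mono ν⊑ν' q (rooted-old q b e)
                   ; short = λ {q} {b} → short' {q} {b} ; solved = solved' }
      where
      bounded' : ∀ {q b K} → ν' q b ≡ just K → K ≤ N
      bounded' {q} {b} e with upd-cases ν p a N q b e
      ... | inj₁ (_ , _ , refl) = ℕₚ.≤-refl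
      ... | inj₂ e'             = ℕₚ.≤-trans (bounded e') M≤N
      short' : ∀ {q b K} → ν' q b ≡ just K → length q < k
      short' {q} {b} e with upd-cases ν p a N q b e
      ... | inj₁ (refl , _) = lt
      ... | inj₂ e'         = short e'

  -- Whether a path of length at most `l` is forced depends only on prescriptions at smaller depth.
  -- `local` preserves these, so treating depth `l` creates no new nodes to be treated there.
  record Advance (l : ℕ) (ν : Profile s) (items : List (Path s × Fin s)) : Set where
    field
      ν'    : Profile s
      M'    : ℕ
      state : State ν' M'
      grows : ν ⊑ ν'
      local : ∀ {q b} → length q ≢ l → ν' q b ≡ ν q b
      done  : ∀ {q b} → (q , b) ∈ items → Forced ν q → ∃ λ N → ν' q b ≡ just N

  advance : ∀ {l ν M} → l < k → State ν M → ∀ items → (∀ {q b} → (q , b) ∈ items → length q ≡ l) → Advance l ν items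
  advance {ν = ν} {M} l<k st [] len = record
    { ν' = ν ; M' = M ; state = st ; grows = id ; local = λ _ → refl ; done = λ () }
  advance {l} {ν} {M} l<k st ((p , a) ∷ items) len with ν p a in e | forced? ν p
  ... | just N | _ = record
    { ν' = ν' ; M' = M' ; state = state ; grows = grows ; local = local
    ; done = λ { (here refl) f → N , grows e ; (there m) f → done m f } }
    where open Advance (advance l<k st items (len ∘ there))
  ... | nothing | no n = record
    { ν' = ν' ; M' = M' ; state = state ; grows = grows ; local = local
    ; done = λ { (here refl) f → ⊥-elim (n f) ; (there m) f → done m f } }
    where open Advance (advance l<k st items (len ∘ there))
  ... | nothing | yes f = record
    { ν' = R.ν' ; M' = R.M' ; state = R.state ; grows = R.grows ∘ X.ν⊑ν'
    ; local = λ {q} n → trans (R.local n)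
        (upd-miss ν p a X.N (inj₁ λ { refl → n (len (here refl)) }))
    ; done = λ { (here refl) _ → X.N , R.grows (upd-hit ν p a X.N)
               ; (there m) f → R.done m (Forced-mono X.ν⊑ν' _ f) } }
    where
    module X = Step st p a e f (subst (_< k) (sym (len (here refl))) l<k)
    module R = Advance (advance l<k X.state items (len ∘ there))

  Full : ℕ → Profile s → Set
  Full l ν = ∀ p a → Forced ν p → length p < l → ∃ λ N → ν p a ≡ just N

  full : ∀ l → l ≤ k → ∃ λ ν → ∃ λ M → State ν M × Full l ν
  full zero    le = (λ _ _ → nothing) , 0 , initial , λ _ _ _ ()
  full (suc l) le with full l (ℕₚ.≤-trans (ℕₚ.n≤1+n l) le)
  ... | ν , M , st , fl = ν' , M' , state , fl'
    where
    -- Forced paths have indices below `M`, so this finite list covers all of them at depth `l`.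
    items = cartesianProduct (pathsOf s l M) (allFin s)
    open Advance (advance le st items (λ m → ∈-pathsOf⁻ l M (proj₁ (∈-cartesianProduct⁻ (pathsOf s l M) (allFin s) m))))
    forced-back : ∀ p → length p ≤ l → Forced ν' p → Forced ν p
    forced-back [] _ _ = unit
    forced-back ((b , i) ∷ p) lt (h , f) = subst (λ m → Present m i) (local (ℕₚ.<⇒≢ lt)) h ,
      forced-back p (ℕₚ.≤-trans (ℕₚ.n≤1+n _) lt) f
    below : ∀ p → Forced ν p → Below M p
    below [] _ = []
    below ((b , i) ∷ p) (h , f) with present⇒just {ν p b} h
    ... | K , e , lt = ℕₚ.<-≤-trans lt (State.bounded st e) ∷ below p f
    fl' : Full (suc l) ν'
    fl' p a f (s≤s len) with length p ℕ.≟ l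
    ... | yes refl = done (∈-cartesianProduct⁺ (∈-pathsOf⁺ M p (below p (forced-back p len f))) (∈-allFin a))
                       (forced-back p len f)
    ... | no n with fl p a (forced-back p len f) (ℕₚ.≤∧≢⇒< len n)
    ...   | K , e = K , grows e

  profile : Profile s
  profile = proj₁ (full k ℕₚ.≤-refl)

  profile-full : Full k profile
  profile-full = proj₂ (proj₂ (proj₂ (full k ℕₚ.≤-refl)))

  -- A full profile is realised by only one set of edges, so the tree that `solved` supplies for a
  -- pair is `t` up to the order of the list.
  profile-generic : ∀ {t} → FS k t → (∀ {π} → π ∈ t → Forced profile π) →
    (∀ {π} → IsEdge k π → Forced profile π → π ∈ t) → IsGeneric N₀ t
  profile-generic {t} fs to back n n< {x} {y} px py nv
    with State.solved (proj₁ (proj₂ (proj₂ (full k ℕₚ.≤-refl)))) n< x y (comp px) (comp py) nv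
    where
    comp : ∀ {S} → All (_∈ t) S → All (Comp profile) S
    comp = All.map (λ {π} m → Forced⇒Comp profile π (to m))
  ... | t' , fs' , re , _ , _ , nz = λ e → nz (trans
        (Q-set (E n) x y (FS.uniq fs') (FS.uniq fs) (λ m → back (∈-edge fs' m) (forced m)) there-to) e)
    where
    forced : ∀ {π} → π ∈ t' → Forced profile π
    forced {[]} m = unit
    forced {(a , i) ∷ p} m = subst (λ z → Present z i) (sym (proj₂ N)) (proj₁ (re (proj₂ N) i) m) , forced-tail p m
      where
      forced-tail : ∀ q {κ} → κ ∷ q ∈ t' → Forced profile q
      forced-tail []      _ = unit
      forced-tail (κ ∷ q) m = forced {κ ∷ q} (FS.closed fs' m)
      N = profile-full p a (forced-tail p m) (FS.ht fs' m)
    there-to : ∀ {π} → π ∈ t → π ∈ t'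
    there-to {[]} m = ⊥-elim (FS.pos fs m)
    there-to {(a , i) ∷ p} m with present⇒just {profile p a} (proj₁ (to m))
    ... | N , e , lt = proj₂ (re e i) lt

-- Coding trees by paths

-- The index of a child is the number of its later siblings with the same label.
count : Fin s → Forest (Fin s) → ℕ
count a []             = 0
count a ((b , _) ∷ cs) with b Finₚ.≟ a
... | yes _ = suc (count a cs)
... | no _  = count a cs

count-hit : ∀ (a : Fin s) t cs → count a ((a , t) ∷ cs) ≡ suc (count a cs)
count-hit a t cs with a Finₚ.≟ a
... | yes _ = refl
... | no n  = ⊥-elim (n refl)

count-miss : ∀ {a b : Fin s} t cs → b ≢ a → count a ((b , t) ∷ cs) ≡ count a cs
count-miss {a = a} {b} t cs n with b Finₚ.≟ a
... | yes e = ⊥-elim (n e)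
... | no _  = refl

count-cons : ∀ (a b : Fin s) t cs → count a cs ≤ count a ((b , t) ∷ cs)
count-cons a b t cs with b Finₚ.≟ a
... | yes _ = ℕₚ.n≤1+n _
... | no _  = ℕₚ.≤-refl

mutual
  code : (t : Tree (Fin s)) → Path s → Edge t → Path s
  code (node cs) p e = codeF cs p e

  codeF : (cs : Forest (Fin s)) → Path s → EdgeF cs → Path s
  codeF ((a , t) ∷ cs) p (inj₁ nothing)  = (a , count a cs) ∷ p
  codeF ((a , t) ∷ cs) p (inj₁ (just e)) = code t ((a , count a cs) ∷ p) e
  codeF ((a , t) ∷ cs) p (inj₂ e)        = codeF cs p e

mutual
  edges : {L : Set} (t : Tree L) → List (Edge t)
  edges (node cs) = edgesF cs

  edgesF : {L : Set} (cs : Forest L) → List (EdgeF cs)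
  edgesF []             = []
  edgesF ((a , t) ∷ cs) = inj₁ nothing ∷ map (inj₁ ∘ just) (edges t) ++ map inj₂ (edgesF cs)

mutual
  ∈-edges : {L : Set} (t : Tree L) (e : Edge t) → e ∈ edges t
  ∈-edges (node cs) e = ∈-edgesF cs e

  ∈-edgesF : {L : Set} (cs : Forest L) (e : EdgeF cs) → e ∈ edgesF cs
  ∈-edgesF ((a , t) ∷ cs) (inj₁ nothing)  = here refl
  ∈-edgesF ((a , t) ∷ cs) (inj₁ (just e)) = there (∈-++⁺ˡ (∈-map⁺ (inj₁ ∘ just) (∈-edges t e)))
  ∈-edgesF ((a , t) ∷ cs) (inj₂ e)        = there (∈-++⁺ʳ (map (inj₁ ∘ just) (edges t)) (∈-map⁺ inj₂ (∈-edgesF cs e)))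

mutual
  edges-unique : {L : Set} (t : Tree L) → Unique (edges t)
  edges-unique (node cs) = edgesF-unique cs

  edgesF-unique : {L : Set} (cs : Forest L) → Unique (edgesF cs)
  edgesF-unique []             = []
  edgesF-unique ((a , t) ∷ cs) = All.tabulate apart ∷ Uniq.++⁺
    (Uniq.map⁺ (λ { refl → refl }) (edges-unique t)) (Uniq.map⁺ (λ { refl → refl }) (edgesF-unique cs)) disjoint
    where
    apart : ∀ {e} → e ∈ map (inj₁ ∘ just) (edges t) ++ map inj₂ (edgesF cs) → inj₁ nothing ≢ e
    apart m refl with ∈-++⁻ (map (inj₁ ∘ just) (edges t)) m
    ... | inj₁ m' with ∈-map⁻ (inj₁ ∘ just) m'
    ...   | _ , _ , ()
    apart m refl | inj₂ m' with ∈-map⁻ inj₂ m'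
    ...   | _ , _ , ()
    disjoint : ∀ {e} → ¬ (e ∈ map (inj₁ ∘ just) (edges t) × e ∈ map inj₂ (edgesF cs))
    disjoint (m , m') with ∈-map⁻ (inj₁ ∘ just) m | ∈-map⁻ inj₂ m'
    ... | _ , _ , refl | _ , _ , ()

mutual
  code-Suf : (t : Tree (Fin s)) (p : Path s) (e : Edge t) → Suf p (code t p e)
  code-Suf (node cs) p e = Suf-tail (proj₂ (proj₂ (proj₂ (codeF-key cs p e))))

  codeF-key : (cs : Forest (Fin s)) (p : Path s) (e : EdgeF cs) →
    ∃ λ b → ∃ λ c → c < count b cs × Suf ((b , c) ∷ p) (codeF cs p e)
  codeF-key ((a , t) ∷ cs) p (inj₁ nothing) =
    a , count a cs , subst (count a cs <_) (sym (count-hit a t cs)) ℕₚ.≤-refl , here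
  codeF-key ((a , t) ∷ cs) p (inj₁ (just e)) =
    a , count a cs , subst (count a cs <_) (sym (count-hit a t cs)) ℕₚ.≤-refl , code-Suf t _ e
  codeF-key ((a , t) ∷ cs) p (inj₂ e) with codeF-key cs p e
  ... | b , c , lt , su = b , c , ℕₚ.≤-trans lt (count-cons b a t cs) , su

code-cons : (t : Tree (Fin s)) (p : Path s) (e : Edge t) → ∃ λ κ → Suf (κ ∷ p) (code t p e)
code-cons (node cs) p e with codeF-key cs p e
... | b , c , _ , su = _ , su

-- The first tree of a forest has index `count a cs`, and every later sibling with label `a` has a
-- smaller one.
codeF-apart : (a : Fin s) (t : Tree (Fin s)) (cs : Forest (Fin s)) (p : Path s) {π : Path s} →
  Suf ((a , count a cs) ∷ p) π → ∀ e → codeF cs p e ≢ π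
codeF-apart a t cs p su e refl with codeF-key cs p e
... | b , c , lt , su' with Suf-unique su su'
...   | refl = ℕₚ.<-irrefl refl lt

mutual
  code-inj : (t : Tree (Fin s)) (p : Path s) {e e' : Edge t} → code t p e ≡ code t p e' → e ≡ e'
  code-inj (node cs) p eq = codeF-inj cs p _ _ eq

  codeF-inj : (cs : Forest (Fin s)) (p : Path s) (e e' : EdgeF cs) → codeF cs p e ≡ codeF cs p e' → e ≡ e'
  codeF-inj ((a , t) ∷ cs) p (inj₁ nothing) (inj₁ nothing) eq = refl
  codeF-inj ((a , t) ∷ cs) p (inj₁ nothing) (inj₁ (just e')) eq =
    ⊥-elim (¬Suf-longer (subst (Suf _) (sym eq) (proj₂ (code-cons t _ e'))))
  codeF-inj ((a , t) ∷ cs) p (inj₁ nothing) (inj₂ e') eq = ⊥-elim (codeF-apart a t cs p here e' (sym eq))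
  codeF-inj ((a , t) ∷ cs) p (inj₁ (just e)) (inj₁ nothing) eq =
    ⊥-elim (¬Suf-longer (subst (Suf _) eq (proj₂ (code-cons t _ e))))
  codeF-inj ((a , t) ∷ cs) p (inj₁ (just e)) (inj₁ (just e')) eq = cong (inj₁ ∘ just) (code-inj t _ eq)
  codeF-inj ((a , t) ∷ cs) p (inj₁ (just e)) (inj₂ e') eq =
    ⊥-elim (codeF-apart a t cs p (code-Suf t _ e) e' (sym eq))
  codeF-inj ((a , t) ∷ cs) p (inj₂ e) (inj₁ nothing) eq = ⊥-elim (codeF-apart a t cs p here e eq)
  codeF-inj ((a , t) ∷ cs) p (inj₂ e) (inj₁ (just e')) eq =
    ⊥-elim (codeF-apart a t cs p (code-Suf t _ e') e eq)
  codeF-inj ((a , t) ∷ cs) p (inj₂ e) (inj₂ e') eq = cong inj₂ (codeF-inj cs p e e' eq)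

mutual
  -- Label and parent are thereby read off the head and the tail of the code, which is all that
  -- formulas need besides equality.
  code-head : (t : Tree (Fin s)) (p : Path s) (e : Edge t) → ∃ λ c →
    code t p e ≡ (label t e , c) ∷ (if isTop t e then p else code t p (parent t e))
  code-head (node cs) p e = codeF-head cs p e

  codeF-head : (cs : Forest (Fin s)) (p : Path s) (e : EdgeF cs) → ∃ λ c →
    codeF cs p e ≡ (labelF cs e , c) ∷ (if isTopF cs e then p else codeF cs p (parentF cs e))
  codeF-head ((a , t) ∷ cs) p (inj₁ nothing) = _ , refl
  codeF-head ((a , t) ∷ cs) p (inj₁ (just e)) with isTop t e | code-head t ((a , count a cs) ∷ p) e
  ... | true  | h = h
  ... | false | h = h
  codeF-head ((a , t) ∷ cs) p (inj₂ e) = codeF-head cs p e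

mutual
  top-parent : {L : Set} (t : Tree L) (e : Edge t) → isTop t e ≡ true → parent t e ≡ e
  top-parent (node cs) e top = topF-parent cs e top

  topF-parent : {L : Set} (cs : Forest L) (e : EdgeF cs) → isTopF cs e ≡ true → parentF cs e ≡ e
  topF-parent ((a , t) ∷ cs) (inj₁ nothing)  top = refl
  topF-parent ((a , t) ∷ cs) (inj₁ (just e)) ()
  topF-parent ((a , t) ∷ cs) (inj₂ e)        top = cong inj₂ (topF-parent cs e top)

root-code : (t : Tree (Fin s)) → Edge t → Path s
root-code t = code t []

code-par : (t : Tree (Fin s)) (e : Edge t) → par↑ (root-code t e) ≡ root-code t (parent t e)
code-par t e with isTop t e in top | code-head t [] e
... | true  | c , eq = trans (cong par↑ eq) (trans (sym eq) (cong (root-code t) (sym (top-parent t e top))))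
... | false | c , eq = trans (cong par↑ eq) (par-cons (code-cons t [] (parent t e)))
  where
  par-cons : ∀ {κ} {π : Path _} → (∃ λ κ' → Suf (κ' ∷ []) π) → par↑ (κ ∷ π) ≡ π
  par-cons {π = _ ∷ _} _ = refl

mutual
  code-height : ∀ {h} (t : Tree (Fin s)) p (e : Edge t) → HeightLE h t → length (code t p e) ≤ h ℕ.+ length p
  code-height (node cs) p e hl = codeF-height cs p e hl

  codeF-height : ∀ {h} (cs : Forest (Fin s)) p (e : EdgeF cs) → HeightLEF h cs → length (codeF cs p e) ≤ h ℕ.+ length p
  codeF-height {h = suc h} ((a , t) ∷ cs) p (inj₁ nothing)  hl = s≤s (ℕₚ.m≤n+m _ h)
  codeF-height {h = suc h} ((a , t) ∷ cs) p (inj₁ (just e)) (hl , _) =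
    subst (length (code t ((a , count a cs) ∷ p) e) ≤_) (ℕₚ.+-suc h (length p)) (code-height t ((a , count a cs) ∷ p) e hl)
  codeF-height {h = suc h} ((a , t) ∷ cs) p (inj₂ e) (_ , hl) = codeF-height cs p e hl
  codeF-height {h = zero} (_ ∷ _) p e ()

paths : Tree (Fin s) → List (Path s)
paths t = map (root-code t) (edges t)

∈-paths : (t : Tree (Fin s)) (e : Edge t) → root-code t e ∈ paths t
∈-paths t e = ∈-map⁺ (root-code t) (∈-edges t e)

paths-FS : ∀ {k} (t : Tree (Fin s)) → HeightLE k t → FS k (paths t)
paths-FS {k = k} t hl = record
  { uniq = Uniq.map⁺ (code-inj t []) (edges-unique t)
  ; closed = closed'
  ; pos = pos'
  ; ht = ht' }
  where
  closed' : ∀ {π} → π ∈ paths t → par↑ π ∈ paths t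
  closed' m with ∈-map⁻ (root-code t) m
  ... | e , _ , refl = subst (_∈ paths t) (sym (code-par t e)) (∈-paths t (parent t e))
  pos' : [] ∉ paths t
  pos' m with ∈-map⁻ (root-code t) m
  ... | e , _ , eq with subst (Suf _) (sym eq) (proj₂ (code-cons t [] e))
  ...   | ()
  ht' : ∀ {π} → π ∈ paths t → length π ≤ k
  ht' m with ∈-map⁻ (root-code t) m
  ... | e , _ , refl = subst (length (root-code t e) ≤_) (ℕₚ.+-identityʳ k) (code-height t [] e hl)

-- Formulas evaluated on paths

labᵖ : Fin s → Path s → Bool
labᵖ a []            = false
labᵖ a ((b , _) ∷ _) = does (b Finₚ.≟ a)

termᵖ : ∀ {m} → Vec (Path s) m → Term m → Path s
termᵖ v (var x) = Vec.lookup v x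
termᵖ v (par u) = par↑ (termᵖ v u)

evalᵖ : ∀ {m} → Vec (Path s) m → QF s m → Bool
evalᵖ v tt        = true
evalᵖ v ff        = false
evalᵖ v (u ≐ w)   = does (termᵖ v u ≟ᵖ termᵖ v w)
evalᵖ v (lab a u) = labᵖ a (termᵖ v u)
evalᵖ v (neg φ)   = not (evalᵖ v φ)
evalᵖ v (φ and ψ) = evalᵖ v φ ∧ evalᵖ v ψ
evalᵖ v (φ or ψ)  = evalᵖ v φ ∨ evalᵖ v ψ

act-labᵖ : ∀ (σ : Swap s) a π → labᵖ a (act σ π) ≡ labᵖ a π
act-labᵖ σ a []      = refl
act-labᵖ σ a (κ ∷ π) with does (π ≟ᵖ Swap.pre σ)
... | true  = refl
... | false = refl

term-swap : ∀ {m} (σ : Swap s) (v : Vec (Path s) m) u → termᵖ (Vec.map (act σ) v) u ≡ act σ (termᵖ v u)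
term-swap σ v (var x) = Vecₚ.lookup-map x (act σ) v
term-swap σ v (par u) = trans (cong par↑ (term-swap σ v u)) (act-par σ (termᵖ v u))

eval-swap : ∀ {m} (σ : Swap s) (v : Vec (Path s) m) φ → evalᵖ (Vec.map (act σ) v) φ ≡ evalᵖ v φ
eval-swap σ v tt = refl
eval-swap σ v ff = refl
eval-swap σ v (u ≐ w) = does-⇔ (termᵖ (Vec.map (act σ) v) u ≟ᵖ termᵖ (Vec.map (act σ) v) w) (termᵖ v u ≟ᵖ termᵖ v w)
  (λ e → act-inj σ (trans (sym (term-swap σ v u)) (trans e (term-swap σ v w))))
  (λ e → trans (term-swap σ v u) (trans (cong (act σ) e) (sym (term-swap σ v w))))
eval-swap σ v (lab a u) = trans (cong (labᵖ a) (term-swap σ v u)) (act-labᵖ σ a (termᵖ v u))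
eval-swap σ v (neg φ) = cong not (eval-swap σ v φ)
eval-swap σ v (φ and ψ) = cong₂ _∧_ (eval-swap σ v φ) (eval-swap σ v ψ)
eval-swap σ v (φ or ψ) = cong₂ _∨_ (eval-swap σ v φ) (eval-swap σ v ψ)

module _ (t : Tree (Fin s)) where

  term-code : ∀ {m} (v : Vec (Edge t) m) u → termᵖ (Vec.map (root-code t) v) u ≡ root-code t (evalTerm {s} t v u)
  term-code v (var x) = Vecₚ.lookup-map x (root-code t) v
  term-code v (par u) = trans (cong par↑ (term-code v u)) (code-par t (evalTerm {s} t v u))

  eval-code : ∀ {m} (v : Vec (Edge t) m) φ → evalᵖ (Vec.map (root-code t) v) φ ≡ evalQF t v φ
  eval-code v tt = refl
  eval-code v ff = refl
  eval-code v (u ≐ w) = does-⇔ (termᵖ (Vec.map (root-code t) v) u ≟ᵖ termᵖ (Vec.map (root-code t) v) w)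
    (edge-≟ t (evalTerm {s} t v u) (evalTerm {s} t v w))
    (λ e → code-inj t [] (trans (sym (term-code v u)) (trans e (term-code v w))))
    (λ e → trans (term-code v u) (trans (cong (root-code t) e) (sym (term-code v w))))
  eval-code v (lab a u) = trans (cong (labᵖ a) (trans (term-code v u) (proj₂ (code-head t [] (evalTerm {s} t v u))))) refl
  eval-code v (neg φ) = cong not (eval-code v φ)
  eval-code v (φ and ψ) = cong₂ _∧_ (eval-code v φ) (eval-code v ψ)
  eval-code v (φ or ψ) = cong₂ _∨_ (eval-code v φ) (eval-code v ψ)

-- ρ₁ and ρ₂ are the virtual roots.

data Component (c d : ℕ) : Set where
  ρ₁ ρ₂  : Component c d
  first  : Fin c → Component c d
  second : Fin d → Component c d

module Pair (f g : Interp s) where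

  Cmp₂ : Set
  Cmp₂ = Component (comps f) (comps g)

  dim₂ : Cmp₂ → ℕ
  dim₂ ρ₁         = 0
  dim₂ ρ₂         = 0
  dim₂ (first i)  = dim f i
  dim₂ (second i) = dim g i

  -- The nodes of the system are arbitrary tuples, so the domain formulas enter the relation. A
  -- tuple outside the universe is then nobody's child and contributes nothing to `ε`.
  relOf : (h : Interp s) (i j : Fin (comps h)) → Vec (Path s) (dim h i) → Vec (Path s) (dim h j) → Bool
  relOf h i j v w = evalᵖ v (dom h i) ∧ (evalᵖ w (dom h j) ∧ evalᵖ (v Vec.++ w) (rel h i j))

  rel₂ : Σ Cmp₂ (Vec (Path s) ∘ dim₂) → Σ Cmp₂ (Vec (Path s) ∘ dim₂) → Bool
  rel₂ (ρ₁ , _)       (first j , w)  = evalᵖ w (dom f j)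
  rel₂ (ρ₂ , _)       (second j , w) = evalᵖ w (dom g j)
  rel₂ (first i , v)  (first j , w)  = relOf f i j v w
  rel₂ (second i , v) (second j , w) = relOf g i j v w
  rel₂ _              _              = false

  relOf-swap : ∀ h i j σ v w → relOf h i j (Vec.map (act σ) v) (Vec.map (act σ) w) ≡ relOf h i j v w
  relOf-swap h i j σ v w = cong₂ _∧_ (eval-swap σ v (dom h i)) (cong₂ _∧_ (eval-swap σ w (dom h j))
    (trans (cong (λ u → evalᵖ u (rel h i j)) (sym (Vecₚ.map-++ (act σ) v w))) (eval-swap σ (v Vec.++ w) (rel h i j))))

  components : List Cmp₂
  components = ρ₁ ∷ ρ₂ ∷ map first (allFin (comps f)) ++ map second (allFin (comps g))

  ∈-components : ∀ i → i ∈ components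
  ∈-components ρ₁         = here refl
  ∈-components ρ₂         = there (here refl)
  ∈-components (first i)  = there (there (∈-++⁺ˡ (∈-map⁺ first (∈-allFin i))))
  ∈-components (second i) = there (there (∈-++⁺ʳ (map first (allFin (comps f))) (∈-map⁺ second (∈-allFin i))))

  components-unique : Unique components
  components-unique = All.tabulate apart₁ ∷ All.tabulate apart₂ ∷ Uniq.++⁺
    (Uniq.map⁺ (λ { refl → refl }) (Uniq.allFin⁺ _)) (Uniq.map⁺ (λ { refl → refl }) (Uniq.allFin⁺ _)) disjoint
    where
    rest : List Cmp₂
    rest = map first (allFin (comps f)) ++ map second (allFin (comps g))
    in-rest : ∀ {i} → i ∈ rest → i ≢ ρ₁ × i ≢ ρ₂
    in-rest m with ∈-++⁻ (map first (allFin (comps f))) m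
    ... | inj₁ m' with ∈-map⁻ first m'
    ...   | _ , _ , refl = (λ ()) , λ ()
    in-rest m | inj₂ m' with ∈-map⁻ second m'
    ...   | _ , _ , refl = (λ ()) , λ ()
    apart₁ : ∀ {i} → i ∈ ρ₂ ∷ rest → ρ₁ ≢ i
    apart₁ (there m) refl = proj₁ (in-rest m) refl
    apart₂ : ∀ {i} → i ∈ rest → ρ₂ ≢ i
    apart₂ m refl = proj₂ (in-rest m) refl
    disjoint : ∀ {i} → ¬ (i ∈ map first (allFin (comps f)) × i ∈ map second (allFin (comps g)))
    disjoint (m , m') with ∈-map⁻ first m | ∈-map⁻ second m'
    ... | _ , _ , refl | _ , _ , ()

  sys : Sys s
  sys = record
    { Cmp = Cmp₂ ; cmps = components ; ∈-cmps = ∈-components ; cmps-unique = components-unique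
    ; arity = dim₂ ; isChild = rel₂ ; isChild-swap = swapped }
    where
    swapped : ∀ σ x y → rel₂ (proj₁ x , Vec.map (act σ) (proj₂ x)) (proj₁ y , Vec.map (act σ) (proj₂ y)) ≡ rel₂ x y
    swapped σ (ρ₁ , _)       (ρ₁ , _)       = refl
    swapped σ (ρ₁ , _)       (ρ₂ , _)       = refl
    swapped σ (ρ₁ , _)       (first j , w)  = eval-swap σ w (dom f j)
    swapped σ (ρ₁ , _)       (second j , w) = refl
    swapped σ (ρ₂ , _)       (ρ₁ , _)       = refl
    swapped σ (ρ₂ , _)       (ρ₂ , _)       = refl
    swapped σ (ρ₂ , _)       (first j , w)  = refl
    swapped σ (ρ₂ , _)       (second j , w) = eval-swap σ w (dom g j)
    swapped σ (first i , v)  (ρ₁ , _)       = refl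
    swapped σ (first i , v)  (ρ₂ , _)       = refl
    swapped σ (first i , v)  (first j , w)  = relOf-swap f i j σ v w
    swapped σ (first i , v)  (second j , w) = refl
    swapped σ (second i , v) (ρ₁ , _)       = refl
    swapped σ (second i , v) (ρ₂ , _)       = refl
    swapped σ (second i , v) (first j , w)  = refl
    swapped σ (second i , v) (second j , w) = relOf-swap g i j σ v w

-- The tree of a profile

module Make (ν : Profile s) where

  size : Maybe ℕ → ℕ
  size nothing  = 0
  size (just N) = N

  num : Path s → Fin s → ℕ
  num p a = size (ν p a)

  present⇒< : ∀ m {i} → Present m i → i < size m
  present⇒< (just N) lt = lt

  <⇒present : ∀ m {i} → i < size m → Present m i
  <⇒present (just N) lt = lt

  mutual
    make : ℕ → Path s → Tree (Fin s)
    make zero    p = node []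
    make (suc h) p = node (kids h p (allFin s))

    kids : ℕ → Path s → List (Fin s) → Forest (Fin s)
    kids h p []       = []
    kids h p (a ∷ as) = block h p a (num p a) (kids h p as)

    -- The indices descend along the list because the code of a child counts its later siblings with
    -- the same label: the child built for index `i` is followed by exactly `i` of them.
    block : ℕ → Path s → Fin s → ℕ → Forest (Fin s) → Forest (Fin s)
    block h p a zero    rest = rest
    block h p a (suc i) rest = (a , make h ((a , i) ∷ p)) ∷ block h p a i rest

  count-block : ∀ h p a i rest → count a (block h p a i rest) ≡ i ℕ.+ count a rest
  count-block h p a zero    rest = refl
  count-block h p a (suc i) rest =
    trans (count-hit a (make h ((a , i) ∷ p)) (block h p a i rest)) (cong suc (count-block h p a i rest))

  count-block-other : ∀ h p a i rest {b} → a ≢ b → count b (block h p a i rest) ≡ count b rest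
  count-block-other h p a zero    rest n = refl
  count-block-other h p a (suc i) rest n =
    trans (count-miss (make h ((a , i) ∷ p)) (block h p a i rest) n) (count-block-other h p a i rest n)

  count-kids : ∀ h p as {b} → All (b ≢_) as → count b (kids h p as) ≡ 0
  count-kids h p []       []       = refl
  count-kids h p (a ∷ as) (n ∷ ns) =
    trans (count-block-other h p a (num p a) (kids h p as) (n ∘ sym)) (count-kids h p as ns)

  index : ∀ h p a as i → All (a ≢_) as → count a (block h p a i (kids h p as)) ≡ i
  index h p a as i n = trans (count-block h p a i (kids h p as))
    (trans (cong (i ℕ.+_) (count-kids h p as n)) (ℕₚ.+-identityʳ i))

  mutual
    make-forced : ∀ h p → Forced ν p → ∀ e → Forced ν (code (make h p) p e)
    make-forced (suc h) p fp e = kids-forced h p (allFin s) (Uniq.allFin⁺ s) fp e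

    kids-forced : ∀ h p as → Unique as → Forced ν p → ∀ e → Forced ν (codeF (kids h p as) p e)
    kids-forced h p (a ∷ as) (n ∷ u) fp e =
      block-forced h p a as (num p a) ℕₚ.≤-refl n fp (kids-forced h p as u fp) e

    block-forced : ∀ h p a as i → i ≤ num p a → All (a ≢_) as → Forced ν p →
      (∀ e → Forced ν (codeF (kids h p as) p e)) → ∀ e → Forced ν (codeF (block h p a i (kids h p as)) p e)
    block-forced h p a as zero    le n fp rest e = rest e
    block-forced h p a as (suc i) le n fp rest (inj₂ e) =
      block-forced h p a as i (ℕₚ.≤-trans (ℕₚ.n≤1+n i) le) n fp rest e
    block-forced h p a as (suc i) le n fp rest (inj₁ nothing) rewrite index h p a as i n =
      <⇒present (ν p a) le , fp
    block-forced h p a as (suc i) le n fp rest (inj₁ (just e)) rewrite index h p a as i n =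
      make-forced h ((a , i) ∷ p) (<⇒present (ν p a) le , fp) e

  block-skip : ∀ h p a i rest (e : EdgeF rest) → ∃ λ e' → codeF (block h p a i rest) p e' ≡ codeF rest p e
  block-skip h p a zero    rest e = e , refl
  block-skip h p a (suc i) rest e with block-skip h p a i rest e
  ... | e' , eq = inj₂ e' , eq

  Suf-cases : ∀ {p π : Path s} → Suf p π → π ≡ p ⊎ ∃ λ κ → Suf (κ ∷ p) π
  Suf-cases here = inj₁ refl
  Suf-cases (there {κ} m) with Suf-cases m
  ... | inj₁ refl      = inj₂ (κ , here)
  ... | inj₂ (κ' , m') = inj₂ (κ' , there m')

  mutual
    make-complete : ∀ h p {κ π} → Suf (κ ∷ p) π → Forced ν π → length π ≤ h ℕ.+ length p →
      ∃ λ e → code (make h p) p e ≡ π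
    make-complete zero    p su f le = ⊥-elim (ℕₚ.<-irrefl refl (ℕₚ.≤-trans (Suf-length su) le))
    make-complete (suc h) p {a , j} su f le =
      kids-complete h p (allFin s) (Uniq.allFin⁺ s) (∈-allFin a) su f le

    kids-complete : ∀ h p as → Unique as → ∀ {a j π} → a ∈ as → Suf ((a , j) ∷ p) π → Forced ν π →
      length π ≤ suc h ℕ.+ length p → ∃ λ e → codeF (kids h p as) p e ≡ π
    kids-complete h p (a ∷ as) (n ∷ u) {π = π} (here refl) su f le =
      block-complete h p a as (num p a) n (present⇒< (ν p a) (Forced-Suf ν π su f)) su f le
    kids-complete h p (a ∷ as) (n ∷ u) (there m) su f le with kids-complete h p as u m su f le
    ... | e , eq with block-skip h p a (num p a) (kids h p as) e
    ...   | e' , eq' = e' , trans eq' eq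

    block-complete : ∀ h p a as i → All (a ≢_) as → ∀ {j π} → j < i → Suf ((a , j) ∷ p) π → Forced ν π →
      length π ≤ suc h ℕ.+ length p → ∃ λ e → codeF (block h p a i (kids h p as)) p e ≡ π
    block-complete h p a as (suc i) n {j} {π} j<i su f le with j ℕ.≟ i
    ... | no j≢i with block-complete h p a as i n (ℕₚ.≤∧≢⇒< (ℕₚ.≤-pred j<i) j≢i) su f le
    ...   | e , eq = inj₂ e , eq
    block-complete h p a as (suc i) n {j} {π} j<i su f le | yes refl with Suf-cases su
    ... | inj₁ refl = inj₁ nothing , cong (λ m → (a , m) ∷ p) (index h p a as i n)
    ... | inj₂ (κ , su') with make-complete h ((a , i) ∷ p) su' f (subst (length π ≤_) (sym (ℕₚ.+-suc h (length p))) le)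
    ...   | e , eq = inj₁ (just e) , trans (cong (λ m → code (make h ((a , i) ∷ p)) ((a , m) ∷ p) e) (index h p a as i n)) eq

  mutual
    make-height : ∀ h p → HeightLE h (make h p)
    make-height zero    p = unit
    make-height (suc h) p = kids-height h p (allFin s)

    kids-height : ∀ h p as → HeightLEF (suc h) (kids h p as)
    kids-height h p []       = unit
    kids-height h p (a ∷ as) = block-height h p a (num p a) (kids h p as) (kids-height h p as)

    block-height : ∀ h p a i rest → HeightLEF (suc h) rest → HeightLEF (suc h) (block h p a i rest)
    block-height h p a zero    rest r = r
    block-height h p a (suc i) rest r = make-height h ((a , i) ∷ p) , block-height h p a i rest r

  paths-make⁻ : ∀ k {π} → π ∈ paths (make k []) → Forced ν π
  paths-make⁻ k m with ∈-map⁻ (root-code (make k [])) m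
  ... | e , _ , refl = make-forced k [] unit e

  paths-make⁺ : ∀ k {π} → IsEdge k π → Forced ν π → π ∈ paths (make k [])
  paths-make⁺ k {π} (pos , le) f with Suf-cases (suf-nil π)
    where
    suf-nil : ∀ (ρ : Path s) → Suf [] ρ
    suf-nil []      = here
    suf-nil (κ ∷ ρ) = there (suf-nil ρ)
  ... | inj₁ refl = ⊥-elim (ℕₚ.1+n≰n pos)
  ... | inj₂ (κ , su) with make-complete k [] su f (subst (length π ≤_) (sym (ℕₚ.+-identityʳ k)) le)
  ...   | e , refl = ∈-paths (make k []) e

-- Outputs and colour refinement

≅-sym : ∀ {A B} → A ≅ B → B ≅ A
≅-sym {A} {B} i = record
  { to = from ; from = to ; from∘to = to∘from ; to∘from = from∘to
  ; to-pres = λ x y r → to-refl _ _ (subst₂ (Rel B) (sym (to∘from x)) (sym (to∘from y)) r)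
  ; to-refl = λ x y r → subst₂ (Rel B) (to∘from x) (to∘from y) (to-pres _ _ r) }
  where open _≅_ i

≅-trans : ∀ {A B C} → A ≅ B → B ≅ C → A ≅ C
≅-trans i j = record
  { to = J.to ∘ I.to ; from = I.from ∘ J.from
  ; from∘to = λ x → trans (cong I.from (J.from∘to (I.to x))) (I.from∘to x)
  ; to∘from = λ z → trans (cong J.to (I.to∘from (J.from z))) (J.to∘from z)
  ; to-pres = λ x y r → J.to-pres _ _ (I.to-pres x y r)
  ; to-refl = λ x y r → I.to-refl x y (J.to-refl _ _ r) }
  where
  module I = _≅_ i
  module J = _≅_ j

-- Isomorphisms of unlabelled trees

record EdgeIso (t u : Tree ⊤) : Set where
  field
    to      : Edge t → Edge u
    from    : Edge u → Edge t
    from∘to : ∀ e → from (to e) ≡ e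
    to∘from : ∀ e → to (from e) ≡ e
    top     : ∀ e → isTop u (to e) ≡ isTop t e
    par-to  : ∀ e → parent u (to e) ≡ to (parent t e)

EdgeIso-refl : ∀ t → EdgeIso t t
EdgeIso-refl t = record { to = id ; from = id ; from∘to = λ _ → refl ; to∘from = λ _ → refl
                        ; top = λ _ → refl ; par-to = λ _ → refl }

EdgeIso-trans : ∀ {t u v} → EdgeIso t u → EdgeIso u v → EdgeIso t v
EdgeIso-trans i j = record
  { to = J.to ∘ I.to ; from = I.from ∘ J.from
  ; from∘to = λ x → trans (cong I.from (J.from∘to (I.to x))) (I.from∘to x)
  ; to∘from = λ z → trans (cong J.to (I.to∘from (J.from z))) (J.to∘from z)
  ; top = λ e → trans (J.top (I.to e)) (I.top e)
  ; par-to = λ e → trans (J.par-to (I.to e)) (cong J.to (I.par-to e)) }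
  where
  module I = EdgeIso i
  module J = EdgeIso j

EdgeIso-cons : ∀ {t u cs ds} {a b : ⊤} → EdgeIso t u → EdgeIso (node cs) (node ds) →
  EdgeIso (node ((a , t) ∷ cs)) (node ((b , u) ∷ ds))
EdgeIso-cons {t} {u} {cs} {ds} {a} {b} i j = record
  { to = to' ; from = from' ; from∘to = ft ; to∘from = tf ; top = top' ; par-to = par' }
  where
  module I = EdgeIso i
  module J = EdgeIso j
  to' : EdgeF ((a , t) ∷ cs) → EdgeF ((b , u) ∷ ds)
  to' (inj₁ nothing)  = inj₁ nothing
  to' (inj₁ (just e)) = inj₁ (just (I.to e))
  to' (inj₂ e)        = inj₂ (J.to e)
  from' : EdgeF ((b , u) ∷ ds) → EdgeF ((a , t) ∷ cs)
  from' (inj₁ nothing)  = inj₁ nothing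
  from' (inj₁ (just e)) = inj₁ (just (I.from e))
  from' (inj₂ e)        = inj₂ (J.from e)
  ft : ∀ e → from' (to' e) ≡ e
  ft (inj₁ nothing)  = refl
  ft (inj₁ (just e)) = cong (inj₁ ∘ just) (I.from∘to e)
  ft (inj₂ e)        = cong inj₂ (J.from∘to e)
  tf : ∀ e → to' (from' e) ≡ e
  tf (inj₁ nothing)  = refl
  tf (inj₁ (just e)) = cong (inj₁ ∘ just) (I.to∘from e)
  tf (inj₂ e)        = cong inj₂ (J.to∘from e)
  top' : ∀ e → isTopF ((b , u) ∷ ds) (to' e) ≡ isTopF ((a , t) ∷ cs) e
  top' (inj₁ nothing)  = refl
  top' (inj₁ (just e)) = refl
  top' (inj₂ e)        = J.top e
  par' : ∀ e → parentF ((b , u) ∷ ds) (to' e) ≡ to' (parentF ((a , t) ∷ cs) e)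
  par' (inj₁ nothing)  = refl
  par' (inj₁ (just e)) with isTop t e | isTop u (I.to e) | I.top e
  ... | true  | .true  | refl = refl
  ... | false | .false | refl = cong (inj₁ ∘ just) (I.par-to e)
  par' (inj₂ e) = cong inj₂ (J.par-to e)

EdgeIso-swap : ∀ x y (ds : Forest ⊤) → EdgeIso (node (x ∷ y ∷ ds)) (node (y ∷ x ∷ ds))
EdgeIso-swap (a , t) (b , u) ds = record
  { to = sw ; from = sw' ; from∘to = ft ; to∘from = tf ; top = top' ; par-to = par' }
  where
  sw : EdgeF ((a , t) ∷ (b , u) ∷ ds) → EdgeF ((b , u) ∷ (a , t) ∷ ds)
  sw (inj₁ m)        = inj₂ (inj₁ m)
  sw (inj₂ (inj₁ m)) = inj₁ m
  sw (inj₂ (inj₂ e)) = inj₂ (inj₂ e)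
  sw' : EdgeF ((b , u) ∷ (a , t) ∷ ds) → EdgeF ((a , t) ∷ (b , u) ∷ ds)
  sw' (inj₁ m)        = inj₂ (inj₁ m)
  sw' (inj₂ (inj₁ m)) = inj₁ m
  sw' (inj₂ (inj₂ e)) = inj₂ (inj₂ e)
  ft : ∀ e → sw' (sw e) ≡ e
  ft (inj₁ m)        = refl
  ft (inj₂ (inj₁ m)) = refl
  ft (inj₂ (inj₂ e)) = refl
  tf : ∀ e → sw (sw' e) ≡ e
  tf (inj₁ m)        = refl
  tf (inj₂ (inj₁ m)) = refl
  tf (inj₂ (inj₂ e)) = refl
  top' : ∀ e → isTopF ((b , u) ∷ (a , t) ∷ ds) (sw e) ≡ isTopF ((a , t) ∷ (b , u) ∷ ds) e
  top' (inj₁ nothing)         = refl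
  top' (inj₁ (just _))        = refl
  top' (inj₂ (inj₁ nothing))  = refl
  top' (inj₂ (inj₁ (just _))) = refl
  top' (inj₂ (inj₂ e))        = refl
  par' : ∀ e → parentF ((b , u) ∷ (a , t) ∷ ds) (sw e) ≡ sw (parentF ((a , t) ∷ (b , u) ∷ ds) e)
  par' (inj₁ nothing)         = refl
  par' (inj₁ (just _))        = refl
  par' (inj₂ (inj₁ nothing))  = refl
  par' (inj₂ (inj₁ (just _))) = refl
  par' (inj₂ (inj₂ e))        = refl

-- Siblings are matched regardless of their order by moving one chosen tree at a time to the front.
data Pick (u : Tree ⊤) : Forest ⊤ → Forest ⊤ → Set where
  here  : ∀ {b ds} → Pick u ((b , u) ∷ ds) ds
  there : ∀ {x ds ds'} → Pick u ds ds' → Pick u (x ∷ ds) (x ∷ ds')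

EdgeIso-pick : ∀ {u ds ds'} → Pick u ds ds' → EdgeIso (node ((unit , u) ∷ ds')) (node ds)
EdgeIso-pick here = EdgeIso-refl _
EdgeIso-pick {u} (there {x} {ds} {ds'} p) = EdgeIso-trans (EdgeIso-swap (unit , u) x ds')
  (EdgeIso-cons (EdgeIso-refl (proj₂ x)) (EdgeIso-pick p))

EdgeIso⇒≅ : ∀ {t u} → EdgeIso t u → nodeStr t ≅ nodeStr u
EdgeIso⇒≅ {t} {u} i = record
  { to = Data.Maybe.map to ; from = Data.Maybe.map from
  ; from∘to = λ { nothing → refl ; (just e) → cong just (from∘to e) }
  ; to∘from = λ { nothing → refl ; (just e) → cong just (to∘from e) }
  ; to-pres = pres ; to-refl = back }
  where
  open EdgeIso i
  parentNode-to : ∀ e → parentNode u (to e) ≡ Data.Maybe.map to (parentNode t e)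
  parentNode-to e with isTop t e | isTop u (to e) | top e
  ... | true  | .true  | refl = refl
  ... | false | .false | refl = cong just (par-to e)
  pres : ∀ x y → ChildOf t x y → ChildOf u (Data.Maybe.map to x) (Data.Maybe.map to y)
  pres _ _ (child e) = subst (λ z → ChildOf u z (just (to e))) (parentNode-to e) (child (to e))
  inj : ∀ {x y} → Data.Maybe.map to x ≡ Data.Maybe.map to y → x ≡ y
  inj {nothing} {nothing} _ = refl
  inj {just e} {just e'} eq = cong just (trans (sym (from∘to e)) (trans (cong from (just-inj eq)) (from∘to e')))
    where
    just-inj : ∀ {e e'} → just e ≡ just e' → e ≡ e'
    just-inj refl = refl
  back : ∀ x y → ChildOf u (Data.Maybe.map to x) (Data.Maybe.map to y) → ChildOf t x y
  back x y c = go (Data.Maybe.map to x) y refl c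
    where
    parent-of : ∀ {x' e} → ChildOf u x' (just e) → x' ≡ parentNode u e
    parent-of (child e) = refl
    no-parent : ∀ {x'} → ¬ ChildOf u x' nothing
    no-parent ()
    go : ∀ x' y → Data.Maybe.map to x ≡ x' → ChildOf u x' (Data.Maybe.map to y) → ChildOf t x y
    go x' nothing  e c = ⊥-elim (no-parent c)
    go x' (just e) eq c = subst (λ z → ChildOf t z (just e))
      (sym (inj (trans eq (trans (parent-of c) (parentNode-to e))))) (child e)

bool-≡ : ∀ {b c : Bool} → (b ≡ true → c ≡ true) → (c ≡ true → b ≡ true) → b ≡ c
bool-≡ {true}  {true}  f g = refl
bool-≡ {false} {false} f g = refl
bool-≡ {true}  {false} f g = sym (f refl)
bool-≡ {false} {true}  f g = g refl

indicator-positive : ∀ {A : Set} (L : List A) (p q : A → Bool) {z} → z ∈ L → p z ≡ true → q z ≡ true →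
  1ℤ ≤ᶻ sumL L (λ w → ⟦ p w ⟧ *ᶻ ⟦ q w ⟧)
indicator-positive {A} L p q m pz qz = go L m
  where
  term≥0 : ∀ w → 0ℤ ≤ᶻ ⟦ p w ⟧ *ᶻ ⟦ q w ⟧
  term≥0 w with p w | q w
  ... | true  | true  = ℤ.+≤+ z≤n
  ... | true  | false = ℤ.+≤+ z≤n
  ... | false | true  = ℤ.+≤+ z≤n
  ... | false | false = ℤ.+≤+ z≤n
  sum≥0 : ∀ L → 0ℤ ≤ᶻ sumL L (λ w → ⟦ p w ⟧ *ᶻ ⟦ q w ⟧)
  sum≥0 []      = ℤ.+≤+ z≤n
  sum≥0 (w ∷ L) = ℤₚ.+-mono-≤ (term≥0 w) (sum≥0 L)
  go : ∀ L → _ ∈ L → 1ℤ ≤ᶻ sumL L (λ w → ⟦ p w ⟧ *ᶻ ⟦ q w ⟧)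
  go (w ∷ L) (here refl) = ℤₚ.+-mono-≤
    (ℤₚ.≤-reflexive (sym (cong₂ (λ b c → ⟦ b ⟧ *ᶻ ⟦ c ⟧) pz qz))) (sum≥0 L)
  go (w ∷ L) (there m) = ℤₚ.+-mono-≤ (term≥0 w) (go L m)

indicator-witness : ∀ {A : Set} (L : List A) (p q : A → Bool) → 1ℤ ≤ᶻ sumL L (λ w → ⟦ p w ⟧ *ᶻ ⟦ q w ⟧) →
  ∃ λ z → z ∈ L × p z ≡ true × q z ≡ true
indicator-witness [] p q (ℤ.+≤+ ())
indicator-witness (w ∷ L) p q le with p w in ep | q w in eq
... | true  | true  = w , here refl , ep , eq
... | true  | false = later (indicator-witness L p q (subst (1ℤ ≤ᶻ_) (ℤₚ.+-identityˡ _) le))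
  where
  later : _ → _
  later (z , m , r) = z , there m , r
... | false | true  = later (indicator-witness L p q (subst (1ℤ ≤ᶻ_) (ℤₚ.+-identityˡ _) le))
  where
  later : _ → _
  later (z , m , r) = z , there m , r
... | false | false = later (indicator-witness L p q (subst (1ℤ ≤ᶻ_) (ℤₚ.+-identityˡ _) le))
  where
  later : _ → _
  later (z , m , r) = z , there m , r

true-product : ∀ b i → ⟦ b ⟧ *ᶻ i ≢ 0ℤ → b ≡ true
true-product true  i nz = refl
true-product false i nz = ⊥-elim (nz (ℤₚ.*-zeroˡ i))

-- Colours of the nodes of an output

module Colours {s : ℕ} (k : ℕ) (𝒮 : Sys s) (t : List (Path s)) (fs : FS k t) where
  open Sys 𝒮
  open Nodes 𝒮
  open Refinement k 𝒮

  L : List Node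
  L = nlist t

  L-unique : Unique L
  L-unique = nlist-unique (FS.uniq fs)

  children : ℕ → Node → Node → ℤ
  children n u c = sumL L (λ z → ⟦ isChild u z ⟧ *ᶻ ⟦ S t n z c ⟧)

  cls≡ : ∀ n u v c → cls (S t n) (ε u v) L c ≡ children n u c -ᶻ children n v c
  cls≡ n u v c = trans (sum-ext L (λ z → alg ⟦ isChild u z ⟧ ⟦ isChild v z ⟧ ⟦ S t n z c ⟧)) (sum-- L _ _)
    where
    alg : ∀ a b c → (a -ᶻ b) *ᶻ c ≡ a *ᶻ c -ᶻ b *ᶻ c
    alg = solve-∀

  S⇒children : ∀ n {u v} → S t (suc n) u v ≡ true → ∀ {c} → c ∈ L → children n u c ≡ children n v c
  S⇒children n {u} {v} e {c} c∈ = ℤₚ.i-j≡0⇒i≡j _ _ (trans (sym (cls≡ n u v c)) (S-classes t n e c∈))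

  children⇒S : ∀ n {u v} → (∀ {c} → c ∈ L → children n u c ≡ children n v c) → S t (suc n) u v ≡ true
  children⇒S n {u} {v} h = classes⇒S t n λ {c} c∈ → trans (cls≡ n u v c) (ℤₚ.i≡j⇒i-j≡0 (h c∈))

  S-left : ∀ n {x y z} → S t n x y ≡ true → S t n x z ≡ S t n y z
  S-left n = IsEqᵇ.left≡ (S-isEq t n) unit unit unit

  S-sym : ∀ n {x y} → S t n x y ≡ true → S t n y x ≡ true
  S-sym n = IsEqᵇ.sm (S-isEq t n) unit unit

  S-refl : ∀ n {x} → S t n x x ≡ true
  S-refl n = IsEqᵇ.rfl (S-isEq t n) unit

  match : ∀ n {u v} → S t (suc n) u v ≡ true → ∀ {z} → z ∈ L → isChild u z ≡ true →
    ∃ λ z' → z' ∈ L × isChild v z' ≡ true × S t n z' z ≡ true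
  match n {u} {v} e {z} z∈ r = indicator-witness L (isChild v) (λ w → S t n w z)
    (subst (1ℤ ≤ᶻ_) (S⇒children n e z∈) (indicator-positive L (isChild u) (λ w → S t n w z) z∈ r (S-refl n)))

  -- A measure of height that colours detect: level `n` determines which chains of length up to `n`
  -- exist. This bounds how deep the partner of a root can lie.
  Chain : ℕ → Node → Set
  Chain zero    u = ⊤
  Chain (suc j) u = ∃ λ z → z ∈ L × isChild u z ≡ true × Chain j z

  Chain-pred : ∀ j {u} → Chain (suc j) u → Chain j u
  Chain-pred zero    _ = unit
  Chain-pred (suc j) (z , z∈ , r , c) = z , z∈ , r , Chain-pred j c

  S-chain : ∀ j n → j ≤ n → ∀ {u v} → S t n u v ≡ true → Chain j u → Chain j v
  S-chain zero    n le e c = unit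
  S-chain (suc j) (suc n) (s≤s le) e (z , z∈ , r , c) with match n e z∈ r
  ... | z' , z'∈ , r' , e' = z' , z'∈ , r' , S-chain j n le (S-sym n e') c

  record Embeds (τ : Tree ⊤) (ρ : Node) (γ : Maybe (Edge τ) → Node) : Set where
    field
      γ∈     : ∀ x → γ x ∈ L
      γ-inj  : ∀ {x y} → γ x ≡ γ y → x ≡ y
      child⁻ : ∀ x {z} → z ∈ L → isChild (γ x) z ≡ true → ∃ λ e → z ≡ γ (just e) × parentNode τ e ≡ x
      child⁺ : ∀ e → isChild (γ (parentNode τ e)) (γ (just e)) ≡ true
      all⁻   : ∀ {z} → z ∈ L → isChild ρ z ≡ true → ∃ λ x → z ≡ γ x
      all⁺   : ∀ x → isChild ρ (γ x) ≡ true

  -- Isomorphic outputs are two embeddings of one tree `τ`. Corresponding nodes receive equal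
  -- colours at each level, as both child counts become sums over the nodes of `τ` with equal
  -- summands.
  module Bisimulation {τ ρ ρ' γ γ'} (em : Embeds τ ρ γ) (em' : Embeds τ ρ' γ') where
    module G = Embeds em
    module G' = Embeds em'

    nodes : List (Maybe (Edge τ))
    nodes = nothing ∷ map just (edges τ)

    ∈-nodes : ∀ x → x ∈ nodes
    ∈-nodes nothing  = here refl
    ∈-nodes (just e) = there (∈-map⁺ just (∈-edges τ e))

    nodes-unique : Unique nodes
    nodes-unique = All.tabulate apart ∷ Uniq.map⁺ (λ { refl → refl }) (edges-unique τ)
      where
      apart : ∀ {x} → x ∈ map just (edges τ) → nothing ≢ x
      apart m refl with ∈-map⁻ just m
      ... | _ , _ , ()

    children≡ : ∀ {ζ : Maybe (Edge τ) → Node} n u c → (∀ x → ζ x ∈ L) → (∀ {x y} → ζ x ≡ ζ y → x ≡ y) →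
      (∀ {z} → z ∈ L → isChild u z ≡ true → ∃ λ x → z ≡ ζ x) →
      children n u c ≡ sumL nodes (λ x → ⟦ isChild u (ζ x) ⟧ *ᶻ ⟦ S t n (ζ x) c ⟧)
    children≡ {ζ} n u c ζ∈ ζ-inj h = trans
      (sum-support L-unique (Uniq.map⁺ ζ-inj nodes-unique) _ to back)
      (sum-map ζ nodes (λ z → ⟦ isChild u z ⟧ *ᶻ ⟦ S t n z c ⟧))
      where
      to : ∀ {z} → ⟦ isChild u z ⟧ *ᶻ ⟦ S t n z c ⟧ ≢ 0ℤ → z ∈ L → z ∈ map ζ nodes
      to {z} nz z∈ with h z∈ (true-product (isChild u z) _ nz)
      ... | x , refl = ∈-map⁺ ζ (∈-nodes x)
      back : ∀ {z} → ⟦ isChild u z ⟧ *ᶻ ⟦ S t n z c ⟧ ≢ 0ℤ → z ∈ map ζ nodes → z ∈ L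
      back _ m with ∈-map⁻ ζ m
      ... | x , _ , refl = ζ∈ x

    step : ∀ n {u v} → (∀ x → S t n (γ x) (γ' x) ≡ true) → (∀ x → isChild u (γ x) ≡ isChild v (γ' x)) →
      (∀ {z} → z ∈ L → isChild u z ≡ true → ∃ λ x → z ≡ γ x) → (∀ {z} → z ∈ L → isChild v z ≡ true → ∃ λ x → z ≡ γ' x) →
      S t (suc n) u v ≡ true
    step n {u} {v} ih same hu hv = children⇒S n λ {c} _ →
      trans (children≡ n u c G.γ∈ G.γ-inj hu)
      (trans (sum-ext nodes (λ x → cong₂ (λ b d → ⟦ b ⟧ *ᶻ ⟦ d ⟧) (same x) (S-left n (ih x))))
        (sym (children≡ n v c G'.γ∈ G'.γ-inj hv)))

    node-rel : ∀ {ζ ρ} (e : Embeds τ ρ ζ) x y → isChild (ζ x) (ζ y) ≡ true → ∃ λ e → y ≡ just e × parentNode τ e ≡ x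
    node-rel e x y r with Embeds.child⁻ e x (Embeds.γ∈ e y) r
    ... | d , eq , p = d , Embeds.γ-inj e eq , p

    rel≡ : ∀ x y → isChild (γ x) (γ y) ≡ isChild (γ' x) (γ' y)
    rel≡ x y = bool-≡ to back
      where
      to : isChild (γ x) (γ y) ≡ true → isChild (γ' x) (γ' y) ≡ true
      to r with node-rel em x y r
      ... | e , refl , refl = G'.child⁺ e
      back : isChild (γ' x) (γ' y) ≡ true → isChild (γ x) (γ y) ≡ true
      back r with node-rel em' x y r
      ... | e , refl , refl = G.child⁺ e

    bisimilar : ∀ n x → S t n (γ x) (γ' x) ≡ true
    bisimilar zero    x = refl
    bisimilar (suc n) x = step n (bisimilar n) (rel≡ x)
      (λ z∈ r → let e , eq , _ = G.child⁻ x z∈ r in just e , eq)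
      (λ z∈ r → let e , eq , _ = G'.child⁻ x z∈ r in just e , eq)

    roots-bisimilar : ∀ n → S t (suc n) ρ ρ' ≡ true
    roots-bisimilar n = step n (bisimilar n) (λ x → trans (G.all⁺ x) (sym (G'.all⁺ x))) G.all⁻ G'.all⁻

  tops : (cs : Forest ⊤) → (EdgeF cs → Node) → List Node
  tops []             δ = []
  tops ((a , _) ∷ cs) δ = δ (inj₁ nothing) ∷ tops cs (δ ∘ inj₂)

  Kids : Node → List Node → Set
  Kids u zs = Unique zs × (∀ {z} → z ∈ L → isChild u z ≡ true → z ∈ zs)
    × (∀ {z} → z ∈ zs → z ∈ L × isChild u z ≡ true)

  mutual
    -- The recursive form of an embedding. Each node comes with a duplicate-free list of its
    -- children, so that inductions over forests need not speak of parent functions.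
    Shape : (τ : Tree ⊤) → (Maybe (Edge τ) → Node) → Set
    Shape (node cs) γ = Kids (γ nothing) (tops cs (γ ∘ just)) × ShapeF cs (γ ∘ just)

    ShapeF : (cs : Forest ⊤) → (EdgeF cs → Node) → Set
    ShapeF []             δ = ⊤
    ShapeF ((a , τ) ∷ cs) δ = Shape τ (δ ∘ inj₁) × ShapeF cs (δ ∘ inj₂)

  ∈-tops⁻ : ∀ cs δ {z} → z ∈ tops cs δ → ∃ λ e → isTopF cs e ≡ true × z ≡ δ e
  ∈-tops⁻ ((a , τ) ∷ cs) δ (here refl) = inj₁ nothing , refl , refl
  ∈-tops⁻ ((a , τ) ∷ cs) δ (there m) with ∈-tops⁻ cs (δ ∘ inj₂) m
  ... | e , top , eq = inj₂ e , top , eq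

  ∈-tops⁺ : ∀ cs δ e → isTopF cs e ≡ true → δ e ∈ tops cs δ
  ∈-tops⁺ ((a , τ) ∷ cs) δ (inj₁ nothing)  top = here refl
  ∈-tops⁺ ((a , τ) ∷ cs) δ (inj₁ (just e)) ()
  ∈-tops⁺ ((a , τ) ∷ cs) δ (inj₂ e)        top = there (∈-tops⁺ cs (δ ∘ inj₂) e top)

  tops-unique : ∀ cs δ → (∀ {e e'} → δ e ≡ δ e' → e ≡ e') → Unique (tops cs δ)
  tops-unique []             δ inj = []
  tops-unique ((a , τ) ∷ cs) δ inj = All.tabulate apart ∷ tops-unique cs (δ ∘ inj₂) (λ eq → inj₂-inj (inj eq))
    where
    inj₂-inj : ∀ {A B : Set} {x y : B} → inj₂ {A = A} x ≡ inj₂ y → x ≡ y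
    inj₂-inj refl = refl
    apart : ∀ {z} → z ∈ tops cs (δ ∘ inj₂) → δ (inj₁ nothing) ≢ z
    apart m eq with ∈-tops⁻ cs (δ ∘ inj₂) m
    ... | e , _ , eq' with inj (trans eq eq')
    ...   | ()

  record SubF (cs : Forest ⊤) (δ : EdgeF cs → Node) : Set where
    field
      δ∈     : ∀ e → δ e ∈ L
      δ-inj  : ∀ {e e'} → δ e ≡ δ e' → e ≡ e'
      child⁻ : ∀ x {z} → z ∈ L → isChild (δ x) z ≡ true →
               ∃ λ e → z ≡ δ e × isTopF cs e ≡ false × parentF cs e ≡ x
      child⁺ : ∀ e → isTopF cs e ≡ false → isChild (δ (parentF cs e)) (δ e) ≡ true

  record Sub (τ : Tree ⊤) (γ : Maybe (Edge τ) → Node) : Set where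
    field
      γ∈     : ∀ x → γ x ∈ L
      γ-inj  : ∀ {x y} → γ x ≡ γ y → x ≡ y
      child⁻ : ∀ x {z} → z ∈ L → isChild (γ x) z ≡ true → ∃ λ e → z ≡ γ (just e) × parentNode τ e ≡ x
      child⁺ : ∀ e → isChild (γ (parentNode τ e)) (γ (just e)) ≡ true

  head-sub : ∀ {a τ cs δ} → SubF ((a , τ) ∷ cs) δ → Sub τ (δ ∘ inj₁)
  head-sub {a} {τ} {cs} {δ} su = record
    { γ∈ = λ x → δ∈ (inj₁ x) ; γ-inj = λ eq → inj₁-inj (δ-inj eq)
    ; child⁻ = λ x z∈ r → restrict x (child⁻ (inj₁ x) z∈ r) ; child⁺ = λ e → child⁺ (inj₁ (just e)) refl }
    where
    open SubF su
    inj₁-inj : ∀ {A B : Set} {x y : A} → inj₁ {B = B} x ≡ inj₁ y → x ≡ y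
    inj₁-inj refl = refl
    restrict : ∀ x {z} → (∃ λ e → z ≡ δ e × isTopF ((a , τ) ∷ cs) e ≡ false × parentF ((a , τ) ∷ cs) e ≡ inj₁ x) →
      ∃ λ e → z ≡ δ (inj₁ (just e)) × parentNode τ e ≡ x
    restrict x (inj₁ (just e) , eq , _ , p) = e , eq , inj₁-inj p
    restrict x (inj₁ nothing , eq , () , p)
    restrict x (inj₂ e , eq , _ , ())

  tail-sub : ∀ {a τ cs δ} → SubF ((a , τ) ∷ cs) δ → SubF cs (δ ∘ inj₂)
  tail-sub {a} {τ} {cs} {δ} su = record
    { δ∈ = λ x → δ∈ (inj₂ x) ; δ-inj = λ eq → inj₂-inj (δ-inj eq)
    ; child⁻ = λ x z∈ r → restrict x (child⁻ (inj₂ x) z∈ r) ; child⁺ = λ e → child⁺ (inj₂ e) }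
    where
    open SubF su
    inj₂-inj : ∀ {A B : Set} {x y : B} → inj₂ {A = A} x ≡ inj₂ y → x ≡ y
    inj₂-inj refl = refl
    restrict : ∀ x {z} → (∃ λ e → z ≡ δ e × isTopF ((a , τ) ∷ cs) e ≡ false × parentF ((a , τ) ∷ cs) e ≡ inj₂ x) →
      ∃ λ e → z ≡ δ (inj₂ e) × isTopF cs e ≡ false × parentF cs e ≡ x
    restrict x (inj₂ e , eq , top , p) = e , eq , top , inj₂-inj p
    restrict x (inj₁ nothing , eq , () , p)
    restrict x (inj₁ (just e) , eq , _ , ())

  node-parts : ∀ {cs γ} → Sub (node cs) γ → Kids (γ nothing) (tops cs (γ ∘ just)) × SubF cs (γ ∘ just)
  node-parts {cs} {γ} su = (tops-unique cs (γ ∘ just) just-inj , listed , are) , record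
    { δ∈ = λ e → γ∈ (just e) ; δ-inj = just-inj
    ; child⁻ = λ x z∈ r → below x (child⁻ (just x) z∈ r)
    ; child⁺ = λ e top → subst (λ x → isChild (γ x) (γ (just e)) ≡ true) (inner e top) (child⁺ e) }
    where
    open Sub su
    just-inj : ∀ {e e'} → γ (just e) ≡ γ (just e') → e ≡ e'
    just-inj eq with γ-inj eq
    ... | refl = refl
    inner : ∀ e → isTopF cs e ≡ false → parentNode (node cs) e ≡ just (parentF cs e)
    inner e top rewrite top = refl
    outer : ∀ e → isTopF cs e ≡ true → parentNode (node cs) e ≡ nothing
    outer e top rewrite top = refl
    listed : ∀ {z} → z ∈ L → isChild (γ nothing) z ≡ true → z ∈ tops cs (γ ∘ just)
    listed z∈ r with child⁻ nothing z∈ r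
    ... | e , refl , p with isTopF cs e in top
    ...   | true = ∈-tops⁺ cs (γ ∘ just) e top
    listed z∈ r | e , refl , () | false
    are : ∀ {z} → z ∈ tops cs (γ ∘ just) → z ∈ L × isChild (γ nothing) z ≡ true
    are m with ∈-tops⁻ cs (γ ∘ just) m
    ... | e , top , refl = γ∈ (just e) , subst (λ x → isChild (γ x) (γ (just e)) ≡ true) (outer e top) (child⁺ e)
    below : ∀ x {z} → (∃ λ e → z ≡ γ (just e) × parentNode (node cs) e ≡ just x) →
      ∃ λ e → z ≡ γ (just e) × isTopF cs e ≡ false × parentF cs e ≡ x
    below x (e , eq , p) with isTopF cs e in top
    below x (e , eq , refl) | false = e , eq , top , refl
    below x (e , eq , ())   | true

  mutual
    shape : ∀ τ γ → Sub τ γ → Shape τ γ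
    shape (node cs) γ su with node-parts su
    ... | kids , suF = kids , shapeF cs (γ ∘ just) suF

    shapeF : ∀ cs δ → SubF cs δ → ShapeF cs δ
    shapeF []             δ su = unit
    shapeF ((a , τ) ∷ cs) δ su = shape τ (δ ∘ inj₁) (head-sub su) , shapeF cs (δ ∘ inj₂) (tail-sub su)

  mutual
    -- For a deeper edge the recursion yields a longer chain than needed, which `Chain-pred`
    -- shortens again.
    chain-up : ∀ τ γ → Shape τ γ → ∀ e j → Chain j (γ (just e)) → Chain (suc j) (γ nothing)
    chain-up (node cs) γ ((_ , _ , are) , sh) e j c = chain-upF cs (γ ∘ just) (λ m → are m) sh e j c

    chain-upF : ∀ cs δ {u} → (∀ {z} → z ∈ tops cs δ → z ∈ L × isChild u z ≡ true) → ShapeF cs δ →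
      ∀ e j → Chain j (δ e) → Chain (suc j) u
    chain-upF ((a , τ) ∷ cs) δ are (sh , shs) (inj₁ nothing) j c =
      _ , proj₁ (are (here refl)) , proj₂ (are (here refl)) , c
    chain-upF ((a , τ) ∷ cs) δ are (sh , shs) (inj₁ (just e)) j c =
      _ , proj₁ (are (here refl)) , proj₂ (are (here refl)) , Chain-pred j (chain-up τ (δ ∘ inj₁) sh e j c)
    chain-upF ((a , τ) ∷ cs) δ are (sh , shs) (inj₂ e) j c = chain-upF cs (δ ∘ inj₂) (are ∘ there) shs e j c

  mutual
    chain-height : ∀ n τ γ → HeightLE n τ → Shape τ γ → ¬ Chain (suc n) (γ nothing)
    chain-height n (node cs) γ hl ((_ , listed , _) , sh) (z , z∈ , r , c) =
      chain-heightF n cs (γ ∘ just) hl sh (listed z∈ r) c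

    chain-heightF : ∀ n cs δ → HeightLEF n cs → ShapeF cs δ → ∀ {z} → z ∈ tops cs δ → ¬ Chain n z
    chain-heightF (suc n) ((a , τ) ∷ cs) δ (hl , _) (sh , _) (here refl) c = chain-height n τ (δ ∘ inj₁) hl sh c
    chain-heightF (suc n) ((a , τ) ∷ cs) δ (_ , hl) (_ , shs) (there m) c =
      chain-heightF (suc n) cs (δ ∘ inj₂) hl shs m c

  chain-any : ∀ τ γ → Shape τ γ → ∀ x j → Chain j (γ x) → Chain j (γ nothing)
  chain-any τ γ sh nothing  j c = c
  chain-any τ γ sh (just e) j c = Chain-pred j (chain-up τ γ sh e j c)

  -- If the root corresponded to a proper descendant of the other root, and
  -- conversely, then chains of every length would start at both roots.
  roots-match : ∀ n {τ τ' ρ ρ' γ γ'} → HeightLE n τ' → Shape τ γ → Shape τ' γ' →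
    Embeds τ ρ γ → Embeds τ' ρ' γ' → S t (suc n) ρ ρ' ≡ true → S t n (γ nothing) (γ' nothing) ≡ true
  roots-match n {τ} {τ'} {ρ} {ρ'} {γ} {γ'} hl sh sh' em em' e
    with match n e (G.γ∈ nothing) (G.all⁺ nothing) | match n (S-sym (suc n) e) (G'.γ∈ nothing) (G'.all⁺ nothing)
    where
    module G = Embeds em
    module G' = Embeds em'
  ... | z' , z'∈ , r' , e' | z , z∈ , r , e'' with Embeds.all⁻ em' z'∈ r' | Embeds.all⁻ em z∈ r
  ...   | nothing , refl | _        = S-sym n e'
  ...   | just d , refl  | x , refl = ⊥-elim (chain-height n τ' γ' hl sh'
          (chain-up τ' γ' sh' d n (S-chain n n ℕₚ.≤-refl (S-sym n e') (grow n ℕₚ.≤-refl))))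
    where
    grow : ∀ j → j ≤ n → Chain j (γ nothing)
    grow zero    le = unit
    grow (suc j) le = chain-any τ γ sh x (suc j) (S-chain (suc j) n le (S-sym n e'')
      (chain-up τ' γ' sh' d j (S-chain j n (ℕₚ.≤-trans (ℕₚ.n≤1+n j) le) (S-sym n e')
        (grow j (ℕₚ.≤-trans (ℕₚ.n≤1+n j) le)))))

  children-listed : ∀ n {u zs} → Kids u zs → ∀ c → children n u c ≡ sumL zs (λ z → ⟦ true ⟧ *ᶻ ⟦ S t n z c ⟧)
  children-listed n {u} {zs} (uq , listed , are) c = trans
    (sum-support L-unique uq _ (λ {z} nz z∈ → listed z∈ (true-product (isChild u z) _ nz)) (λ _ m → proj₁ (are m)))
    (sum-cong zs (λ {z} m → cong (λ b → ⟦ b ⟧ *ᶻ ⟦ S t n z c ⟧) (proj₂ (are m))))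

  record Picked (n : ℕ) (ds : Forest ⊤) (δ : EdgeF ds → Node) (z : Node) : Set where
    field
      u      : Tree ⊤
      ds'    : Forest ⊤
      pick   : Pick u ds ds'
      γ      : Maybe (Edge u) → Node
      δ'     : EdgeF ds' → Node
      root   : γ nothing ≡ z
      hu     : HeightLE n u
      hds'   : HeightLEF (suc n) ds'
      shu    : Shape u γ
      shds'  : ShapeF ds' δ'
      sums   : ∀ h → sumL (tops ds δ) h ≡ h z +ᶻ sumL (tops ds' δ') h
      subset : ∀ {y} → y ∈ tops ds' δ' → y ∈ tops ds δ

  pick-top : ∀ n ds δ {z} → HeightLEF (suc n) ds → ShapeF ds δ → z ∈ tops ds δ → Picked n ds δ z
  pick-top n ((b , u) ∷ ds) δ (hu , hds) (shu , shds) (here refl) = record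
    { u = u ; ds' = ds ; pick = here ; γ = δ ∘ inj₁ ; δ' = δ ∘ inj₂ ; root = refl ; hu = hu ; hds' = hds
    ; shu = shu ; shds' = shds ; sums = λ h → refl ; subset = there }
  pick-top n ((b , v) ∷ ds) δ {z} (hv , hds) (shv , shds) (there m) = record
    { u = P.u ; ds' = (b , v) ∷ P.ds' ; pick = there P.pick ; γ = P.γ ; δ' = δ'' ; root = P.root ; hu = P.hu
    ; hds' = hv , P.hds' ; shu = P.shu ; shds' = shv , P.shds'
    ; sums = λ h → trans (cong (h (δ (inj₁ nothing)) +ᶻ_) (P.sums h)) (alg (h (δ (inj₁ nothing))) (h z) _)
    ; subset = λ { (here refl) → here refl ; (there m') → there (P.subset m') } }
    where
    module P = Picked (pick-top n ds (δ ∘ inj₂) hds shds m)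
    δ'' : EdgeF ((b , v) ∷ P.ds') → Node
    δ'' (inj₁ x) = δ (inj₁ x)
    δ'' (inj₂ e) = P.δ' e
    alg : ∀ a b c → a +ᶻ (b +ᶻ c) ≡ b +ᶻ (a +ᶻ c)
    alg = solve-∀

  mutual
    trees-match : ∀ n τ τ' γ γ' → HeightLE n τ → HeightLE n τ' → Shape τ γ → Shape τ' γ' →
      S t n (γ nothing) (γ' nothing) ≡ true → EdgeIso τ τ'
    trees-match zero    (node [])      (node [])      γ γ' hl hl' sh sh' e = EdgeIso-refl (node [])
    trees-match (suc n) (node cs) (node ds) γ γ' hl hl' (kids , sh) (kids' , sh') e =
      forests-match n cs ds (γ ∘ just) (γ' ∘ just) hl hl' sh sh'
        (λ m → proj₁ (proj₂ (proj₂ kids) m)) (λ m → proj₁ (proj₂ (proj₂ kids') m))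
        λ {c} c∈ → trans (sym (children-listed n kids c)) (trans (S⇒children n e c∈) (children-listed n kids' c))

    -- The count for the colour of the first tree is positive, so the other forest has a tree of
    -- that colour. Both are removed; having equal colours they contributed equally to every count,
    -- so the counts of the remaining forests still agree.
    forests-match : ∀ n cs ds δ δ' → HeightLEF (suc n) cs → HeightLEF (suc n) ds → ShapeF cs δ → ShapeF ds δ' →
      (∀ {z} → z ∈ tops cs δ → z ∈ L) → (∀ {z} → z ∈ tops ds δ' → z ∈ L) →
      (∀ {c} → c ∈ L → sumL (tops cs δ) (λ z → ⟦ true ⟧ *ᶻ ⟦ S t n z c ⟧) ≡ sumL (tops ds δ') (λ z → ⟦ true ⟧ *ᶻ ⟦ S t n z c ⟧)) →
      EdgeIso (node cs) (node ds)
    forests-match n [] [] δ δ' hl hl' sh sh' in-L in-L' same = EdgeIso-refl (node [])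
    forests-match n [] ((b , u) ∷ ds) δ δ' hl hl' sh sh' in-L in-L' same =
      ⊥-elim (absurd (subst (1ℤ ≤ᶻ_) (sym (same (in-L' (here refl))))
        (indicator-positive (tops ((b , u) ∷ ds) δ') (λ _ → true) (λ w → S t n w (δ' (inj₁ nothing))) (here refl) refl (S-refl n))))
      where
      absurd : ¬ (1ℤ ≤ᶻ 0ℤ)
      absurd (ℤ.+≤+ ())
    forests-match n ((a , τ) ∷ cs) ds δ δ' (hτ , hcs) hl' (shτ , shcs) sh' in-L in-L' same
      with indicator-witness (tops ds δ') (λ _ → true) (λ w → S t n w (δ (inj₁ nothing)))
             (subst (1ℤ ≤ᶻ_) (same (in-L (here refl)))
               (indicator-positive (tops ((a , τ) ∷ cs) δ) (λ _ → true) (λ w → S t n w (δ (inj₁ nothing))) (here refl) refl (S-refl n)))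
    ... | z , z∈ , _ , e = EdgeIso-trans
        (EdgeIso-cons {b = unit} (trees-match n τ P.u (δ ∘ inj₁) P.γ hτ P.hu shτ P.shu
            (subst (λ w → S t n (δ (inj₁ nothing)) w ≡ true) (sym P.root) (S-sym n e)))
          (forests-match n cs P.ds' (δ ∘ inj₂) P.δ' hcs P.hds' shcs P.shds'
            (in-L ∘ there) (in-L' ∘ P.subset) rest))
        (EdgeIso-pick P.pick)
      where
      module P = Picked (pick-top n ds δ' hl' sh' z∈)
      cancel : ∀ a {b c} → a +ᶻ b ≡ a +ᶻ c → b ≡ c
      cancel a {b} {c} eq = trans (alg a b) (trans (cong (-ᶻ a +ᶻ_) eq) (sym (alg a c)))
        where
        alg : ∀ a b → b ≡ -ᶻ a +ᶻ (a +ᶻ b)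
        alg = solve-∀
      rest : ∀ {c} → c ∈ L → _
      rest {c} c∈ = cancel (⟦ true ⟧ *ᶻ ⟦ S t n z c ⟧) (trans
        (cong (λ b → ⟦ true ⟧ *ᶻ ⟦ b ⟧ +ᶻ sumL (tops cs (δ ∘ inj₂)) (λ w → ⟦ true ⟧ *ᶻ ⟦ S t n w c ⟧)) (S-left n e))
        (trans (same c∈) (P.sums (λ w → ⟦ true ⟧ *ᶻ ⟦ S t n w c ⟧))))

  Embeds⇒Sub : ∀ {τ ρ γ} → Embeds τ ρ γ → Sub τ γ
  Embeds⇒Sub em = record { γ∈ = γ∈ ; γ-inj = γ-inj ; child⁻ = child⁻ ; child⁺ = child⁺ }
    where open Embeds em

  outputs-match : ∀ n {τ τ' ρ ρ' γ γ'} → HeightLE n τ → HeightLE n τ' → Embeds τ ρ γ → Embeds τ' ρ' γ' →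
    S t (suc n) ρ ρ' ≡ true → nodeStr τ ≅ nodeStr τ'
  outputs-match n {τ} {τ'} {γ = γ} {γ'} hl hl' em em' e = EdgeIso⇒≅
    (trees-match n τ τ' γ γ' hl hl' sh sh' (roots-match n hl' sh sh' em em' e))
    where
    sh = shape τ γ (Embeds⇒Sub em)
    sh' = shape τ' γ' (Embeds⇒Sub em')

T⇒≡ : ∀ {b} → T b → b ≡ true
T⇒≡ {true} _ = refl

≡⇒T : ∀ {b} → b ≡ true → T b
≡⇒T refl = unit

∧-split : ∀ {b c} → b ∧ c ≡ true → b ≡ true × c ≡ true
∧-split {true} {true} _ = refl , refl

-- The outputs of the interpretations as embedded trees

module Outputs {s : ℕ} (k : ℕ) (f g : Interp s) (t : Tree (Fin s)) (hl : HeightLE k t) where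
  open Pair f g
  open Sys sys
  open Nodes sys
  open Colours k sys (paths t) (paths-FS t hl)

  map-injective : ∀ {d} (v w : Vec (Edge t) d) → Vec.map (root-code t) v ≡ Vec.map (root-code t) w → v ≡ w
  map-injective []      []      eq = refl
  map-injective (e ∷ v) (d ∷ w) eq =
    cong₂ _∷_ (code-inj t [] (Vecₚ.∷-injectiveˡ eq)) (map-injective v w (Vecₚ.∷-injectiveʳ eq))

  preimage : ∀ {d} (w : Vec (Path s) d) → All (_∈ paths t) (toList w) → ∃ λ v → w ≡ Vec.map (root-code t) v
  preimage []      []       = [] , refl
  preimage (π ∷ w) (m ∷ ms) with ∈-map⁻ (root-code t) m | preimage w ms
  ... | e , _ , refl | v , refl = e ∷ v , refl

  codes∈ : ∀ {d} (v : Vec (Edge t) d) → All (_∈ paths t) (toList (Vec.map (root-code t) v))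
  codes∈ []      = []
  codes∈ (e ∷ v) = ∈-paths t e ∷ codes∈ v

  -- The common form of the two halves of the system, so that one proof embeds both outputs.
  record Side (h : Interp s) (ρ : Node) : Set where
    field
      α       : (i : Fin (comps h)) → Vec (Path s) (dim h i) → Node
      α-pts   : ∀ i v → pts (α i v) ≡ toList v
      α-inj   : ∀ {i j v w} → α i v ≡ α j w → (i , v) ≡ (j , w)
      α-rel   : ∀ i j v w → isChild (α i v) (α j w) ≡ relOf h i j v w
      α-child : ∀ i v z → isChild (α i v) z ≡ true → ∃ λ j → ∃ λ w → z ≡ α j w
      ρ-rel   : ∀ j w → isChild ρ (α j w) ≡ evalᵖ w (dom h j)
      ρ-child : ∀ z → isChild ρ z ≡ true → ∃ λ j → ∃ λ w → z ≡ α j w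

  side₁ : Side f (ρ₁ , [])
  side₁ = record
    { α = λ i v → first i , v ; α-pts = λ i v → refl ; α-inj = λ { refl → refl } ; α-rel = λ i j v w → refl
    ; α-child = λ { i v (first j , w) _ → j , w , refl }
    ; ρ-rel = λ j w → refl ; ρ-child = λ { (first j , w) _ → j , w , refl } }

  side₂ : Side g (ρ₂ , [])
  side₂ = record
    { α = λ i v → second i , v ; α-pts = λ i v → refl ; α-inj = λ { refl → refl } ; α-rel = λ i j v w → refl
    ; α-child = λ { i v (second j , w) _ → j , w , refl }
    ; ρ-rel = λ j w → refl ; ρ-child = λ { (second j , w) _ → j , w , refl } }

  module _ {h : Interp s} {ρ : Node} (side : Side h ρ) where
    open Side side

    place : Carrier (apply h t) → Node
    place (i , v , _) = α i (Vec.map (root-code t) v)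

    place∈ : ∀ x → place x ∈ L
    place∈ (i , v , _) = ∈-nlist⁺ _ (subst (All (_∈ paths t)) (sym (α-pts i _)) (codes∈ v))

    place-inj : ∀ x y → place x ≡ place y → x ≡ y
    place-inj (i , v , a) (j , w , b) eq = same (α-inj eq) a b
      where
      same : ∀ {j w} → (i , Vec.map (root-code t) v) ≡ (j , Vec.map (root-code t) w) →
        (a : T (evalQF t v (dom h i))) (b : T (evalQF t w (dom h j))) →
        _≡_ {A = Carrier (apply h t)} (i , v , a) (j , w , b)
      same {j} {w} eq a b with cong proj₁ eq
      ... | refl with map-injective v w (vec eq)
        where
        vec : ∀ {i} {v w : Vec (Path s) (dim h i)} →
          _≡_ {A = Σ (Fin (comps h)) (λ i → Vec (Path s) (dim h i))} (i , v) (i , w) → v ≡ w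
        vec refl = refl
      ...   | refl = cong (λ a → i , v , a) (Boolₚ.T-irrelevant a b)

    find-node : ∀ j w → α j w ∈ L → evalᵖ w (dom h j) ≡ true → ∃ λ y → α j w ≡ place y
    find-node j w m d with preimage w (subst (All (_∈ paths t)) (α-pts j w) (∈-nlist⁻ m))
    ... | v , refl = (j , v , ≡⇒T (trans (sym (eval-code t v (dom h j))) d)) , refl

    place-rel : ∀ x y → isChild (place x) (place y) ≡ true → Rel (apply h t) x y
    place-rel (i , v , a) (j , w , b) r
      with ∧-split {evalᵖ (Vec.map (root-code t) v) (dom h i)} (trans (sym (α-rel i j _ _)) r)
    ... | _ , r' with ∧-split {evalᵖ (Vec.map (root-code t) w) (dom h j)} r'
    ...   | _ , r'' = ≡⇒T (trans (sym (eval-code t (v Vec.++ w) (rel h i j)))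
              (trans (cong (λ u → evalᵖ u (rel h i j)) (Vecₚ.map-++ (root-code t) v w)) r''))

    rel-place : ∀ x y → Rel (apply h t) x y → isChild (place x) (place y) ≡ true
    rel-place (i , v , a) (j , w , b) r = trans (α-rel i j _ _)
      (cong₂ _∧_ (trans (eval-code t v (dom h i)) (T⇒≡ a))
        (cong₂ _∧_ (trans (eval-code t w (dom h j)) (T⇒≡ b))
          (trans (cong (λ u → evalᵖ u (rel h i j)) (sym (Vecₚ.map-++ (root-code t) v w)))
            (trans (eval-code t (v Vec.++ w) (rel h i j)) (T⇒≡ r)))))

    embeds : ∀ {τ} → (ι : apply h t ≅ nodeStr τ) → Embeds τ ρ (place ∘ _≅_.from ι)
    embeds {τ} ι = record
      { γ∈ = λ x → place∈ (from x)
      ; γ-inj = λ {x} {y} eq → trans (sym (to∘from x)) (trans (cong to (place-inj (from x) (from y) eq)) (to∘from y))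
      ; child⁻ = child⁻
      ; child⁺ = λ e → rel-place (from (parentNode τ e)) (from (just e)) (to-refl _ _
          (subst₂ (ChildOf τ) (sym (to∘from (parentNode τ e))) (sym (to∘from (just e))) (child e)))
      ; all⁻ = λ {z} z∈ r → all⁻ z z∈ r (ρ-child z r)
      ; all⁺ = λ x → all⁺ (from x) }
      where
      open _≅_ ι
      back : ∀ y → place y ≡ place (from (to y))
      back y = cong place (sym (from∘to y))
      child⁻ : ∀ x {z} → z ∈ L → isChild (place (from x)) z ≡ true →
        ∃ λ e → z ≡ place (from (just e)) × parentNode τ e ≡ x
      child⁻ x {z} z∈ r with α-child _ _ z r
      ... | j , w , refl with ∧-split {evalᵖ (Vec.map (root-code t) (proj₁ (proj₂ (from x)))) (dom h (proj₁ (from x)))}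
                                (trans (sym (α-rel (proj₁ (from x)) j _ w)) r)
      ...   | _ , r' with find-node j w z∈ (proj₁ (∧-split r'))
      ...     | y , eq = finish (to y) refl (to-pres (from x) y
                  (place-rel (from x) y (trans (cong (isChild (place (from x))) (sym eq)) r)))
        where
        finish : ∀ u → to y ≡ u → ChildOf τ (to (from x)) u → ∃ λ e → z ≡ place (from (just e)) × parentNode τ e ≡ x
        finish u eu c = go c (to∘from x) eu
          where
          go : ∀ {p u} → ChildOf τ p u → p ≡ x → to y ≡ u → ∃ λ e → z ≡ place (from (just e)) × parentNode τ e ≡ x
          go (child e) ep eu = e , trans eq (trans (back y) (cong (place ∘ from) eu)) , ep
      all⁻ : ∀ z → z ∈ L → isChild ρ z ≡ true → (∃ λ j → ∃ λ w → z ≡ α j w) → ∃ λ x → z ≡ place (from x)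
      all⁻ _ z∈ r (j , w , refl) with find-node j w z∈ (trans (sym (ρ-rel j w)) r)
      ... | y , eq = to y , trans eq (back y)
      all⁺ : ∀ y → isChild ρ (place y) ≡ true
      all⁺ (j , w , b) = trans (ρ-rel j _) (trans (eval-code t w (dom h j)) (T⇒≡ b))

  iso⇒S : ∀ n {m} → InM m (apply f t) → apply f t ≅ apply g t →
    Refinement.S k sys (paths t) (suc n) (ρ₁ , []) (ρ₂ , []) ≡ true
  -- The output of `g` is read through `iso` as the same tree `τ`, so that both embeddings have one
  -- source.
  iso⇒S n (τ , _ , ι) iso = Bisimulation.roots-bisimilar
    (embeds side₁ ι) (embeds side₂ (≅-trans (≅-sym iso) ι)) n

  S⇒iso : ∀ n → InM n (apply f t) → InM n (apply g t) →
    Refinement.S k sys (paths t) (suc n) (ρ₁ , []) (ρ₂ , []) ≡ true → apply f t ≅ apply g t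
  S⇒iso n (τ , hτ , ι) (τ' , hτ' , ι') e = ≅-trans ι (≅-trans
    (outputs-match n hτ hτ' (embeds side₁ ι) (embeds side₂ ι') e) (≅-sym ι'))

theorem5p1 : (s k n : ℕ) (f g : Interp s)
    → ((t : Tree (Fin s)) → HeightLE k t → InM n (apply f t))
    → ((t : Tree (Fin s)) → HeightLE k t → InM n (apply g t))
    → Dec ((t : Tree (Fin s)) → HeightLE k t → apply f t ≅ apply g t)
-- Level `n` settles trees of height `n`; the additional level leads from the virtual roots to their
-- children.
theorem5p1 s k n f g inf ing = decide (E (suc n) (ρ₁ , []) (ρ₂ , [])) refl
  where
  open Pair f g
  open Generic k sys
  open Refinement k sys
  open Construction k sys (suc n)
  open Make profile
  decide : ∀ b → E (suc n) (ρ₁ , []) (ρ₂ , []) ≡ b → Dec ((t : Tree (Fin s)) → HeightLE k t → apply f t ≅ apply g t)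
  decide true e = yes λ t hl → Outputs.S⇒iso k f g t hl n (inf t hl) (ing t hl)
    -- The virtual roots are empty tuples and hence lie over every tree.
    (E⇒S (paths-FS t hl) (suc n) {ρ₁ , []} {ρ₂ , []} [] [] e)
  -- Isomorphic outputs on `G` would give the virtual roots equal colours there, but on `G` colours
  -- agree with `E`.
  decide false e = no λ iso → impossible (trans (sym e) (trans
      (sym (S≡E (paths-FS G hl) generic (suc n) ℕₚ.≤-refl {ρ₁ , []} {ρ₂ , []} [] []))
      (Outputs.iso⇒S k f g G hl n (inf G hl) (iso G hl))))
    where
    G : Tree (Fin s)
    G = make k []
    hl : HeightLE k G
    hl = make-height k []
    generic : IsGeneric (suc n) (paths G)
    generic = profile-generic (paths-FS G hl) (paths-make⁻ k) (paths-make⁺ k)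
    impossible : false ≢ true
    impossible ()
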